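{- \textsc{Weighted Vertex Integrity} can be solved in time $2^{O(\mathrm{vc}(G))} n^{O(1)}$, where $n$ is the number of vertices of the input graph $G$.
   Context: Graphs are finite, simple and undirected; $\mathrm{vc}(G)$ is the vertex cover number of $G$. For $w: V(G) \to \mathbb{Z}^+$ and $X \subseteq V(G)$, $w(X) = \sum_{x\in X} w(x)$. The weighted vertex integrity is $\mathrm{wvi}(G) = \min_{S \subseteq V(G)} \{ w(S) + \max_{D} w(D) \}$, the maximum ranging over connected components $D$ of $G - S$. \textsc{Weighted Vertex Integrity}: given a graph $G$, vertex weights $w: V(G) \to \mathbb{Z}^+$ encoded in binary, and an integer $k$, decide whether $\mathrm{wvi}(G) \le k$. -}

module Defs where

open import Data.Bool.Base using (Bool; if_then_else_)
open import Data.Fin.Base using (Fin)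
open import Data.Fin.Properties using (any?; all?)
open import Data.Fin.Subset using (Subset; inside; outside; ⊤; ⁅_⁆; _∈_; _∉_; _∪_; ∣_∣)
open import Data.Fin.Subset.Properties
  using (_∈?_; ∈⊤; ∣p∣≤n; ∣p∣≡n⇒p≡⊤; p⊆p∪q; q⊆p∪q; x∈p∪q⁻; x∈⁅x⁆; x∈⁅y⁆⇒x≡y; p⊂q⇒∣p∣<∣q∣)
open import Data.Integer.Base using (ℤ; +_; -[1+_])
open import Data.List.Base
  using (List; []; _∷_; _++_; map; concatMap; filter; allFin)
open import Data.List.Extrema.Nat using (min; max)
open import Data.Nat.ListAction using (sum)
open import Data.Nat.Base using (ℕ; zero; suc; _+_; _∸_; _≤_; NonZero)
open import Data.Nat.Properties
  using (_≟_; ≤-antisym; ≤-trans; ≤-reflexive; +-suc; +-monoʳ-≤; m≤m+n)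
open import Data.Product.Base using (∃₂; _×_; _,_)
open import Data.Sum.Base using (_⊎_; inj₁; inj₂)
open import Data.Vec.Base as Vec using ()
open import Function.Base using (_∘_)
open import Level using (0ℓ)
open import Relation.Binary.Construct.Closure.ReflexiveTransitive
  using (Star; ε; _◅_; _◅◅_)
open import Relation.Binary.Core using (Rel)
open import Relation.Binary.Definitions using (Decidable; Symmetric)
open import Relation.Binary.PropositionalEquality.Core using (_≡_; refl; sym; subst)
open import Relation.Nullary.Decidable.Core
  using (Dec; yes; no; does; _×-dec_; _⊎-dec_; _→-dec_; ¬?)
open import Relation.Nullary.Negation.Core using (¬_; contradiction)

------------------------------------------------------------------------
-- Graphs and subsets of vertices

record Graph (n : ℕ) : Set₁ where
  field
    Adj       : Rel (Fin n) 0ℓ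
    Adj?      : Decidable Adj
    symmetric : Symmetric Adj
    loopless  : ∀ {v} → ¬ Adj v v

open Graph public

allSubsets : ∀ n → List (Subset n)
allSubsets zero    = Vec.[] ∷ []
allSubsets (suc n) =
  map (outside Vec.∷_) (allSubsets n) ++ map (inside Vec.∷_) (allSubsets n)

weight : ∀ {n} → (Fin n → ℕ) → Subset n → ℕ
weight w X = sum (map w (filter (_∈? X) (allFin _)))

------------------------------------------------------------------------
-- Vertex cover number

IsVertexCover : ∀ {n} → Graph n → Subset n → Set
IsVertexCover G C = ∀ u v → Adj G u v → u ∈ C ⊎ v ∈ C

isVertexCover? : ∀ {n} (G : Graph n) (C : Subset n) → Dec (IsVertexCover G C)
isVertexCover? G C =
  all? λ u → all? λ v → Adj? G u v →-dec (u ∈? C ⊎-dec v ∈? C)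

-- The first argument of `min` also counts as a candidate; here it is the
-- size of the cover consisting of all vertices.
vc : ∀ {n} → Graph n → ℕ
vc {n} G = min n (map ∣_∣ (filter (isVertexCover? G) (allSubsets n)))

------------------------------------------------------------------------
-- Decidability of reachability in a finite digraph

module _ {n : ℕ} {R : Rel (Fin n) 0ℓ} (R? : Decidable R) where

  private
    Exit : Subset n → Set
    Exit A = ∃₂ λ x y → x ∈ A × y ∉ A × R x y

    exit? : ∀ A → Dec (Exit A)
    exit? A = any? λ x → any? λ y → x ∈? A ×-dec ¬? (y ∈? A) ×-dec R? x y

    stays : ∀ {A x y} → ¬ Exit A → x ∈ A → Star R x y → y ∈ A
    stays closed x∈A ε = x∈A
    stays {A} closed x∈A (_◅_ {j = z} r rs) with z ∈? A
    ... | yes z∈A = stays closed z∈A rs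
    ... | no  z∉A = contradiction (_ , _ , x∈A , z∉A , r) closed

    -- A is a set of vertices known to be reachable from u.  It is enlarged
    -- until no edge leaves it; k bounds the number of enlargements.
    explore : ∀ k u (A : Subset n) → n ≤ k + ∣ A ∣ → u ∈ A →
              (∀ {x} → x ∈ A → Star R u x) → ∀ v → Dec (Star R u v)
    explore k u A n≤k+∣A∣ u∈A sound v with exit? A
    explore k u A n≤k+∣A∣ u∈A sound v | no closed with v ∈? A
    ... | yes v∈A = yes (sound v∈A)
    ... | no  v∉A = no (v∉A ∘ stays closed u∈A)
    explore zero u A n≤∣A∣ u∈A sound v | yes (x , y , _ , y∉A , _) =
      contradiction
        (subst (y ∈_) (sym (∣p∣≡n⇒p≡⊤ (≤-antisym (∣p∣≤n A) n≤∣A∣))) ∈⊤) y∉A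
    explore (suc k) u A n≤k+∣A∣ u∈A sound v | yes (x , y , x∈A , y∉A , r) =
      explore k u A′ bound (p⊆p∪q ⁅ y ⁆ u∈A) sound′ v
      where
      A′ : Subset n
      A′ = A ∪ ⁅ y ⁆

      bound : n ≤ k + ∣ A′ ∣
      bound = ≤-trans n≤k+∣A∣ (≤-trans (≤-reflexive (sym (+-suc k ∣ A ∣)))
        (+-monoʳ-≤ k
          (p⊂q⇒∣p∣<∣q∣ (p⊆p∪q ⁅ y ⁆ , y , q⊆p∪q A ⁅ y ⁆ (x∈⁅x⁆ y) , y∉A))))

      sound′ : ∀ {z} → z ∈ A′ → Star R u z
      sound′ z∈A′ with x∈p∪q⁻ A ⁅ y ⁆ z∈A′
      ... | inj₁ z∈A = sound z∈A
      ... | inj₂ z∈y =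
        subst (Star R u) (sym (x∈⁅y⁆⇒x≡y y z∈y)) (sound x∈A ◅◅ r ◅ ε)

  reachable? : Decidable (Star R)
  reachable? u =
    explore n u ⁅ u ⁆ (m≤m+n n ∣ ⁅ u ⁆ ∣) (x∈⁅x⁆ u)
      (λ x∈u → subst (Star R u) (sym (x∈⁅y⁆⇒x≡y u x∈u)) ε)

------------------------------------------------------------------------
-- Weighted vertex integrity

module _ {n : ℕ} (G : Graph n) (S : Subset n) where

  -- The edges of G - S.
  AdjOff : Rel (Fin n) 0ℓ
  AdjOff u v = u ∉ S × v ∉ S × Adj G u v

  adjOff? : Decidable AdjOff
  adjOff? u v = ¬? (u ∈? S) ×-dec ¬? (v ∈? S) ×-dec Adj? G u v

  component : Fin n → Subset n
  component v = Vec.tabulate λ u → does (reachable? adjOff? v u)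

  -- Every component of G - S occurs, once for each of its vertices.
  components : List (Subset n)
  components = map component (filter (λ v → ¬? (v ∈? S)) (allFin n))

-- The maximum over no components (S the whole vertex set) is 0.
maxComponentWeight : ∀ {n} → Graph n → (Fin n → ℕ) → Subset n → ℕ
maxComponentWeight G w S = max 0 (map (weight w) (components G S))

integrity : ∀ {n} → Graph n → (Fin n → ℕ) → Subset n → ℕ
integrity G w S = weight w S + maxComponentWeight G w S

wvi : ∀ {n} → Graph n → (Fin n → ℕ) → ℕ
wvi {n} G w = min (integrity G w ⊤) (map (integrity G w) (allSubsets n))

------------------------------------------------------------------------
-- A random access machine with structured programs
--
-- There are registers and an indirectly addressed memory, both holding
-- natural numbers of any size.  Every operation costs 1.  The only
-- arithmetic is addition and truncated subtraction, so a step lengthens the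
-- binary representation of the largest stored number by O(1) bits, and the
-- unit cost is polynomially related to the bit cost.

infixl 6 _⊕_ _⊖_
infix  4 _≔_ mem[_]≔_
infixr 3 _⨾_

data Exp : Set where
  lit     : ℕ → Exp
  reg     : ℕ → Exp
  mem[_]  : Exp → Exp
  _⊕_ _⊖_ : Exp → Exp → Exp

data Program : Set where
  skip     : Program
  _≔_      : ℕ → Exp → Program
  mem[_]≔_ : Exp → Exp → Program
  _⨾_      : Program → Program → Program
  cond     : Exp → Program → Program → Program
  while    : Exp → Program → Program

record State : Set where
  constructor ⟨_,_⟩
  field
    registers : ℕ → ℕ
    memory    : ℕ → ℕ

open State public

_[_↦_] : (ℕ → ℕ) → ℕ → ℕ → (ℕ → ℕ)
(f [ a ↦ x ]) b = if does (b ≟ a) then x else f b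

⟦_⟧ : Exp → State → ℕ
⟦ lit m ⟧    s = m
⟦ reg r ⟧    s = registers s r
⟦ mem[ e ] ⟧ s = memory s (⟦ e ⟧ s)
⟦ e ⊕ f ⟧    s = ⟦ e ⟧ s + ⟦ f ⟧ s
⟦ e ⊖ f ⟧    s = ⟦ e ⟧ s ∸ ⟦ f ⟧ s

cost : Exp → ℕ
cost (lit m)    = 1
cost (reg r)    = 1
cost (mem[ e ]) = 1 + cost e
cost (e ⊕ f)    = 1 + cost e + cost f
cost (e ⊖ f)    = 1 + cost e + cost f

-- s ⊢ P ⇓[ t ] s′: started in s, the program P halts in s′ after time t.
-- A test succeeds when its value is nonzero.
infix 2 _⊢_⇓[_]_

data _⊢_⇓[_]_ : State → Program → ℕ → State → Set where

  ⇓skip : ∀ {s} → s ⊢ skip ⇓[ 1 ] s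

  ⇓reg : ∀ {s r e} →
    s ⊢ r ≔ e ⇓[ 1 + cost e ] ⟨ registers s [ r ↦ ⟦ e ⟧ s ] , memory s ⟩

  ⇓mem : ∀ {s e f} →
    s ⊢ mem[ e ]≔ f ⇓[ 1 + cost e + cost f ]
      ⟨ registers s , memory s [ ⟦ e ⟧ s ↦ ⟦ f ⟧ s ] ⟩

  ⇓seq : ∀ {s s′ s″ P Q t u} →
    s ⊢ P ⇓[ t ] s′ → s′ ⊢ Q ⇓[ u ] s″ → s ⊢ P ⨾ Q ⇓[ t + u ] s″

  ⇓then : ∀ {s s′ e P Q t} → NonZero (⟦ e ⟧ s) →
    s ⊢ P ⇓[ t ] s′ → s ⊢ cond e P Q ⇓[ 1 + cost e + t ] s′

  ⇓else : ∀ {s s′ e P Q t} → ⟦ e ⟧ s ≡ 0 →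
    s ⊢ Q ⇓[ t ] s′ → s ⊢ cond e P Q ⇓[ 1 + cost e + t ] s′

  ⇓stop : ∀ {s e P} → ⟦ e ⟧ s ≡ 0 →
    s ⊢ while e P ⇓[ 1 + cost e ] s

  ⇓loop : ∀ {s s′ s″ e P t u} → NonZero (⟦ e ⟧ s) →
    s ⊢ P ⇓[ t ] s′ → s′ ⊢ while e P ⇓[ u ] s″ →
    s ⊢ while e P ⇓[ 1 + cost e + t + u ] s″

------------------------------------------------------------------------
-- Input and output

bit : Bool → ℕ
bit b = if b then 1 else 0

-- Sign (1 if negative) and absolute value.
encodeℤ : ℤ → List ℕ
encodeℤ (+ m)    = 0 ∷ m ∷ []
encodeℤ -[1+ m ] = 1 ∷ suc m ∷ []

-- The number of vertices, k, the weights, and the adjacency matrix by rows.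
encode : ∀ {n} → Graph n → (Fin n → ℕ) → ℤ → List ℕ
encode {n} G w k =
  n ∷ encodeℤ k ++ map w (allFin n) ++
  concatMap (λ u → map (λ v → bit (does (Adj? G u v))) (allFin n)) (allFin n)

-- Cells beyond the end of the input contain 0.
load : List ℕ → ℕ → ℕ
load []       _       = 0
load (x ∷ xs) zero    = x
load (x ∷ xs) (suc a) = load xs a

initial : List ℕ → State
initial input = ⟨ (λ _ → 0) , load input ⟩

output : State → ℕ
output s = registers s 0

module Submission where

-- Let C be the set of ends of a greedily chosen maximal matching: a vertex
-- cover with at most 2 vc(G) vertices.  Fix the deleted part s of C.  If
-- p ⊆ C - s is the trace in C of a union of components, then every vertex
-- outside C with a neighbour in p and all neighbours in p ∪ s may be kept,
-- since deleting it instead costs as much as it can save; call p with these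
-- vertices the region of p.  A vertex with all neighbours in s is isolated.
-- Everything else outside C has to be deleted.  Hence, given a bound ℓ on the
-- weight of a component, it remains to partition C - s into sets p without
-- edges between them and with regions of weight at most ℓ such that the total
-- weight of the regions is largest: a dynamic program over the subsets of C.
-- The only bounds ℓ to be tried are the maxima of the weight of the region of
-- some q ⊆ C and the largest weight of an isolated vertex, so that there are
-- 2^O(|C|) pairs (s , q).
--
-- The machine program is compiled from a language in which every loop runs n
-- or 2^|C| times; its running time is therefore bounded by a polynomial in
-- n 2^|C|, which can be read off the syntax.

open import Defs
open import Data.Bool.Base using (Bool; true; false; if_then_else_; _∧_; _∨_; not)
open import Data.Bool.Properties using (∧-identityʳ; ∧-zeroʳ; ¬-not) renaming (_≟_ to _≟ᵇ_)
open import Data.Empty using (⊥; ⊥-elim)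
open import Data.Fin.Base using (Fin; zero; suc; toℕ; fromℕ<; inject₁; fromℕ)
open import Data.Fin.Properties using (all?; toℕ<n; toℕ-fromℕ<; ¬∀⟶∃¬; toℕ-inject₁; toℕ-fromℕ; toℕ-injective)
open import Data.Fin.Subset as Subset using (Subset; inside; outside; _∈_; _∉_; ∣_∣)
open import Data.Fin.Subset.Properties using (_∈?_)
open import Data.Integer.Base as ℤ using (ℤ; -[1+_])
import Data.Integer.Properties as ℤ
open import Data.List.Base using (List; []; _∷_; _++_; map; concatMap; filter; allFin; length; tabulate)
open import Data.List.Extrema.Nat using (max≤v⁺; xs≤max; argmin-sel; argmin-all; min≤xs)
open import Data.List.Membership.Propositional using () renaming (_∈_ to _∈ˡ_)
open import Data.List.Membership.Propositional.Properties using (∈-map⁺; ∈-map⁻; ∈-filter⁺; ∈-allFin; ∈-++⁺ˡ; ∈-++⁺ʳ)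
open import Data.List.Properties using (map-tabulate; length-tabulate)
import Data.List.Relation.Unary.All as Allˡ
import Data.List.Relation.Unary.All.Properties as Allˡ
open import Data.List.Relation.Unary.Any using (here)
import Data.Nat.ListAction as ListAction
open import Data.Nat.Base
open import Data.Nat.Properties renaming (_≤?_ to _≤ⁿ?_)
open import Data.Nat.Solver using (module +-*-Solver)
open import Data.Product.Base using (Σ-syntax; ∃; _×_; _,_; proj₁; proj₂)
open import Data.Sum.Base using (_⊎_; inj₁; inj₂; [_,_]′)
open import Data.Unit.Base using (⊤; tt)
open import Data.Vec.Base as Vec using (Vec; []; _∷_; lookup)
open import Data.Vec.Properties using (lookup-map; lookup∘tabulate; lookup⇒[]=; []=⇒lookup)
open import Data.Vec.Relation.Unary.All as All using (All; []; _∷_)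
open import Function.Base using (_∘_; id)
open import Relation.Binary.Construct.Closure.ReflexiveTransitive using (Star; ε; _◅_; _◅◅_; reverse)
open import Relation.Binary.PropositionalEquality
open import Relation.Nullary.Decidable using (dec-true; dec-false; ¬?)
open import Relation.Nullary.Decidable.Core using (Dec; yes; no; does)
open import Relation.Nullary.Negation.Core using (¬_; contradiction)

open import Algebra.Properties.CommutativeMonoid.Sum +-0-commutativeMonoid
  using (sum; sum-cong-≗; ∑-distrib-+; sum-init-last)
open +-*-Solver using (solve; _:+_; _:=_; con)

-- A language of loop programs and its compilation

-- Weights are binary, so neither `ℓ` nor the weight of the deleted set can be enumerated; both have
-- to come from subsets of the cover. The reason that this is possible is an exchange: a vertex that
-- is kept instead of deleted moves its weight from the deleted set into one component, so the
-- deleted weight plus the weight of that component does not grow. After all such exchanges the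
-- solution is determined by `s` and the traces of the components, and the only weights that `ℓ` has
-- to dominate are those of regions and of isolated vertices.
--
-- The table maximises the kept weight, because regions of different blocks are disjoint and their
-- weights add up, while a vertex outside C with neighbours in two blocks lies in neither region and
-- is deleted without being mentioned.
--
-- Subsets of C are numbers in which a disjoint union is a sum and a difference of nested sets is a
-- subtraction, so that the machine needs no set operations to address the table. Since any
-- polynomial in the number of subsets is allowed, trying all `(s , q)` and filling each table over
-- all `(f , p)` is affordable, and so is a cover of twice the minimum size.

data Range : Set where
  small large : Range

counter : Range → Fin 4
counter small = zero
counter large = suc zero

infixl 6 _⊹_ _∸ᵗ_

mutual
  -- Pure terms with d free variables.  The body of a loop binds the index
  -- (variable 0) and the accumulator (variable 1).
  data Term (d : ℕ) : Set where
    var       : Fin d → Term d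
    glob      : Fin 4 → Term d
    const     : ℕ → Term d
    _⊹_ _∸ᵗ_  : Term d → Term d → Term d
    read      : Term d → Term d
    ite       : Term d → Term d → Term d → Term d
    loop      : Range → Term d → Term (2 + d) → Term d
    call      : ∀ {k} → Term k → Args k d → Term d

  -- A called term sees only its arguments. Subroutines are thus written once, and no weakening or
  -- substitution of terms is needed.
  data Args : ℕ → ℕ → Set where
    []  : ∀ {d} → Args 0 d
    _∷_ : ∀ {k d} → Term d → Args k d → Args (suc k) d

infixr 5 _∷_

-- Terms read the memory but never change it, so that their values are plain equations; writing is
-- confined to commands, which only the table requires.
data Command (d : ℕ) : Set where
  ret     : Term d → Command d
  store   : Term d → Term d → Command d
  bind    : Command d → Command (suc d) → Command d
  repeat  : Range → Term d → Command (2 + d) → Command d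

iter : ∀ {A : Set} → ℕ → (ℕ → A → A) → A → A
iter zero    f x = x
iter (suc k) f x = f k (iter k f x)

branch : ℕ → ℕ → ℕ → ℕ
branch zero    x y = y
branch (suc _) x y = x

Memory : Set
Memory = ℕ → ℕ

module Semantics (γ : Vec ℕ 4) where

  mutual
    eval : ∀ {d} → Memory → Term d → Vec ℕ d → ℕ
    eval μ (var i)      e = lookup e i
    eval μ (glob g)     e = lookup γ g
    eval μ (const x)    e = x
    eval μ (t ⊹ u)      e = eval μ t e + eval μ u e
    eval μ (t ∸ᵗ u)     e = eval μ t e ∸ eval μ u e
    eval μ (read t)     e = μ (eval μ t e)
    eval μ (ite c t u)  e = branch (eval μ c e) (eval μ t e) (eval μ u e)
    eval μ (loop r t u) e =
      iter (lookup γ (counter r)) (λ i x → eval μ u (i ∷ x ∷ e)) (eval μ t e)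
    eval μ (call t as)  e = eval μ t (evals μ as e)

    evals : ∀ {k d} → Memory → Args k d → Vec ℕ d → Vec ℕ k
    evals μ []       e = []
    evals μ (t ∷ as) e = eval μ t e ∷ evals μ as e

  exec : ∀ {d} → Command d → Vec ℕ d → Memory → ℕ × Memory
  exec (ret t)        e μ = eval μ t e , μ
  exec (store t u)    e μ = 0 , μ [ eval μ t e ↦ eval μ u e ]
  exec (bind c k)     e μ = exec k (proj₁ (exec c e μ) ∷ e) (proj₂ (exec c e μ))
  exec (repeat r t c) e μ =
    iter (lookup γ (counter r)) (λ i p → exec c (i ∷ proj₁ p ∷ e) (proj₂ p)) (eval μ t e , μ)

open Semantics public

-- The value of a term is left in register d; registers below d, which hold
-- the globals and the variables (at ρ), are not written.

globals : Vec ℕ 4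
globals = 0 ∷ 1 ∷ 2 ∷ 3 ∷ []

range : ℕ → (k : ℕ) → Vec ℕ k
range d zero    = []
range d (suc k) = d ∷ range (suc d) k

-- Register `d` is the accumulator, `1 + d` the index and `2 + d` the result of the body. The
-- truncated difference is nonzero exactly while the index is below the counter.
whileProgram : Range → ℕ → Program → Program
whileProgram r d P =
  while (reg (lookup globals (counter r)) ⊖ reg (1 + d))
    (P ⨾ (d ≔ reg (2 + d) ⨾ 1 + d ≔ reg (1 + d) ⊕ lit 1))

loopProgram : Range → ℕ → Program → Program → Program
loopProgram r d P Q = P ⨾ (1 + d ≔ lit 0 ⨾ whileProgram r d Q)

mutual
  compile : ∀ {k} → Term k → Vec ℕ k → ℕ → Program
  compile (var i)      ρ d = d ≔ reg (lookup ρ i)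
  compile (glob g)     ρ d = d ≔ reg (lookup globals g)
  compile (const x)    ρ d = d ≔ lit x
  compile (t ⊹ u)      ρ d = compile t ρ d ⨾ (compile u ρ (1 + d) ⨾ d ≔ reg d ⊕ reg (1 + d))
  compile (t ∸ᵗ u)     ρ d = compile t ρ d ⨾ (compile u ρ (1 + d) ⨾ d ≔ reg d ⊖ reg (1 + d))
  compile (read t)     ρ d = compile t ρ d ⨾ d ≔ mem[ reg d ]
  compile (ite c t u)  ρ d = compile c ρ d ⨾ cond (reg d) (compile t ρ d) (compile u ρ d)
  compile (loop r t u) ρ d =
    loopProgram r d (compile t ρ d) (compile u (1 + d ∷ d ∷ ρ) (2 + d))
  compile (call {k} t as) ρ d =
    -- The arguments occupy the registers from `d` on and become the variables of the callee, which
    -- works above them.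
    compileArgs as ρ d ⨾ (compile t (range d k) (k + d) ⨾ d ≔ reg (k + d))

  compileArgs : ∀ {m k} → Args m k → Vec ℕ k → ℕ → Program
  compileArgs []       ρ d = skip
  compileArgs (t ∷ as) ρ d = compile t ρ d ⨾ compileArgs as ρ (1 + d)

compileCommand : ∀ {k} → Command k → Vec ℕ k → ℕ → Program
compileCommand (ret t)        ρ d = compile t ρ d
compileCommand (store t u)    ρ d =
  compile t ρ d ⨾ (compile u ρ (1 + d) ⨾ (mem[ reg d ]≔ reg (1 + d) ⨾ d ≔ lit 0))
compileCommand (bind c k)     ρ d =
  compileCommand c ρ d ⨾ (compileCommand k (d ∷ ρ) (1 + d) ⨾ d ≔ reg (1 + d))
compileCommand (repeat r t c) ρ d =
  loopProgram r d (compile t ρ d) (compileCommand c (1 + d ∷ d ∷ ρ) (2 + d))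

-- Each round pays 4 for the test and 6 for copying the result and advancing the index. The 2 sets
-- the index to 0, and the last 4 is the test that fails.
loopTime : ℕ → ℕ → ℕ → ℕ
loopTime K t u = t + (2 + (K * (4 + (u + 6)) + 4))

mutual
  -- Both branches of a conditional are charged, so that the bound depends on the syntax and on the
  -- bound `K` on the loop counters alone.
  time : ∀ {d} → ℕ → Term d → ℕ
  time K (var i)      = 2
  time K (glob g)     = 2
  time K (const x)    = 2
  time K (t ⊹ u)      = time K t + (time K u + 4)
  time K (t ∸ᵗ u)     = time K t + (time K u + 4)
  time K (read t)     = time K t + 3
  time K (ite c t u)  = time K c + (2 + (time K t + time K u))
  time K (loop r t u) = loopTime K (time K t) (time K u)
  time K (call t as)  = timeArgs K as + (time K t + 2)

  timeArgs : ∀ {k d} → ℕ → Args k d → ℕ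
  timeArgs K []       = 1
  timeArgs K (t ∷ as) = time K t + timeArgs K as

timeCommand : ∀ {d} → ℕ → Command d → ℕ
timeCommand K (ret t)        = time K t
timeCommand K (store t u)    = time K t + (time K u + (3 + 2))
timeCommand K (bind c k)     = timeCommand K c + (timeCommand K k + 2)
timeCommand K (repeat r t c) = loopTime K (time K t) (timeCommand K c)

-- Memories can be compared by equality of functions without extensionality, as every store of the
-- machine is literally the update made by `exec`.
record Outcome (s : State) (P : Program) (b d : ℕ) (x : ℕ) (μ : Memory) : Set where
  constructor outcome
  field
    {steps}   : ℕ
    {final}   : State
    runs      : s ⊢ P ⇓[ steps ] final
    fast      : steps ≤ b
    yields     : registers final d ≡ x
    frame     : ∀ {r} → r < d → registers final r ≡ registers s r
    remembers : memory final ≡ μ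

open Outcome

record Holds (s : State) {k : ℕ} (ρ : Vec ℕ k) (γ : Vec ℕ 4) (e : Vec ℕ k) (μ : Memory) : Set where
  constructor holds
  field
    holds-globals   : Vec.map (registers s) globals ≡ γ
    holds-variables : Vec.map (registers s) ρ ≡ e
    holds-memory    : memory s ≡ μ

open Holds

update-same : ∀ f d x → (f [ d ↦ x ]) d ≡ x
update-same f d x = cong (if_then x else f d) (dec-true (d ≟ d) refl)

update-other : ∀ f d x {r} → r ≢ d → (f [ d ↦ x ]) r ≡ f r
update-other f d x {r} r≢d = cong (if_then x else f r) (dec-false (r ≟ d) r≢d)

put : State → ℕ → ℕ → State
put s d x = ⟨ registers s [ d ↦ x ] , memory s ⟩

put-same : ∀ s d x → registers (put s d x) d ≡ x
put-same s = update-same (registers s)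

put-other : ∀ s d x {r} → r ≢ d → registers (put s d x) r ≡ registers s r
put-other s = update-other (registers s)

put-below : ∀ s d x {r} → r < d → registers (put s d x) r ≡ registers s r
put-below s d x r<d = put-other s d x (<⇒≢ r<d)

map-frame : ∀ (f g : ℕ → ℕ) {d k} {ρ : Vec ℕ k} → All (_< d) ρ →
            (∀ {r} → r < d → f r ≡ g r) → Vec.map f ρ ≡ Vec.map g ρ
map-frame f g []           eq = refl
map-frame f g (r<d ∷ ρ<d) eq = cong₂ _∷_ (eq r<d) (map-frame f g ρ<d eq)

globals-below : ∀ {d} → 4 ≤ d → All (_< d) globals
globals-below 4≤d =
  ≤-trans (s≤s z≤n) 4≤d ∷ ≤-trans (s≤s (s≤s z≤n)) 4≤d ∷
  ≤-trans (s≤s (s≤s (s≤s z≤n))) 4≤d ∷ 4≤d ∷ []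

holds-frame : ∀ {s s′ d k} {ρ : Vec ℕ k} {γ e μ μ′} → 4 ≤ d → All (_< d) ρ →
              Holds s ρ γ e μ → (∀ {r} → r < d → registers s′ r ≡ registers s r) →
              memory s′ ≡ μ′ → Holds s′ ρ γ e μ′
holds-frame {s} 4≤d ρ<d h same eq = holds
  (trans (map-frame _ (registers s) (globals-below 4≤d) same) (holds-globals h))
  (trans (map-frame _ (registers s) ρ<d same) (holds-variables h))
  eq

lookup-variable : ∀ {s k} {ρ : Vec ℕ k} {γ e μ} → Holds s ρ γ e μ →
                  ∀ i → registers s (lookup ρ i) ≡ lookup e i
lookup-variable {s} {ρ = ρ} h i =
  trans (sym (lookup-map i (registers s) ρ)) (cong (λ e → lookup e i) (holds-variables h))

lookup-global : ∀ {s k} {ρ : Vec ℕ k} {γ e μ} → Holds s ρ γ e μ →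
                ∀ g → registers s (lookup globals g) ≡ lookup γ g
lookup-global {s} h g =
  trans (sym (lookup-map g (registers s) globals)) (cong (λ γ → lookup γ g) (holds-globals h))

weaken : ∀ {d k} {ρ : Vec ℕ k} → All (_< d) ρ → All (_< suc d) ρ
weaken = All.map m<n⇒m<1+n

range-below : ∀ d k → All (_< k + d) (range d k)
range-below d zero    = []
range-below d (suc k) =
  s≤s (m≤n+m d k) ∷ subst (λ m → All (_< m) (range (suc d) k)) (+-suc k d) (range-below (suc d) k)

outcome-assign : ∀ {s d x} E → ⟦ E ⟧ s ≡ x → Outcome s (d ≔ E) (1 + cost E) d x (memory s)
outcome-assign {s} {d} E eq =
  outcome ⇓reg ≤-refl (trans (put-same s d _) eq) (put-below s d _) refl

outcome-seq : ∀ {s P Q b c d d′ x y μ ν} → d ≤ d′ → (p : Outcome s P b d′ x μ) →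
              (Outcome (final p) Q c d y ν) → Outcome s (P ⨾ Q) (b + c) d y ν
outcome-seq d≤d′ p q = outcome (⇓seq (runs p) (runs q)) (+-mono-≤ (fast p) (fast q)) (yields q)
  (λ r<d → trans (frame q r<d) (frame p (≤-trans r<d d≤d′))) (remembers q)

outcome-≤ : ∀ {s P b c d x μ} → b ≤ c → Outcome s P b d x μ → Outcome s P c d x μ
outcome-≤ b≤c p = outcome (runs p) (≤-trans (fast p) b≤c) (yields p) (frame p) (remembers p)

outcome-remembering : ∀ {s P b d x μ ν} → μ ≡ ν → Outcome s P b d x μ → Outcome s P b d x ν
outcome-remembering refl p = p

-- Loops of terms and of commands compile to the same code. Here `f` acts on accumulator and memory
-- together; a loop in a term is the case in which the memory stays the same.
module Loop {k : ℕ} (r : Range) (d : ℕ) (4≤d : 4 ≤ d) {ρ : Vec ℕ k} (ρ<d : All (_< d) ρ)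
            (γ : Vec ℕ 4) (e : Vec ℕ k) (Q : Program) (b : ℕ) (f : ℕ → ℕ × Memory → ℕ × Memory)
            (body : ∀ {s μ} i x → Holds s (1 + d ∷ d ∷ ρ) γ (i ∷ x ∷ e) μ →
                    Outcome s Q b (2 + d) (proj₁ (f i (x , μ))) (proj₂ (f i (x , μ)))) where

  private
    N : ℕ
    N = lookup γ (counter r)

    difference : ∀ {s i x μ} → Holds s (1 + d ∷ d ∷ ρ) γ (i ∷ x ∷ e) μ →
                 registers s (lookup globals (counter r)) ∸ registers s (1 + d) ≡ N ∸ i
    difference h = cong₂ _∸_ (lookup-global h (counter r))
                             (lookup-variable h zero)

  iterations : ∀ p j i {s} → j + i ≡ N →
               Holds s (1 + d ∷ d ∷ ρ) γ (i ∷ proj₁ (iter i f p) ∷ e) (proj₂ (iter i f p)) →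
               Outcome s (whileProgram r d Q) (j * (4 + (b + 6)) + 4) d
                 (proj₁ (iter N f p)) (proj₂ (iter N f p))
  iterations p zero i {s} refl h =
    outcome (⇓stop (trans (difference h) (n∸n≡0 i))) ≤-refl
      (lookup-variable h (suc zero)) (λ _ → refl) (holds-memory h)
  iterations p (suc j) i {s} eq h = outcome
    (⇓loop (>-nonZero (subst (0 <_) (sym (difference h)) (m<n⇒0<n∸m (subst (i <_) eq (s≤s (m≤n+m i j))))))
           (⇓seq (runs one) (⇓seq ⇓reg ⇓reg)) (runs rest))
    (≤-trans (+-mono-≤ (+-monoʳ-≤ 4 (+-monoˡ-≤ 6 (fast one))) (fast rest))
             (≤-reflexive (sym (+-assoc (4 + (b + 6)) (j * (4 + (b + 6))) 4))))
    (yields rest) (λ r<d → trans (frame rest r<d) (same r<d)) (remembers rest)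
    where
    x′ = proj₁ (iter (suc i) f p)

    one : Outcome s Q b (2 + d) x′ (proj₂ (iter (suc i) f p))
    one = body i _ h

    copied after : State
    copied = put (final one) d (registers (final one) (2 + d))
    after  = put copied (1 + d) (registers copied (1 + d) + 1)

    same : ∀ {r} → r < d → registers after r ≡ registers s r
    same r<d = trans (put-below copied (1 + d) _ (m<n⇒m<1+n r<d))
      (trans (put-below (final one) d _ r<d) (frame one (m<n⇒m<1+n (m<n⇒m<1+n r<d))))

    index : registers after (1 + d) ≡ suc i
    index = trans (put-same copied (1 + d) _)
      (trans (cong (_+ 1) (trans (put-other (final one) d _ 1+n≢n)
        (trans (frame one ≤-refl) (lookup-variable h zero)))) (+-comm i 1))

    accumulator : registers after d ≡ x′
    accumulator = trans (put-below copied (1 + d) _ ≤-refl)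
      (trans (put-same (final one) d _) (yields one))

    rest : Outcome after (whileProgram r d Q) (j * (4 + (b + 6)) + 4) d
             (proj₁ (iter N f p)) (proj₂ (iter N f p))
    rest = iterations p j (suc i) (trans (+-suc j i) eq) (holds
      (trans (map-frame _ (registers s) (globals-below 4≤d) same) (holds-globals h))
      (cong₂ _∷_ index (cong₂ _∷_ accumulator
        (trans (map-frame _ (registers s) ρ<d same) (cong (Vec.tail ∘ Vec.tail) (holds-variables h)))))
      (remembers one))

  outcome-loop : ∀ {s P μ₀ c x μ K} → Holds s ρ γ e μ₀ → N ≤ K → Outcome s P c d x μ →
                 Outcome s (loopProgram r d P Q) (loopTime K c b) d
                   (proj₁ (iter N f (x , μ))) (proj₂ (iter N f (x , μ)))
  outcome-loop {s} {x = x} {μ} {K} h N≤K p = outcome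
    (⇓seq (runs p) (⇓seq ⇓reg (runs loops)))
    (+-mono-≤ (fast p) (+-monoʳ-≤ 2 (≤-trans (fast loops) (+-monoˡ-≤ 4 (*-monoˡ-≤ (4 + (b + 6)) N≤K)))))
    (yields loops)
    (λ r<d → trans (frame loops r<d) (same r<d))
    (remembers loops)
    where
    start : State
    start = put (final p) (1 + d) 0

    same : ∀ {r} → r < d → registers start r ≡ registers s r
    same r<d = trans (put-below (final p) (1 + d) 0 (m<n⇒m<1+n r<d)) (frame p r<d)

    h′ : Holds start ρ γ e (memory start)
    h′ = holds-frame 4≤d ρ<d h same refl

    loops : Outcome start (whileProgram r d Q) (N * (4 + (b + 6)) + 4) d
              (proj₁ (iter N f (x , μ))) (proj₂ (iter N f (x , μ)))
    loops = iterations (x , μ) N 0 (+-identityʳ N) (holds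
      (holds-globals h′)
      (cong₂ _∷_ (put-same (final p) (1 + d) 0) (cong₂ _∷_
        (trans (put-below (final p) (1 + d) 0 ≤-refl) (yields p)) (holds-variables h′)))
      (remembers p))

-- Bridges `Loop`, which threads the memory through the iteration, and `eval`, which iterates on the
-- number only.
iter-pair : ∀ (f : Memory → ℕ → ℕ → ℕ) k x μ →
            iter k (λ i p → f (proj₂ p) i (proj₁ p) , proj₂ p) (x , μ) ≡ (iter k (f μ) x , μ)
iter-pair f zero    x μ = refl
iter-pair f (suc k) x μ = cong (λ p → f (proj₂ p) k (proj₁ p) , proj₂ p) (iter-pair f k x μ)

-- Correctness and running time of compiled programs

module _ {γ : Vec ℕ 4} {K : ℕ} (counter≤K : ∀ r → lookup γ (counter r) ≤ K) where

  mutual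
    compile-correct : ∀ {k} (t : Term k) {s ρ d e μ} → 4 ≤ d → All (_< d) ρ → Holds s ρ γ e μ →
                      Outcome s (compile t ρ d) (time K t) d (eval γ μ t e) μ
    compile-correct (var i)     4≤d ρ<d h =
      outcome-remembering (holds-memory h) (outcome-assign _ (lookup-variable h i))
    compile-correct (glob g)    4≤d ρ<d h =
      outcome-remembering (holds-memory h) (outcome-assign _ (lookup-global h g))
    compile-correct (const x)   4≤d ρ<d h =
      outcome-remembering (holds-memory h) (outcome-assign _ refl)
    compile-correct (t ⊹ u)     4≤d ρ<d h = operation t u _+_ _⊕_ (λ _ _ _ → refl) (λ _ _ → refl) 4≤d ρ<d h
    compile-correct (t ∸ᵗ u)    4≤d ρ<d h = operation t u _∸_ _⊖_ (λ _ _ _ → refl) (λ _ _ → refl) 4≤d ρ<d h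
    compile-correct (read t)    4≤d ρ<d h =
      outcome-seq ≤-refl p (outcome-remembering (remembers p)
        (outcome-assign _ (cong₂ (λ μ a → μ a) (remembers p) (yields p))))
      where p = compile-correct t 4≤d ρ<d h
    compile-correct (ite c t u) {e = e} {μ} 4≤d ρ<d h =
      outcome-seq ≤-refl p (choose (eval γ μ c e) (yields p))
      where
      p = compile-correct c 4≤d ρ<d h
      h′ = holds-frame 4≤d ρ<d h (frame p) (remembers p)
      q = compile-correct t 4≤d ρ<d h′
      r = compile-correct u 4≤d ρ<d h′
      choose : ∀ x → registers (final p) _ ≡ x →
               Outcome (final p) _ (2 + (time K t + time K u)) _ (branch x _ _) μ
      choose zero    eq = outcome (⇓else eq (runs r))
        (+-monoʳ-≤ 2 (≤-trans (fast r) (m≤n+m _ _))) (yields r) (frame r) (remembers r)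
      choose (suc x) eq = outcome (⇓then (subst NonZero (sym eq) _) (runs q))
        (+-monoʳ-≤ 2 (≤-trans (fast q) (m≤m+n _ _))) (yields q) (frame q) (remembers q)
    compile-correct (loop r t u) {ρ = ρ} {d} {e} {μ} 4≤d ρ<d h =
      subst (λ p → Outcome _ _ _ d (proj₁ p) (proj₂ p))
        (iter-pair (λ ν i x → eval γ ν u (i ∷ x ∷ e)) (lookup γ (counter r)) (eval γ μ t e) μ)
        (Loop.outcome-loop r d 4≤d ρ<d γ e _ (time K u)
          (λ i p → eval γ (proj₂ p) u (i ∷ proj₁ p ∷ e) , proj₂ p)
          (λ i x h′ → compile-correct u (m≤n⇒m≤o+n 2 4≤d) (≤-refl ∷ m<n⇒m<1+n ≤-refl ∷ weaken (weaken ρ<d)) h′)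
          h (counter≤K r) (compile-correct t 4≤d ρ<d h))
    compile-correct (call {k} t as) {d = d} 4≤d ρ<d h =
      let (_ , s′ , run , quick , h′ , same) = compileArgs-correct as 4≤d ρ<d h
          p = compile-correct t (m≤n⇒m≤o+n k 4≤d) (range-below d k) h′
      in outcome (⇓seq run (⇓seq (runs p) ⇓reg)) (+-mono-≤ quick (+-monoˡ-≤ 2 (fast p)))
           (trans (put-same (final p) d _) (yields p))
           (λ r<d → trans (put-below (final p) d _ r<d)
             (trans (frame p (m≤n⇒m≤o+n k r<d)) (same r<d)))
           (remembers p)

    compileArgs-correct : ∀ {m k} (as : Args m k) {s ρ d e μ} → 4 ≤ d → All (_< d) ρ → Holds s ρ γ e μ →
      Σ[ steps ∈ ℕ ] Σ[ s′ ∈ State ] (s ⊢ compileArgs as ρ d ⇓[ steps ] s′) × steps ≤ timeArgs K as ×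
        Holds s′ (range d m) γ (evals γ μ as e) μ × (∀ {r} → r < d → registers s′ r ≡ registers s r)
    compileArgs-correct []       4≤d ρ<d h =
      _ , _ , ⇓skip , ≤-refl , holds (holds-globals h) refl (holds-memory h) , λ _ → refl
    compileArgs-correct (t ∷ as) 4≤d ρ<d h =
      let p = compile-correct t 4≤d ρ<d h
          (_ , s′ , run , quick , h′ , same) = compileArgs-correct as (m≤n⇒m≤1+n 4≤d) (weaken ρ<d)
            (holds-frame 4≤d ρ<d h (frame p) (remembers p))
      in _ , s′ , ⇓seq (runs p) run , +-mono-≤ (fast p) quick ,
         holds (holds-globals h′) (cong₂ _∷_ (trans (same ≤-refl) (yields p)) (holds-variables h′)) (holds-memory h′) ,
         λ r<d → trans (same (m<n⇒m<1+n r<d)) (frame p r<d)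

    operation : ∀ {k} (t u : Term k) (_∙_ : ℕ → ℕ → ℕ) (_⊙_ : Exp → Exp → Exp) →
                (∀ s E F → ⟦ E ⊙ F ⟧ s ≡ ⟦ E ⟧ s ∙ ⟦ F ⟧ s) → (∀ i j → cost (reg i ⊙ reg j) ≡ 3) →
                ∀ {s ρ d e μ} → 4 ≤ d → All (_< d) ρ → Holds s ρ γ e μ →
                Outcome s (compile t ρ d ⨾ (compile u ρ (1 + d) ⨾ d ≔ reg d ⊙ reg (1 + d)))
                  (time K t + (time K u + 4)) d (eval γ μ t e ∙ eval γ μ u e) μ
    operation t u _∙_ _⊙_ sem cst {d = d} 4≤d ρ<d h =
      outcome-seq ≤-refl p (outcome-seq (n≤1+n d) q (outcome-remembering (remembers q)
        (outcome-≤ (≤-reflexive (cong suc (cst _ _))) (outcome-assign _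
          (trans (sem _ _ _) (cong₂ _∙_ (trans (frame q ≤-refl) (yields p)) (yields q)))))))
      where
      p = compile-correct t 4≤d ρ<d h
      q = compile-correct u (m≤n⇒m≤1+n 4≤d) (weaken ρ<d) (holds-frame 4≤d ρ<d h (frame p) (remembers p))

  compileCommand-correct : ∀ {k} (c : Command k) {s ρ d e μ} → 4 ≤ d → All (_< d) ρ → Holds s ρ γ e μ →
    Outcome s (compileCommand c ρ d) (timeCommand K c) d (proj₁ (exec γ c e μ)) (proj₂ (exec γ c e μ))
  compileCommand-correct (ret t) 4≤d ρ<d h = compile-correct t 4≤d ρ<d h
  compileCommand-correct (store t u) {d = d} 4≤d ρ<d h =
    outcome-seq ≤-refl p (outcome-seq (n≤1+n d) q (outcome
      (⇓seq ⇓mem ⇓reg) ≤-refl (put-same (final q) d 0) (put-below (final q) d 0)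
      (cong₂ (λ f p → f [ proj₁ p ↦ proj₂ p ]) (remembers q)
        (cong₂ _,_ (trans (frame q ≤-refl) (yields p)) (yields q)))))
    where
    p = compile-correct t 4≤d ρ<d h
    q = compile-correct u (m≤n⇒m≤1+n 4≤d) (weaken ρ<d) (holds-frame 4≤d ρ<d h (frame p) (remembers p))
  compileCommand-correct (bind c k) {d = d} 4≤d ρ<d h =
    outcome-seq ≤-refl p (outcome-seq (n≤1+n d) q (outcome-remembering (remembers q) (outcome-assign _ (yields q))))
    where
    p = compileCommand-correct c 4≤d ρ<d h
    h′ = holds-frame 4≤d ρ<d h (frame p) (remembers p)
    q = compileCommand-correct k (m≤n⇒m≤1+n 4≤d) (≤-refl ∷ weaken ρ<d)
      (holds (holds-globals h′) (cong₂ _∷_ (yields p) (holds-variables h′)) (holds-memory h′))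
  compileCommand-correct (repeat r t c) {d = d} {e} 4≤d ρ<d h =
    Loop.outcome-loop r d 4≤d ρ<d γ e _ (timeCommand K c)
      (λ i p → exec γ c (i ∷ proj₁ p ∷ e) (proj₂ p))
      (λ i x h′ → compileCommand-correct c (m≤n⇒m≤o+n 2 4≤d) (≤-refl ∷ m<n⇒m<1+n ≤-refl ∷ weaken (weaken ρ<d)) h′)
      h (counter≤K r) (compile-correct t 4≤d ρ<d h)

-- Polynomial bounds on running times

Polynomial : (ℕ → ℕ) → Set
Polynomial f = Σ[ a ∈ ℕ ] Σ[ c ∈ ℕ ] (∀ K → 1 ≤ K → f K ≤ a * K ^ c)

polynomial-const : ∀ m → Polynomial (λ _ → m)
polynomial-const m = m , 0 , λ K _ → ≤-reflexive (sym (*-identityʳ m))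

-- For `1 ≤ K` powers grow with the exponent, so the sum of the exponents serves for both summands.
-- A single monomial therefore suffices as the shape of a bound.
polynomial-+ : ∀ {f g} → Polynomial f → Polynomial g → Polynomial (λ K → f K + g K)
polynomial-+ (a , c , f≤) (a′ , c′ , g≤) = a + a′ , c + c′ , λ K 1≤K →
  ≤-trans (+-mono-≤
      (≤-trans (f≤ K 1≤K) (*-monoʳ-≤ a (^-monoʳ-≤ K ⦃ >-nonZero 1≤K ⦄ (m≤m+n c c′))))
      (≤-trans (g≤ K 1≤K) (*-monoʳ-≤ a′ (^-monoʳ-≤ K ⦃ >-nonZero 1≤K ⦄ (m≤n+m c′ c)))))
    (≤-reflexive (sym (*-distribʳ-+ (K ^ (c + c′)) a a′)))

polynomial-K* : ∀ {f} → Polynomial f → Polynomial (λ K → K * f K)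
polynomial-K* (a , c , f≤) = a , suc c , λ K 1≤K →
  ≤-trans (*-monoʳ-≤ K (f≤ K 1≤K))
    (≤-reflexive (trans (sym (*-assoc K a (K ^ c)))
      (trans (cong (_* K ^ c) (*-comm K a)) (*-assoc a K (K ^ c)))))

polynomial-loopTime : ∀ {f g} → Polynomial f → Polynomial g → Polynomial (λ K → loopTime K (f K) (g K))
polynomial-loopTime pf pg =
  polynomial-+ pf (polynomial-+ (polynomial-const 2) (polynomial-+
    (polynomial-K* (polynomial-+ (polynomial-const 4) (polynomial-+ pg (polynomial-const 6))))
    (polynomial-const 4)))

mutual
  polynomial-time : ∀ {d} (t : Term d) → Polynomial (λ K → time K t)
  polynomial-time (var i)      = polynomial-const 2
  polynomial-time (glob g)     = polynomial-const 2
  polynomial-time (const x)    = polynomial-const 2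
  polynomial-time (t ⊹ u)      =
    polynomial-+ (polynomial-time t) (polynomial-+ (polynomial-time u) (polynomial-const 4))
  polynomial-time (t ∸ᵗ u)     =
    polynomial-+ (polynomial-time t) (polynomial-+ (polynomial-time u) (polynomial-const 4))
  polynomial-time (read t)     = polynomial-+ (polynomial-time t) (polynomial-const 3)
  polynomial-time (ite c t u)  = polynomial-+ (polynomial-time c)
    (polynomial-+ (polynomial-const 2) (polynomial-+ (polynomial-time t) (polynomial-time u)))
  polynomial-time (loop r t u) = polynomial-loopTime (polynomial-time t) (polynomial-time u)
  polynomial-time (call t as)  =
    polynomial-+ (polynomial-timeArgs as) (polynomial-+ (polynomial-time t) (polynomial-const 2))

  polynomial-timeArgs : ∀ {k d} (as : Args k d) → Polynomial (λ K → timeArgs K as)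
  polynomial-timeArgs []       = polynomial-const 1
  polynomial-timeArgs (t ∷ as) = polynomial-+ (polynomial-time t) (polynomial-timeArgs as)

polynomial-timeCommand : ∀ {d} (c : Command d) → Polynomial (λ K → timeCommand K c)
polynomial-timeCommand (ret t)        = polynomial-time t
polynomial-timeCommand (store t u)    =
  polynomial-+ (polynomial-time t) (polynomial-+ (polynomial-time u) (polynomial-const 5))
polynomial-timeCommand (bind c k)     =
  polynomial-+ (polynomial-timeCommand c) (polynomial-+ (polynomial-timeCommand k) (polynomial-const 2))
polynomial-timeCommand (repeat r t c) =
  polynomial-loopTime (polynomial-time t) (polynomial-timeCommand c)

-- Sets of vertices and their codes

-- Boolean functions rather than `Subset`: set operations compute pointwise, and membership is
-- directly comparable with the 0 or 1 that a term returns.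
VertexSet : ℕ → Set
VertexSet n = Fin n → Bool

∧-split : ∀ {a b} → a ∧ b ≡ true → a ≡ true × b ≡ true
∧-split {true} {true} _ = refl , refl

∧-join : ∀ {a b} → a ≡ true → b ≡ true → a ∧ b ≡ true
∧-join refl refl = refl

∨-split : ∀ {a b} → a ∨ b ≡ true → a ≡ true ⊎ b ≡ true
∨-split {true}  _ = inj₁ refl
∨-split {false} p = inj₂ p

∨-left : ∀ {a b} → a ≡ true → a ∨ b ≡ true
∨-left refl = refl

∨-right : ∀ {a b} → b ≡ true → a ∨ b ≡ true
∨-right {true}  _ = refl
∨-right {false} p = p

not-intro : ∀ {a} → ¬ (a ≡ true) → not a ≡ true
not-intro {true}  p = contradiction refl p
not-intro {false} p = refl

not-elim : ∀ {a} → not a ≡ true → ¬ (a ≡ true)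
not-elim {false} _ ()

infixr 4 _⇒_

_⇒_ : Bool → Bool → Bool
a ⇒ b = if a then b else true

⇒-intro : ∀ {a b} → (a ≡ true → b ≡ true) → (a ⇒ b) ≡ true
⇒-intro {true}  p = p refl
⇒-intro {false} p = refl

⇒-elim : ∀ {a b} → (a ⇒ b) ≡ true → a ≡ true → b ≡ true
⇒-elim p refl = p

does-elim : ∀ {A : Set} (d : Dec A) → does d ≡ true → A
does-elim (yes a) _ = a

≤ᵇ-elim : ∀ {m n} → (m ≤ᵇ n) ≡ true → m ≤ n
≤ᵇ-elim {m} {n} = does-elim (m ≤ⁿ? n)

≤ᵇ-intro : ∀ {m n} → m ≤ n → (m ≤ᵇ n) ≡ true
≤ᵇ-intro {m} {n} = dec-true (m ≤ⁿ? n)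

≤ᵇ-false : ∀ {m n} → n < m → (m ≤ᵇ n) ≡ false
≤ᵇ-false {m} {n} n<m = dec-false (m ≤ⁿ? n) (<⇒≱ n<m)

opaque
  every : ∀ {n} → VertexSet n → Bool
  every f = does (all? λ v → f v ≟ᵇ true)

opaque
  unfolding every

  every-intro : ∀ {n} {f : VertexSet n} → (∀ v → f v ≡ true) → every f ≡ true
  every-intro {f = f} = dec-true (all? λ v → f v ≟ᵇ true)

opaque
  unfolding every

  every-elim : ∀ {n} (f : VertexSet n) → every f ≡ true → ∀ v → f v ≡ true
  every-elim f = does-elim (all? λ v → f v ≟ᵇ true)

-- Written as the double negation that `someᵗ` computes with the universal loop.
some : ∀ {n} → VertexSet n → Bool
some f = not (every (not ∘ f))

some-intro : ∀ {n} {f : VertexSet n} v → f v ≡ true → some f ≡ true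
some-intro {f = f} v fv = not-intro λ p → not-elim (every-elim (not ∘ f) p v) fv

some-elim : ∀ {n} {f : VertexSet n} → some f ≡ true → ∃ λ v → f v ≡ true
some-elim {n} {f} p with ¬∀⟶∃¬ n _ (λ v → not (f v) ≟ᵇ true) (λ q → not-elim p (every-intro q))
... | v , q with f v in eq
...   | true  = v , eq
...   | false = contradiction refl q

module _ {A : Set} {f : ℕ → A → A} where

  iter-rule : ∀ (P : ℕ → A → Set) {x} k → P 0 x → (∀ i {x} → i < k → P i x → P (suc i) (f i x)) →
              P k (iter k f x)
  iter-rule P zero    base step = base
  iter-rule P (suc k) base step =
    step k ≤-refl (iter-rule P k base λ i i<k → step i (m<n⇒m<1+n i<k))

-- The loop adds the last index outermost, whereas `sum` splits off the first; `sum-init-last`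
-- reconciles the two.
iter-sum : ∀ {n} {φ : ℕ → ℕ → ℕ} (g : Fin n → ℕ) → (∀ v x → φ (toℕ v) x ≡ g v) →
           iter n (λ i x → x + φ i x) 0 ≡ sum g
iter-sum {zero}  g eq = refl
iter-sum {suc n} {φ} g eq = trans
  (cong₂ _+_
    (iter-sum (g ∘ inject₁) λ v x → trans (cong (λ i → φ i x) (sym (toℕ-inject₁ v))) (eq (inject₁ v) x))
    (trans (cong (λ i → φ i (iter n (λ i x → x + φ i x) 0)) (sym (toℕ-fromℕ n))) (eq (fromℕ n) _)))
  (sym (sum-init-last g))

iter-every : ∀ {n} {φ : ℕ → ℕ → ℕ} (f : VertexSet n) → (∀ v x → φ (toℕ v) x ≡ bit (f v)) →
             iter n (λ i x → branch (φ i x) x 0) 1 ≡ bit (every f)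
iter-every {n} {φ} f eq = conclude (iter-rule P n (inj₁ (refl , λ v ())) step)
  where
  P : ℕ → ℕ → Set
  P k x = (x ≡ 1 × ∀ v → toℕ v < k → f v ≡ true) ⊎ (x ≡ 0 × ∃ λ v → f v ≡ false)

  step : ∀ i {x} → i < n → P i x → P (suc i) (branch (φ i x) x 0)
  step i {x} i<n p with fromℕ< i<n | toℕ-fromℕ< i<n
  ... | v | refl with f v in fv | φ (toℕ v) x | eq v x
  ...   | true  | _ | refl = [ (λ (q , r) → inj₁ (q , λ u u<1+v → extend r u (m≤n⇒m<n∨m≡n (≤-pred u<1+v)))) , inj₂ ]′ p
    where
    extend : (∀ u → toℕ u < toℕ v → f u ≡ true) → ∀ u → toℕ u < toℕ v ⊎ toℕ u ≡ toℕ v → f u ≡ true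
    extend r u (inj₁ u<v) = r u u<v
    extend r u (inj₂ u≡v) = trans (cong f (toℕ-injective u≡v)) fv
  ...   | false | _ | refl = inj₂ (refl , v , fv)

  conclude : ∀ {x} → P n x → x ≡ bit (every f)
  conclude (inj₁ (refl , p)) = cong bit (sym (every-intro λ v → p v (toℕ<n v)))
  conclude (inj₂ (refl , v , p)) with every f in eq′
  ... | true  = contradiction (trans (sym (every-elim f eq′ v)) p) λ ()
  ... | false = refl

-- The sum `m + (n ∸ m)` is the maximum of `m` and `n`, expressed by the operations of the machine.
m+[n∸m]≤ : ∀ {m n o} → m ≤ o → n ≤ o → m + (n ∸ m) ≤ o
m+[n∸m]≤ {m} {n} m≤o n≤o with ≤-total m n
... | inj₁ m≤n = ≤-trans (≤-reflexive (m+[n∸m]≡n m≤n)) n≤o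
... | inj₂ n≤m = ≤-trans (≤-reflexive (trans (cong (m +_) (m≤n⇒m∸n≡0 n≤m)) (+-identityʳ m))) m≤o

module _ {n : ℕ} {φ : ℕ → ℕ → ℕ} where

  private
    max : ℕ
    max = iter n (λ i x → x + (φ i x ∸ x)) 0

  ≤-iter-max : ∀ {m i} → i < n → (∀ x → m ≤ φ i x) → m ≤ max
  ≤-iter-max {m} {i} i<n m≤φ = iter-rule (λ k x → i < k → m ≤ x) n (λ ()) step i<n
    where
    step : ∀ j {x} → j < n → (i < j → m ≤ x) → i < suc j → m ≤ x + (φ j x ∸ x)
    step j {x} _ p i<1+j with m≤n⇒m<n∨m≡n (≤-pred i<1+j)
    ... | inj₁ i<j  = ≤-trans (p i<j) (m≤m+n x _)
    ... | inj₂ refl = ≤-trans (m≤φ x) (m≤n+m∸n (φ i x) x)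

  iter-max-≤ : ∀ {m} → (∀ i → i < n → ∀ x → φ i x ≤ m) → max ≤ m
  iter-max-≤ {m} φ≤m = iter-rule (λ _ x → x ≤ m) n z≤n λ i i<n x≤m → m+[n∸m]≤ x≤m (φ≤m i i<n _)

-- Weights of sets of vertices

module _ {n : ℕ} (w : Fin n → ℕ) where

  part : VertexSet n → Fin n → ℕ
  part h v = if h v then w v else 0

  total : VertexSet n → ℕ
  total h = sum (part h)

sum-mono : ∀ {n} {f g : Fin n → ℕ} → (∀ v → f v ≤ g v) → sum f ≤ sum g
sum-mono {zero}  f≤g = z≤n
sum-mono {suc n} f≤g = +-mono-≤ (f≤g zero) (sum-mono (f≤g ∘ suc))

module _ {n : ℕ} (w : Fin n → ℕ) where

  total-mono : ∀ (f g : VertexSet n) → (∀ v → f v ≡ true → g v ≡ true) → total w f ≤ total w g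
  total-mono f g f⊆g = sum-mono pointwise
    where
    pointwise : ∀ v → (if f v then w v else 0) ≤ (if g v then w v else 0)
    pointwise v with f v | g v | f⊆g v
    ... | false | _     | _ = z≤n
    ... | true  | true  | _ = ≤-refl
    ... | true  | false | p = contradiction (p refl) λ ()

  total-cover : ∀ (f g h : VertexSet n) → (∀ v → f v ≡ true → g v ≡ true ⊎ h v ≡ true) →
                total w f ≤ total w g + total w h
  total-cover f g h cover = ≤-trans (sum-mono pointwise) (≤-reflexive (∑-distrib-+ (part w g) (part w h)))
    where
    pointwise : ∀ v → (if f v then w v else 0) ≤ (if g v then w v else 0) + (if h v then w v else 0)
    pointwise v with f v | g v | h v | cover v
    ... | false | _     | _     | _ = z≤n
    ... | true  | true  | _     | _ = m≤m+n _ _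
    ... | true  | false | true  | _ = ≤-refl
    ... | true  | false | false | p = [ (λ ()) , (λ ()) ]′ (p refl)

  total-pack : ∀ (f g h : VertexSet n) → (∀ v → f v ≡ true → g v ≡ true → ⊥) →
               (∀ v → f v ≡ true ⊎ g v ≡ true → h v ≡ true) → total w f + total w g ≤ total w h
  total-pack f g h disjoint f∪g⊆h = ≤-trans (≤-reflexive (sym (∑-distrib-+ (part w f) (part w g)))) (sum-mono pointwise)
    where
    pointwise : ∀ v → (if f v then w v else 0) + (if g v then w v else 0) ≤ (if h v then w v else 0)
    pointwise v with f v | g v | h v | disjoint v | f∪g⊆h v
    ... | false | false | _     | _ | _ = z≤n
    ... | true  | true  | _     | d | _ = ⊥-elim (d refl refl)
    ... | true  | false | true  | _ | _ = ≤-reflexive (+-identityʳ _)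
    ... | true  | false | false | _ | p = contradiction (p (inj₁ refl)) λ ()
    ... | false | true  | true  | _ | _ = ≤-refl
    ... | false | true  | false | _ | p = contradiction (p (inj₂ refl)) λ ()

  total-cong : ∀ (f g : VertexSet n) → (∀ v → f v ≡ g v) → total w f ≡ total w g
  total-cong f g eq = sum-cong-≗ λ v → cong (if_then w v else 0) (eq v)

≤-sum : ∀ {n} (f : Fin n → ℕ) v → f v ≤ sum f
≤-sum f zero    = m≤m+n _ _
≤-sum f (suc v) = ≤-trans (≤-sum (f ∘ suc) v) (m≤n+m _ _)

sum-0 : ∀ {n} {f : Fin n → ℕ} → (∀ v → f v ≡ 0) → sum f ≡ 0
sum-0 {zero}  eq = refl
sum-0 {suc n} eq = cong₂ _+_ (eq zero) (sum-0 (eq ∘ suc))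

sum-single : ∀ {n} {f : Fin n → ℕ} u → (∀ v → v ≢ u → f v ≡ 0) → sum f ≡ f u
sum-single {f = f} zero eq = trans (cong (f zero +_) (sum-0 λ v → eq (suc v) λ ())) (+-identityʳ _)
sum-single (suc u) eq = cong₂ _+_ (eq zero λ ()) (sum-single u λ v v≢u → eq (suc v) λ { refl → v≢u refl })

module _ {n : ℕ} (w : Fin n → ℕ) where

  ∈⇒≤total : ∀ {f : VertexSet n} {v} → f v ≡ true → w v ≤ total w f
  ∈⇒≤total {f} {v} fv = ≤-trans (≤-reflexive (cong (if_then w v else 0) (sym fv))) (≤-sum _ v)

  total-single : ∀ {f : VertexSet n} u → f u ≡ true → (∀ v → f v ≡ true → v ≡ u) → total w f ≡ w u
  total-single {f} u fu only = trans (sum-single u zeros) (cong (if_then w u else 0) fu)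
    where
    zeros : ∀ v → v ≢ u → (if f v then w v else 0) ≡ 0
    zeros v v≢u with f v in eq
    ... | true  = contradiction (only v eq) v≢u
    ... | false = refl

-- The set f ∩ D ∩ {0, …, j-1}, its elements being numbered within D, as a
-- binary number with the smallest element in the lowest bit.

module Code (D : ℕ → Bool) where

  -- This is 2 to the number of elements of `D` below `j`: the place value of a digit at `j`, and
  -- also the number of codes of subsets of `D` below `j`.
  val : ℕ → ℕ
  val zero    = 1
  val (suc j) = if D j then val j + val j else val j

  mask : (ℕ → Bool) → ℕ → ℕ
  mask f zero    = 0
  mask f (suc j) = if D j ∧ f j then mask f j + val j else mask f j

  mask<val : ∀ f j → mask f j < val j
  mask<val f zero = s≤s z≤n
  mask<val f (suc j) with D j | f j
  ... | false | _     = mask<val f j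
  ... | true  | false = ≤-trans (mask<val f j) (m≤m+n _ _)
  ... | true  | true  = +-monoˡ-< (val j) (mask<val f j)

  -- One step of decoding. All lower digits together are less than `val j`, so comparing with
  -- `val j` reveals the top digit and subtracting removes it.
  reduce : ∀ f j → (if D j ∧ (val j ≤ᵇ mask f (suc j)) then mask f (suc j) ∸ val j else mask f (suc j)) ≡ mask f j
  reduce f j with D j | f j
  ... | false | _     = refl
  ... | true  | false rewrite ≤ᵇ-false (mask<val f j) = refl
  ... | true  | true  rewrite ≤ᵇ-intro (m≤n+m (val j) (mask f j)) = m+n∸n≡m (mask f j) (val j)

  top-bit : ∀ f j → D j ≡ true → (val j ≤ᵇ mask f (suc j)) ≡ f j
  top-bit f j Dj rewrite Dj with f j
  ... | false = ≤ᵇ-false (mask<val f j)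
  ... | true  = ≤ᵇ-intro (m≤n+m (val j) (mask f j))

  mask-cong : ∀ {f g} j → (∀ i → i < j → D i ≡ true → f i ≡ g i) → mask f j ≡ mask g j
  mask-cong zero eq = refl
  mask-cong (suc j) eq with D j | eq j ≤-refl | mask-cong j (λ i i<j → eq i (m<n⇒m<1+n i<j))
  ... | false | _ | p = p
  ... | true  | q | p rewrite q refl | p = refl

  setTo : (ℕ → Bool) → ℕ → Bool → ℕ → Bool
  setTo f j b i = if does (i ≟ j) then b else f i

  setTo-mask : ∀ f j b → D j ≡ true → mask (setTo f j b) (suc j) ≡ (if b then mask f j + val j else mask f j)
  setTo-mask f j b Dj rewrite Dj | dec-true (j ≟ j) refl
    | mask-cong {setTo f j b} {f} j (λ i i<j _ → cong (if_then b else f i) (dec-false (i ≟ j) (<⇒≢ i<j))) = refl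

  -- Binary expansion from the top digit down. Owing to it, a loop over the numbers below `val n` is
  -- a loop over all subsets.
  mask-surjective : ∀ j {m} → m < val j → ∃ λ f → mask f j ≡ m
  mask-surjective zero (s≤s z≤n) = (λ _ → false) , refl
  mask-surjective (suc j) {m} m<val = step (D j) refl
    where
    step : ∀ b → D j ≡ b → ∃ λ f → mask f (suc j) ≡ m
    step false Dj =
      let (f , eq) = mask-surjective j (subst (λ b → m < (if b then val j + val j else val j)) Dj m<val)
      in f , trans (cong (λ b → if b ∧ f j then mask f j + val j else mask f j) Dj) eq
    step true Dj with val j ≤ⁿ? m
    ... | yes v≤m =
      let (f , eq) = mask-surjective j (subst (m ∸ val j <_) (m+n∸n≡m (val j) (val j))
            (∸-monoˡ-< (subst (λ b → m < (if b then val j + val j else val j)) Dj m<val) v≤m))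
      in setTo f j true , trans (setTo-mask f j true Dj) (trans (cong (_+ val j) eq) (m∸n+n≡m v≤m))
    ... | no v≰m =
      let (f , eq) = mask-surjective j (≰⇒> v≰m)
      in setTo f j false , trans (setTo-mask f j false Dj) eq

  -- Disjoint sets have no digit in common, so their sum has no carries.
  mask-∪ : ∀ {f g} j → (∀ i → i < j → f i ≡ true → g i ≡ true → ⊥) →
           mask (λ i → f i ∨ g i) j ≡ mask f j + mask g j
  mask-∪ zero _ = refl
  mask-∪ {f} {g} (suc j) disjoint with D j | f j | g j | disjoint j ≤-refl | mask-∪ {f} {g} j (λ i i<j → disjoint i (m<n⇒m<1+n i<j))
  ... | false | _     | _     | _ | p = p
  ... | true  | false | false | _ | p = p
  ... | true  | false | true  | _ | p = trans (cong (_+ val j) p) (+-assoc (mask f j) _ _)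
  ... | true  | true  | true  | d | p = ⊥-elim (d refl refl)
  ... | true  | true  | false | _ | p = trans (cong (_+ val j) p)
        (trans (+-assoc (mask f j) _ _) (trans (cong (mask f j +_) (+-comm (mask g j) _)) (sym (+-assoc (mask f j) _ _))))

  mask-full : ∀ j → suc (mask (λ _ → true) j) ≡ val j
  mask-full zero = refl
  mask-full (suc j) with D j | mask-full j
  ... | false | p = p
  ... | true  | p = cong (_+ val j) p

  mask-empty : ∀ j → mask (λ _ → false) j ≡ 0
  mask-empty zero = refl
  mask-empty (suc j) with D j | mask-empty j
  ... | false | p = p
  ... | true  | p = p

  val-pos : ∀ j → 1 ≤ val j
  val-pos j = ≤-trans (s≤s z≤n) (mask<val (λ _ → false) j)

  mask-pos : ∀ {f} j {i} → i < j → D i ≡ true → f i ≡ true → 1 ≤ mask f j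
  mask-pos {f} (suc j) {i} i<1+j Di fi with m≤n⇒m<n∨m≡n (≤-pred i<1+j)
  ... | inj₂ refl rewrite Di | fi = ≤-trans (val-pos j) (m≤n+m _ _)
  ... | inj₁ i<j with D j ∧ f j
  ...   | true  = ≤-trans (mask-pos j i<j Di fi) (m≤m+n _ _)
  ...   | false = mask-pos j i<j Di fi

  mask-single : ∀ {u} j → u < j → D u ≡ true → mask (λ i → does (i ≟ u)) j ≡ val u
  mask-single {u} (suc j) u<1+j Du with m≤n⇒m<n∨m≡n (≤-pred u<1+j)
  ... | inj₂ refl rewrite Du | dec-true (u ≟ u) refl = cong (_+ val u) (trans
    (mask-cong u λ i i<u _ → dec-false (i ≟ u) (<⇒≢ i<u)) (mask-empty u))
  ... | inj₁ u<j with D j | dec-false (j ≟ u) (>⇒≢ u<j)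
  ...   | false | _ = mask-single j u<j Du
  ...   | true  | p rewrite p = mask-single j u<j Du

ext : ∀ {n} → VertexSet n → ℕ → Bool
ext {zero}  f i       = false
ext {suc n} f zero    = f zero
ext {suc n} f (suc i) = ext (f ∘ suc) i

ext-toℕ : ∀ {n} (f : VertexSet n) v → ext f (toℕ v) ≡ f v
ext-toℕ f zero    = refl
ext-toℕ f (suc v) = ext-toℕ (f ∘ suc) v

ext-< : ∀ {n} (f : VertexSet n) {i} (i<n : i < n) → ext f i ≡ f (fromℕ< i<n)
ext-< f i<n = trans (cong (ext f) (sym (toℕ-fromℕ< i<n))) (ext-toℕ f (fromℕ< i<n))

infix  4 _⊆ᵇ_
infixl 6 _∪ᵇ_
infixl 7 _∖ᵇ_

_∪ᵇ_ _∖ᵇ_ : ∀ {n} → VertexSet n → VertexSet n → VertexSet n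
(f ∪ᵇ g) v = f v ∨ g v
(f ∖ᵇ g) v = f v ∧ not (g v)

∅ᵇ : ∀ {n} → VertexSet n
∅ᵇ _ = false

_⊆ᵇ_ : ∀ {n} → VertexSet n → VertexSet n → Set
f ⊆ᵇ g = ∀ v → f v ≡ true → g v ≡ true

Disjoint : ∀ {n} → VertexSet n → VertexSet n → Set
Disjoint f g = ∀ v → f v ≡ true → g v ≡ true → ⊥

module Coding {n : ℕ} (C : VertexSet n) where

  open Code (ext C) public using (val)
  open Code (ext C) hiding (val)

  code : VertexSet n → ℕ
  code f = mask (ext f) n

  size : ℕ
  size = val n

  code<size : ∀ f → code f < size
  code<size f = mask<val (ext f) n

  code-cong : ∀ {f g} → (∀ v → C v ≡ true → f v ≡ g v) → code f ≡ code g
  code-cong {f} {g} eq = mask-cong n λ i i<n Ci → trans (ext-< f i<n)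
    (trans (eq (fromℕ< i<n) (trans (sym (ext-< C i<n)) Ci)) (sym (ext-< g i<n)))

  code-surjective : ∀ {m} → m < size → ∃ λ f → f ⊆ᵇ C × code f ≡ m
  code-surjective m<size with mask-surjective n m<size
  ... | f , eq = (λ v → f (toℕ v) ∧ C v) , (λ v p → proj₂ (∧-split p)) , trans
    (mask-cong n λ i i<n Ci → trans (ext-< _ i<n) (trans
      (cong₂ _∧_ (cong f (toℕ-fromℕ< i<n)) (trans (sym (ext-< C i<n)) Ci)) (∧-identityʳ _))) eq

  code-∪ : ∀ {f g} → Disjoint f g → code (f ∪ᵇ g) ≡ code f + code g
  code-∪ {f} {g} disjoint = trans
    (mask-cong n λ i i<n _ → trans (ext-< (f ∪ᵇ g) i<n) (cong₂ _∨_ (sym (ext-< f i<n)) (sym (ext-< g i<n))))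
    (mask-∪ n λ i i<n fi gi →
      disjoint (fromℕ< i<n) (trans (sym (ext-< f i<n)) fi) (trans (sym (ext-< g i<n)) gi))

  -- The code of the whole cover is all ones. Subtracting the code of `s` from it gives the table
  -- index at which `acceptᵗ` reads the final entry.
  code-full : suc (code C) ≡ size
  code-full = trans (cong suc (mask-cong n λ i i<n Ci → Ci)) (mask-full n)

  code-empty : ∀ {f} → (∀ v → ¬ (f v ≡ true)) → code f ≡ 0
  code-empty {f} empty = trans (mask-cong n λ i i<n _ → trans (ext-< f i<n) (¬-not (empty _))) (mask-empty n)

  code-positive : ∀ {f v} → C v ≡ true → f v ≡ true → 1 ≤ code f
  code-positive {f} {v} Cv fv = mask-pos n (toℕ<n v) (trans (ext-toℕ C v) Cv) (trans (ext-toℕ f v) fv)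

  code-single : ∀ {u} → C u ≡ true → code (λ v → does (toℕ v ≟ toℕ u)) ≡ val (toℕ u)
  code-single {u} Cu = trans
    (mask-cong n λ i i<n _ → trans (ext-< _ i<n) (cong (λ j → does (j ≟ toℕ u)) (toℕ-fromℕ< i<n)))
    (mask-single n (toℕ<n u) (trans (ext-toℕ C u) Cu))

  -- Turns the difference of nested sets into a subtraction of codes; this is how a candidate finds
  -- the entry of the smaller set.
  code-∖ : ∀ {f g} → g ⊆ᵇ f → code f ≡ code (f ∖ᵇ g) + code g
  code-∖ {f} {g} g⊆f = trans (code-cong λ v _ → pointwise v)
    (code-∪ {f ∖ᵇ g} {g} λ v p → not-elim (proj₂ (∧-split p)))
    where
    pointwise : ∀ v → f v ≡ (f v ∧ not (g v)) ∨ g v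
    pointwise v with f v | g v | g⊆f v
    ... | true  | true  | _ = refl
    ... | true  | false | _ = refl
    ... | false | false | _ = refl
    ... | false | true  | p = p refl

-- The greedy vertex cover

v0 : ∀ {d} → Term (1 + d)
v0 = var zero
v1 : ∀ {d} → Term (2 + d)
v1 = var (suc zero)
v2 : ∀ {d} → Term (3 + d)
v2 = var (suc (suc zero))
v3 : ∀ {d} → Term (4 + d)
v3 = var (suc (suc (suc zero)))
v4 : ∀ {d} → Term (5 + d)
v4 = var (suc (suc (suc (suc zero))))

vertices codes coverMask tableBase : ∀ {d} → Term d
vertices  = glob zero
codes     = glob (suc zero)
coverMask = glob (suc (suc zero))
tableBase = glob (suc (suc (suc zero)))

notᵗ : ∀ {d} → Term d → Term d
notᵗ t = const 1 ∸ᵗ t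

andᵗ orᵗ impliesᵗ leqᵗ maxᵗ : ∀ {d} → Term d → Term d → Term d
andᵗ t u     = ite t u (const 0)
orᵗ t u      = ite t (const 1) u
impliesᵗ t u = ite t u (const 1)
leqᵗ t u     = const 1 ∸ᵗ (t ∸ᵗ u)
maxᵗ t u     = t ⊹ (u ∸ᵗ t)

everyᵗ someᵗ sumᵗ : ∀ {d} → Term (2 + d) → Term d
everyᵗ t = loop small (const 1) (ite t v1 (const 0))
someᵗ t  = notᵗ (everyᵗ (notᵗ t))
sumᵗ t   = loop small (const 0) (v1 ⊹ t)

branch-bit : ∀ {c} b x y → c ≡ bit b → branch c x y ≡ (if b then x else y)
branch-bit true  x y refl = refl
branch-bit false x y refl = refl

not-value : ∀ {x a} → x ≡ bit a → 1 ∸ x ≡ bit (not a)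
not-value {a = true}  refl = refl
not-value {a = false} refl = refl

and-value : ∀ {x y a b} → x ≡ bit a → y ≡ bit b → branch x y 0 ≡ bit (a ∧ b)
and-value {a = true}  refl eq = eq
and-value {a = false} refl eq = refl

or-value : ∀ {x y a b} → x ≡ bit a → y ≡ bit b → branch x 1 y ≡ bit (a ∨ b)
or-value {a = true}  refl eq = refl
or-value {a = false} refl eq = eq

implies-value : ∀ {x y a b} → x ≡ bit a → y ≡ bit b → branch x y 1 ≡ bit (a ⇒ b)
implies-value {a = true}  refl eq = eq
implies-value {a = false} refl eq = refl

leq-value : ∀ x y → 1 ∸ (x ∸ y) ≡ bit (x ≤ᵇ y)
leq-value x y with x ≤ⁿ? y
... | yes x≤y rewrite m≤n⇒m∸n≡0 x≤y | ≤ᵇ-intro x≤y = refl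
... | no  x≰y rewrite ≤ᵇ-false (≰⇒> x≰y) = m≤n⇒m∸n≡0 (m<n⇒0<n∸m (≰⇒> x≰y))

some-value : ∀ {n} {φ : ℕ → ℕ → ℕ} (f : VertexSet n) → (∀ v x → φ (toℕ v) x ≡ bit (f v)) →
             1 ∸ iter n (λ i x → branch (1 ∸ φ i x) x 0) 1 ≡ bit (some f)
some-value f eq = not-value (iter-every (not ∘ f) λ v x → not-value (eq v x))

-- Parameters: valᵗ j, clearᵗ h r j and bitᵗ m j.  To find bit j of m, clearᵗ
-- is applied for h = n - 1, n - 2, …, j + 1 and removes the bit at h.
opaque
  valᵗ : Term 1 → Term 1
  valᵗ D = loop small (const 1) (ite (andᵗ (call D (v0 ∷ [])) (leqᵗ (v0 ⊹ const 1) v2)) (v1 ⊹ v1) v1)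

  clearᵗ : Term 1 → Term 3
  clearᵗ D = ite (andᵗ (leqᵗ (v2 ⊹ const 1) v0) (andᵗ (call D (v0 ∷ [])) (leqᵗ (call (valᵗ D) (v0 ∷ [])) v1)))
    (v1 ∸ᵗ call (valᵗ D) (v0 ∷ [])) v1

  bitᵗ : Term 1 → Term 2
  bitᵗ D = leqᵗ (call (valᵗ D) (v1 ∷ []))
    (loop small v0 (call (clearᵗ D) (vertices ∸ᵗ const 1 ∸ᵗ v0 ∷ v1 ∷ v3 ∷ [])))

module BitValue {n M c L : ℕ} (μ : Memory) (Dᵗ : Term 1) (D : ℕ → Bool)
  (D-value : ∀ i → i < n → eval (n ∷ M ∷ c ∷ L ∷ []) μ Dᵗ (i ∷ []) ≡ bit (D i)) where

  open Code D

  private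
    γ : Vec ℕ 4
    γ = n ∷ M ∷ c ∷ L ∷ []

  opaque
    unfolding valᵗ

    val-value : ∀ j → j ≤ n → eval γ μ (valᵗ Dᵗ) (j ∷ []) ≡ val j
    val-value j j≤n = trans
      -- A loop always runs `n` rounds; from round `j` on it does nothing, which the minimum
      -- records.
      (iter-rule (λ k x → x ≡ val (k ⊓ j)) n refl step)
      (cong val (m≥n⇒m⊓n≡n j≤n))
      where
      step : ∀ i {x} → i < n → x ≡ val (i ⊓ j) →
             branch (branch (eval γ μ Dᵗ (i ∷ [])) (1 ∸ (i + 1 ∸ j)) 0) (x + x) x ≡ val (suc i ⊓ j)
      step i {x} i<n eq = trans
        (branch-bit (D i ∧ (i + 1 ≤ᵇ j)) _ _ (and-value (D-value i i<n) (leq-value (i + 1) j)))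
        (cases (i <? j))
        where
        cases : Dec (i < j) → (if D i ∧ (i + 1 ≤ᵇ j) then x + x else x) ≡ val (suc i ⊓ j)
        cases (yes i<j)
          rewrite eq | m≤n⇒m⊓n≡m (<⇒≤ i<j) | m≤n⇒m⊓n≡m i<j
                | +-comm i 1 | ≤ᵇ-intro i<j | ∧-identityʳ (D i) = refl
        cases (no i≮j)
          rewrite eq | m≥n⇒m⊓n≡n (≮⇒≥ i≮j) | m≥n⇒m⊓n≡n (m≤n⇒m≤1+n (≮⇒≥ i≮j))
                | +-comm i 1 | ≤ᵇ-false (s≤s (≮⇒≥ i≮j)) | ∧-zeroʳ (D i) = refl

  opaque
    unfolding clearᵗ

    -- Rounds with `h ≤ j` must leave the number unchanged, since the digit at `j` is still to be
    -- inspected. The maximum with `suc j` expresses that clearing stops there.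
    clear-value : ∀ f j h {r} → h < n → r ≡ mask f (suc h ⊔ suc j) →
                  eval γ μ (clearᵗ Dᵗ) (h ∷ r ∷ j ∷ []) ≡ mask f (h ⊔ suc j)
    clear-value f j h {r} h<n eq = trans
      (branch-bit ((j + 1 ≤ᵇ h) ∧ (D h ∧ (val h ≤ᵇ r))) _ _
        (and-value (leq-value (j + 1) h) (and-value (D-value h h<n)
          (trans (cong (λ v → 1 ∸ (v ∸ r)) val-h) (leq-value (val h) r)))))
      (trans (cong (λ v → if (j + 1 ≤ᵇ h) ∧ (D h ∧ (val h ≤ᵇ r)) then r ∸ v else r) val-h)
        (cases (j <? h)))
      where
      val-h : eval γ μ (valᵗ Dᵗ) (h ∷ []) ≡ val h
      val-h = val-value h (<⇒≤ h<n)
      cases : Dec (j < h) →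
              (if (j + 1 ≤ᵇ h) ∧ (D h ∧ (val h ≤ᵇ r)) then r ∸ val h else r) ≡ mask f (h ⊔ suc j)
      cases (yes j<h) rewrite eq | m≥n⇒m⊔n≡m j<h | m≥n⇒m⊔n≡m (<⇒≤ j<h) | +-comm j 1 | ≤ᵇ-intro j<h = reduce f h
      cases (no j≮h) rewrite eq | +-comm j 1 | ≤ᵇ-false (s≤s (≮⇒≥ j≮h))
        | m≤n⇒m⊔n≡n (≮⇒≥ j≮h) | m≤n⇒m⊔n≡n (m≤n⇒m≤1+n (≮⇒≥ j≮h)) = refl

  opaque
    unfolding bitᵗ

    bit-value : ∀ f j → j < n → D j ≡ true → eval γ μ (bitᵗ Dᵗ) (mask f n ∷ j ∷ []) ≡ bit (f j)
    bit-value f j j<n Dj = trans (cong₂ (λ v r → 1 ∸ (v ∸ r)) (val-value j (<⇒≤ j<n)) cleared)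
      (trans (leq-value (val j) (mask f (suc j))) (cong bit (top-bit f j Dj)))
      where
      step : ∀ i {r} → i < n → r ≡ mask f ((n ∸ i) ⊔ suc j) →
             eval γ μ (clearᵗ Dᵗ) (n ∸ 1 ∸ i ∷ r ∷ j ∷ []) ≡ mask f ((n ∸ suc i) ⊔ suc j)
      step i {r} i<n eq = trans (cong (λ h → eval γ μ (clearᵗ Dᵗ) (h ∷ r ∷ j ∷ [])) (∸-+-assoc n 1 i))
        (clear-value f j (n ∸ suc i) (∸-monoʳ-< {o = 0} (s≤s z≤n) i<n)
          (trans eq (cong (λ h → mask f (h ⊔ suc j)) (+-∸-assoc 1 i<n))))

      cleared : eval γ μ (loop small v0 (call (clearᵗ Dᵗ) (vertices ∸ᵗ const 1 ∸ᵗ v0 ∷ v1 ∷ v3 ∷ [])))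
                  (mask f n ∷ j ∷ []) ≡ mask f (suc j)
      cleared = trans
        (iter-rule (λ k r → r ≡ mask f ((n ∸ k) ⊔ suc j)) n
          (cong (mask f) (sym (m≥n⇒m⊔n≡m j<n))) step)
        (cong (λ h → mask f (h ⊔ suc j)) (n∸n≡0 n))

-- The numbering is used twice: over all vertices, to hold the cover itself as one number, and over
-- the cover, for the subsets that are looped over.
everyVertexᵗ : Term 1
everyVertexᵗ = const 1

opaque
  -- The matrix follows three header cells and the `n` weights. The start of the row is found by
  -- adding its number `n` times, as the machine does not multiply.
  adjacentᵗ : Term 2
  adjacentᵗ = read (const 3 ⊹ vertices ⊹ loop small (const 0) (v1 ⊹ v2) ⊹ v1)

  weightᵗ : Term 1
  weightᵗ = read (const 3 ⊹ v0)

  matchᵗ : Term 3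
  matchᵗ = ite (andᵗ (call adjacentᵗ (v0 ∷ v1 ∷ []))
                 (andᵗ (notᵗ (call (bitᵗ everyVertexᵗ) (v2 ∷ v0 ∷ [])))
                       (notᵗ (call (bitᵗ everyVertexᵗ) (v2 ∷ v1 ∷ [])))))
    (v2 ⊹ call (valᵗ everyVertexᵗ) (v0 ∷ []) ⊹ call (valᵗ everyVertexᵗ) (v1 ∷ [])) v2

  coverᵗ : Term 0
  coverᵗ = loop small (const 0) (loop small v1 (call matchᵗ (v2 ∷ v0 ∷ v1 ∷ [])))

  inCoverᵗ : Term 1
  inCoverᵗ = call (bitᵗ everyVertexᵗ) (coverMask ∷ v0 ∷ [])

-- Matchings and covers

IsCover : ∀ {n} → (Fin n → Fin n → Bool) → VertexSet n → Set
IsCover A X = ∀ u v → A u v ≡ true → X u ≡ true ⊎ X v ≡ true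

count : ∀ {n} → VertexSet n → ℕ
count = total (λ _ → 1)

⁅_⁆ᵇ : ∀ {n} → Fin n → VertexSet n
⁅ u ⁆ᵇ v = does (toℕ v ≟ toℕ u)

∈⁅⁆ : ∀ {n} (u : Fin n) → ⁅ u ⁆ᵇ u ≡ true
∈⁅⁆ u = dec-true (toℕ u ≟ toℕ u) refl

∈⁅⁆⇒≡ : ∀ {n} {u v : Fin n} → ⁅ u ⁆ᵇ v ≡ true → v ≡ u
∈⁅⁆⇒≡ {u = u} {v} p = toℕ-injective (does-elim (toℕ v ≟ toℕ u) p)

_∩ᵇ_ : ∀ {n} → VertexSet n → VertexSet n → VertexSet n
(f ∩ᵇ g) v = f v ∧ g v

-- Holds for the set of ends of a matching, as a cover meets each of its edges.
Matched : ∀ {n} → (Fin n → Fin n → Bool) → VertexSet n → Set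
Matched A f = ∀ X → IsCover A X → count f ≤ 2 * count (f ∩ᵇ X)

-- The new edge contributes two ends, and every cover contains at least one of them, which was not
-- counted before; so both sides grow by 2 or the right one by more.
matched-extend : ∀ {n} {A : Fin n → Fin n → Bool} {f : VertexSet n} {u v} → A u v ≡ true →
                 ¬ (f u ≡ true) → ¬ (f v ≡ true) → Matched A f → Matched A (f ∪ᵇ ⁅ u ⁆ᵇ ∪ᵇ ⁅ v ⁆ᵇ)
matched-extend {A = A} {f} {u} {v} Auv fu fv matched X cover = begin
  count (f ∪ᵇ ⁅ u ⁆ᵇ ∪ᵇ ⁅ v ⁆ᵇ)             ≤⟨ total-cover _ _ (f ∪ᵇ ⁅ u ⁆ᵇ) ⁅ v ⁆ᵇ (λ x p → ∨-split p) ⟩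
  count (f ∪ᵇ ⁅ u ⁆ᵇ) + count ⁅ v ⁆ᵇ         ≤⟨ +-mono-≤ (total-cover _ _ f ⁅ u ⁆ᵇ (λ x p → ∨-split p)) (one v) ⟩
  count f + count ⁅ u ⁆ᵇ + 1                 ≤⟨ +-monoˡ-≤ 1 (+-mono-≤ (matched X cover) (one u)) ⟩
  2 * count (f ∩ᵇ X) + 1 + 1                 ≡⟨ +-assoc (2 * count (f ∩ᵇ X)) 1 1 ⟩
  2 * count (f ∩ᵇ X) + 2 * 1                 ≡⟨ *-distribˡ-+ 2 (count (f ∩ᵇ X)) 1 ⟨
  2 * (count (f ∩ᵇ X) + 1)                   ≤⟨ *-monoʳ-≤ 2 (more (cover u v Auv)) ⟩
  2 * count ((f ∪ᵇ ⁅ u ⁆ᵇ ∪ᵇ ⁅ v ⁆ᵇ) ∩ᵇ X)  ∎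
  where
  open ≤-Reasoning

  one : ∀ x → count ⁅ x ⁆ᵇ ≤ 1
  one x = ≤-reflexive (total-single _ x (∈⁅⁆ x) λ y → ∈⁅⁆⇒≡ {v = y})

  gain : ∀ x → ¬ (f x ≡ true) → X x ≡ true → ⁅ x ⁆ᵇ ⊆ᵇ (f ∪ᵇ ⁅ u ⁆ᵇ ∪ᵇ ⁅ v ⁆ᵇ) →
         count (f ∩ᵇ X) + 1 ≤ count ((f ∪ᵇ ⁅ u ⁆ᵇ ∪ᵇ ⁅ v ⁆ᵇ) ∩ᵇ X)
  gain x fx Xx x⊆ = ≤-trans
    (+-monoʳ-≤ (count (f ∩ᵇ X)) (∈⇒≤total (λ _ → 1) {⁅ x ⁆ᵇ} {x} (∈⁅⁆ x)))
    (total-pack (λ _ → 1) (f ∩ᵇ X) ⁅ x ⁆ᵇ _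
      (λ y p q → fx (trans (cong f (sym (∈⁅⁆⇒≡ {v = y} q))) (proj₁ (∧-split p))))
      (λ y → [ (λ p → ∧-join (∨-left (∨-left (proj₁ (∧-split {f y} p)))) (proj₂ (∧-split {f y} p)))
             , (λ q → ∧-join (x⊆ y q) (trans (cong X (∈⁅⁆⇒≡ {v = y} q)) Xx)) ]′))

  more : X u ≡ true ⊎ X v ≡ true → count (f ∩ᵇ X) + 1 ≤ count ((f ∪ᵇ ⁅ u ⁆ᵇ ∪ᵇ ⁅ v ⁆ᵇ) ∩ᵇ X)
  more (inj₁ Xu) = gain u fu Xu λ y p → ∨-left (∨-right {f y} p)
  more (inj₂ Xv) = gain v fv Xv λ y p → ∨-right {(f ∪ᵇ ⁅ u ⁆ᵇ) y} p

module CoverValue {n M c L : ℕ} (μ : Memory) (A : Fin n → Fin n → Bool)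
  (irreflexive : ∀ v → ¬ (A v v ≡ true))
  (read-adjacency : ∀ u v → μ (3 + n + n * toℕ u + toℕ v) ≡ bit (A u v)) where

  private
    γ : Vec ℕ 4
    γ = n ∷ M ∷ c ∷ L ∷ []

  open Coding {n} (λ _ → true) public

  product-value : ∀ u → iter n (λ i x → x + u) 0 ≡ n * u
  product-value u = iter-rule (λ k x → x ≡ k * u) n refl
    (λ i {x} _ eq → trans (+-comm x u) (cong (u +_) eq))

  opaque
    unfolding adjacentᵗ

    adjacent-value : ∀ u v → eval γ μ adjacentᵗ (toℕ u ∷ toℕ v ∷ []) ≡ bit (A u v)
    adjacent-value u v = trans (cong (λ m → μ (3 + n + m + toℕ v)) (product-value (toℕ u))) (read-adjacency u v)

  private
    every-vertex : ∀ i → i < n → 1 ≡ bit (ext {n} (λ _ → true) i)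
    every-vertex i i<n = cong bit (sym (ext-< (λ _ → true) i<n))

    module B = BitValue {n} {M} {c} {L} μ everyVertexᵗ (ext {n} (λ _ → true)) every-vertex

  bit-value : ∀ f v → eval γ μ (bitᵗ everyVertexᵗ) (code f ∷ toℕ v ∷ []) ≡ bit (f v)
  bit-value f v = trans (B.bit-value (ext f) (toℕ v) (toℕ<n v) (ext-toℕ (λ _ → true) v))
    (cong bit (ext-toℕ f v))

  opaque
    unfolding matchᵗ

    -- Both ends are new and, the graph being loopless, different. Hence their two place values can
    -- be added without a carry.
    match-value : ∀ f u v → eval γ μ matchᵗ (toℕ u ∷ toℕ v ∷ code f ∷ []) ≡
      (if A u v ∧ (not (f u) ∧ not (f v)) then code (f ∪ᵇ ⁅ u ⁆ᵇ ∪ᵇ ⁅ v ⁆ᵇ) else code f)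
    match-value f u v = trans
      (branch-bit (A u v ∧ (not (f u) ∧ not (f v))) _ _
        (and-value (adjacent-value u v) (and-value (not-value (bit-value f u)) (not-value (bit-value f v)))))
      (cases (A u v) refl (f u) refl (f v) refl)
      where
      value : ∀ w → code ⁅ w ⁆ᵇ ≡ eval γ μ (valᵗ everyVertexᵗ) (toℕ w ∷ [])
      value w = trans (code-single refl) (sym (B.val-value (toℕ w) (<⇒≤ (toℕ<n w))))

      cases : ∀ a → A u v ≡ a → ∀ b → f u ≡ b → ∀ d → f v ≡ d →
        (if a ∧ (not b ∧ not d) then code f + eval γ μ (valᵗ everyVertexᵗ) (toℕ u ∷ [])
           + eval γ μ (valᵗ everyVertexᵗ) (toℕ v ∷ []) else code f) ≡
        (if a ∧ (not b ∧ not d) then code (f ∪ᵇ ⁅ u ⁆ᵇ ∪ᵇ ⁅ v ⁆ᵇ) else code f)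
      cases false _ _ _ _ _ = refl
      cases true _ true _ _ _ = refl
      cases true _ false _ true _ = refl
      cases true Auv false fu false fv = sym (trans
        (code-∪ {f ∪ᵇ ⁅ u ⁆ᵇ} {⁅ v ⁆ᵇ} λ x p q → [ (λ fx → true≢false (trans (sym fx) (trans (cong f (∈⁅⁆⇒≡ {v = x} q)) fv)))
                          , (λ r → irreflexive u (trans (cong (A u) (trans (sym (∈⁅⁆⇒≡ {v = x} r)) (∈⁅⁆⇒≡ {v = x} q))) Auv)) ]′ (∨-split {f x} p))
        (cong₂ _+_ (trans (code-∪ {f} {⁅ u ⁆ᵇ} λ x fx q → true≢false (trans (sym fx) (trans (cong f (∈⁅⁆⇒≡ {v = x} q)) fu)))
          (cong (code f +_) (value u))) (value v)))
        where
        true≢false : ¬ (true ≡ false)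
        true≢false ()

  -- `Q` holds for the pairs examined so far, and only their edges need to be covered. The chosen
  -- set never shrinks, so covered edges stay covered.
  record Greedy (Q : Fin n → Fin n → Set) (x : ℕ) : Set where
    constructor greedy
    field
      {chosen} : VertexSet n
      coded    : code chosen ≡ x
      matched  : Matched A chosen
      covered  : ∀ u v → Q u v → A u v ≡ true → chosen u ≡ true ⊎ chosen v ≡ true

  match-step : ∀ {Q x} u v → Greedy Q x →
               Greedy (λ u′ v′ → Q u′ v′ ⊎ (u′ ≡ u × v′ ≡ v)) (eval γ μ matchᵗ (toℕ u ∷ toℕ v ∷ x ∷ []))
  match-step {Q} u v (greedy {f} refl m cov) = subst (Greedy _) (sym (match-value f u v)) (cases _ refl)
    where
    cases : ∀ b → A u v ∧ (not (f u) ∧ not (f v)) ≡ b →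
            Greedy (λ u′ v′ → Q u′ v′ ⊎ (u′ ≡ u × v′ ≡ v)) (if b then code (f ∪ᵇ ⁅ u ⁆ᵇ ∪ᵇ ⁅ v ⁆ᵇ) else code f)
    cases true eq = greedy refl
      (matched-extend {f = f} Auv (not-elim ¬fu) (not-elim ¬fv) m)
      λ { u′ v′ (inj₁ q) a → [ (λ p → inj₁ (∨-left (∨-left p))) , (λ p → inj₂ (∨-left (∨-left p))) ]′ (cov u′ v′ q a)
        ; u′ v′ (inj₂ (refl , refl)) a → inj₁ (∨-left (∨-right {f u} (∈⁅⁆ u))) }
      where
      Auv = proj₁ (∧-split eq)
      ¬fu = proj₁ (∧-split (proj₂ (∧-split {A u v} eq)))
      ¬fv = proj₂ (∧-split {not (f u)} (proj₂ (∧-split {A u v} eq)))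
    cases false eq = greedy refl m
      λ { u′ v′ (inj₁ q) a → cov u′ v′ q a ; u′ v′ (inj₂ (refl , refl)) a → either a }
      where
      either : A u v ≡ true → f u ≡ true ⊎ f v ≡ true
      either a with f u | f v
      ... | true  | _     = inj₁ refl
      ... | false | true  = inj₂ refl
      ... | false | false = contradiction (trans (sym eq) (∧-join a refl)) λ ()

  greedy-⊆ : ∀ {Q R x} → (∀ u v → R u v → Q u v) → Greedy Q x → Greedy R x
  greedy-⊆ R⊆Q (greedy c m cov) = greedy c m λ u v r → cov u v (R⊆Q u v r)

  opaque
    unfolding coverᵗ

    cover-value : Σ[ C ∈ VertexSet n ] code C ≡ eval γ μ coverᵗ [] × Matched A C × IsCover A C
    cover-value =
      let (greedy {C} coded m cov) = result
      in C , coded , m , λ u v → cov u v (toℕ<n u)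
      where
      inner : ∀ u k {x} → Greedy (λ u′ v′ → toℕ u′ < toℕ u) x → k ≤ n →
              Greedy (λ u′ v′ → toℕ u′ < toℕ u ⊎ (u′ ≡ u × toℕ v′ < k))
                (iter k (λ j x → eval γ μ matchᵗ (toℕ u ∷ j ∷ x ∷ [])) x)
      inner u k g k≤n = iter-rule (λ k x → Greedy (λ u′ v′ → toℕ u′ < toℕ u ⊎ (u′ ≡ u × toℕ v′ < k)) x) k
        (greedy-⊆ (λ u′ v′ → [ id , (λ ()) ]′) g) step
        where
        step : ∀ j {x} → j < k → Greedy (λ u′ v′ → toℕ u′ < toℕ u ⊎ (u′ ≡ u × toℕ v′ < j)) x →
               Greedy (λ u′ v′ → toℕ u′ < toℕ u ⊎ (u′ ≡ u × toℕ v′ < suc j)) (eval γ μ matchᵗ (toℕ u ∷ j ∷ x ∷ []))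
        step j j<k g with fromℕ< (≤-trans j<k k≤n) | toℕ-fromℕ< (≤-trans j<k k≤n)
        ... | v | refl = greedy-⊆
          (λ u′ v′ → [ (λ p → inj₁ (inj₁ p)) , (λ (p , q) → [ (λ r → inj₁ (inj₂ (p , r))) , (λ r → inj₂ (p , toℕ-injective r)) ]′ (m≤n⇒m<n∨m≡n (≤-pred q))) ]′)
          (match-step u v g)

      result : Greedy (λ u v → toℕ u < n) (eval γ μ coverᵗ [])
      result = iter-rule (λ k x → Greedy (λ u v → toℕ u < k) x) n
        (greedy {chosen = ∅ᵇ} (code-empty λ v ()) (λ X _ → ≤-trans (≤-reflexive (sum-0 {n} λ v → refl)) z≤n) (λ u v ())) step
        where
        step : ∀ i {x} → i < n → Greedy (λ u v → toℕ u < i) x →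
               Greedy (λ u v → toℕ u < suc i) (iter n (λ j x → eval γ μ matchᵗ (i ∷ j ∷ x ∷ [])) x)
        step i i<n g with fromℕ< i<n | toℕ-fromℕ< i<n
        ... | u | refl = greedy-⊆
          (λ u′ v′ p → [ inj₁ , (λ q → inj₂ (toℕ-injective q , toℕ<n v′)) ]′ (m≤n⇒m<n∨m≡n (≤-pred p)))
          (inner u n g ≤-refl)

-- The dynamic program

v5 : ∀ {d} → Term (6 + d)
v5 = var (suc (suc (suc (suc (suc zero)))))

-- Parameters, where s, p, f and q are codes of subsets of the cover, v is a
-- vertex and ℓ is the bound on the weight of a component:
--   memberᵗ f v, neighboursᵗ s p v, validᵗ s p, regionᵗ s p v,
--   regionWeightᵗ s p, isolatedᵗ s v, isolatedPartᵗ v s, subsetᵗ p f,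
--   candidateᵗ s ℓ f p, entryᵗ s ℓ f, limitᵗ s q, acceptᵗ s ℓ.
-- The table entry at f is 0 if f has no admissible partition, and otherwise
-- exceeds the largest total weight of the regions by 1.
opaque
  memberᵗ : Term 2
  memberᵗ = andᵗ (call inCoverᵗ (v1 ∷ [])) (call (bitᵗ inCoverᵗ) (v0 ∷ v1 ∷ []))

  neighboursᵗ : Term 3
  neighboursᵗ = everyᵗ (impliesᵗ (andᵗ (call inCoverᵗ (v0 ∷ [])) (call adjacentᵗ (v4 ∷ v0 ∷ [])))
    (orᵗ (call memberᵗ (v3 ∷ v0 ∷ [])) (call memberᵗ (v2 ∷ v0 ∷ []))))

  validᵗ : Term 2
  validᵗ = everyᵗ (impliesᵗ (call memberᵗ (v3 ∷ v0 ∷ []))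
    (andᵗ (notᵗ (call memberᵗ (v2 ∷ v0 ∷ []))) (call neighboursᵗ (v2 ∷ v3 ∷ v0 ∷ []))))

  regionᵗ : Term 3
  regionᵗ = orᵗ (call memberᵗ (v1 ∷ v2 ∷ []))
    (andᵗ (notᵗ (call inCoverᵗ (v2 ∷ []))) (andᵗ (call neighboursᵗ (v0 ∷ v1 ∷ v2 ∷ []))
      (someᵗ (andᵗ (call adjacentᵗ (v4 ∷ v0 ∷ [])) (call memberᵗ (v3 ∷ v0 ∷ []))))))

  regionWeightᵗ : Term 2
  regionWeightᵗ = sumᵗ (ite (call regionᵗ (v2 ∷ v3 ∷ v0 ∷ [])) (call weightᵗ (v0 ∷ [])) (const 0))

  isolatedᵗ : Term 2
  isolatedᵗ = andᵗ (notᵗ (call inCoverᵗ (v1 ∷ []))) (call neighboursᵗ (v0 ∷ const 0 ∷ v1 ∷ []))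

  isolatedPartᵗ : Term 2
  isolatedPartᵗ = ite (call isolatedᵗ (v1 ∷ v0 ∷ [])) (call weightᵗ (v0 ∷ [])) (const 0)

  isolatedWeightᵗ isolatedMaxᵗ : Term 1
  isolatedWeightᵗ = sumᵗ (call isolatedPartᵗ (v0 ∷ v2 ∷ []))
  isolatedMaxᵗ = loop small (const 0) (maxᵗ v1 (call isolatedPartᵗ (v0 ∷ v2 ∷ [])))

  totalWeightᵗ : Term 0
  totalWeightᵗ = sumᵗ (call weightᵗ (v0 ∷ []))

  subsetᵗ : Term 2
  subsetᵗ = everyᵗ (impliesᵗ (call memberᵗ (v2 ∷ v0 ∷ [])) (call memberᵗ (v3 ∷ v0 ∷ [])))

  tableᵗ : Term 1
  tableᵗ = read (tableBase ⊹ v0)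

  candidateᵗ : Term 4
  candidateᵗ = ite
    (andᵗ (leqᵗ (const 1) v3) (andᵗ (call subsetᵗ (v3 ∷ v2 ∷ [])) (andᵗ (call validᵗ (v0 ∷ v3 ∷ []))
      (andᵗ (leqᵗ (call regionWeightᵗ (v0 ∷ v3 ∷ [])) v1) (leqᵗ (const 1) (call tableᵗ (v2 ∸ᵗ v3 ∷ [])))))))
    (call tableᵗ (v2 ∸ᵗ v3 ∷ []) ⊹ call regionWeightᵗ (v0 ∷ v3 ∷ [])) (const 0)

  entryᵗ : Term 3
  entryᵗ = ite v2 (loop large (const 0) (maxᵗ v1 (call candidateᵗ (v2 ∷ v3 ∷ v4 ∷ v0 ∷ [])))) (const 1)

  limitᵗ : Term 2
  limitᵗ = maxᵗ (call regionWeightᵗ (v0 ∷ v1 ∷ [])) (call isolatedMaxᵗ (v0 ∷ []))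

  acceptᵗ : Term 2
  acceptᵗ = andᵗ (notᵗ (read (const 1))) (andᵗ (leqᵗ (const 1) (call tableᵗ (codes ∸ᵗ const 1 ∸ᵗ v0 ∷ [])))
    (leqᵗ (call totalWeightᵗ [] ⊹ v1 ⊹ const 1)
          (read (const 2) ⊹ call tableᵗ (codes ∸ᵗ const 1 ∸ᵗ v0 ∷ []) ⊹ call isolatedWeightᵗ (v0 ∷ []))))

-- Variables: ℓ, q, the result so far, s, and an unused one.
fillᶜ : Command 5
fillᶜ = repeat large (const 0) (store (tableBase ⊹ v0) (call entryᵗ (v5 ∷ v2 ∷ v0 ∷ [])))

-- Every attempt overwrites the table of the previous one. This is harmless: entries are filled in
-- increasing order, and since removing a nonempty set lowers the code, an entry depends only on
-- entries already renewed.
attemptᶜ : Command 4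
attemptᶜ = bind (ret (call limitᵗ (v2 ∷ v0 ∷ [])))
  (bind fillᶜ (ret (ite (call acceptᵗ (v4 ∷ v1 ∷ [])) (const 1) v3)))

searchᶜ : Command 0
searchᶜ = repeat large (const 0) (repeat large v1 attemptᶜ)

module Regions {n : ℕ} (A : Fin n → Fin n → Bool) (C : VertexSet n) where

  neighbours : VertexSet n → VertexSet n → VertexSet n
  neighbours s p v = every λ u → C u ∧ A v u ⇒ p u ∨ s u

  -- For `p` within the cover: `p` is a union of components of the graph induced on the cover
  -- without `s`.
  valid : VertexSet n → VertexSet n → Bool
  valid s p = every λ u → p u ⇒ not (s u) ∧ neighbours s p u

  region : VertexSet n → VertexSet n → VertexSet n
  region s p v = p v ∨ (not (C v) ∧ (neighbours s p v ∧ some λ u → A v u ∧ p u))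

  isolated : VertexSet n → VertexSet n
  isolated s v = not (C v) ∧ neighbours s ∅ᵇ v

subset : ∀ {n} → VertexSet n → VertexSet n → Bool
subset p f = every λ u → p u ⇒ f u

-- Values of the terms of the search

module InCover {n M L : ℕ} (A : Fin n → Fin n → Bool) (irreflexive : ∀ v → ¬ (A v v ≡ true))
  (C : VertexSet n) (μ : Memory)
  (read-adjacency : ∀ u v → μ (3 + n + n * toℕ u + toℕ v) ≡ bit (A u v)) where

  private
    γ : Vec ℕ 4
    γ = n ∷ M ∷ Coding.code (λ _ → true) C ∷ L ∷ []

  module AllVertices = CoverValue {n} {M} {Coding.code (λ _ → true) C} {L} μ A irreflexive read-adjacency

  opaque
    unfolding inCoverᵗ

    in-cover-value : ∀ v → eval γ μ inCoverᵗ (toℕ v ∷ []) ≡ bit (C v)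
    in-cover-value v = AllVertices.bit-value C v

  module B = BitValue {n} {M} {Coding.code (λ _ → true) C} {L} μ inCoverᵗ (ext C)
    (λ i i<n → trans (cong (λ j → eval γ μ inCoverᵗ (j ∷ [])) (sym (toℕ-fromℕ< i<n)))
      (trans (in-cover-value (fromℕ< i<n)) (cong bit (sym (ext-< C i<n)))))

  -- Available for every `M`, because it is applied while the global for the number of codes is
  -- still 0.
  size-value : eval γ μ (valᵗ inCoverᵗ) (n ∷ []) ≡ Coding.size C
  size-value = B.val-value n ≤-refl

module Values {n : ℕ} (A : Fin n → Fin n → Bool) (irreflexive : ∀ v → ¬ (A v v ≡ true))
  (C : VertexSet n) (w : Fin n → ℕ) (L : ℕ) (μ : Memory)
  (read-adjacency : ∀ u v → μ (3 + n + n * toℕ u + toℕ v) ≡ bit (A u v))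
  (read-weight : ∀ v → μ (3 + toℕ v) ≡ w v) where

  open Coding C
  open Regions A C

  γ : Vec ℕ 4
  γ = n ∷ size ∷ Coding.code (λ _ → true) C ∷ L ∷ []

  open InCover {n} {size} {L} A irreflexive C μ read-adjacency using (in-cover-value; module AllVertices; module B)

  opaque
    unfolding memberᵗ

    member-value : ∀ {f} → f ⊆ᵇ C → ∀ v → eval γ μ memberᵗ (code f ∷ toℕ v ∷ []) ≡ bit (f v)
    member-value {f} f⊆C v = trans (branch-bit (C v) _ _ (in-cover-value v)) (cases (C v) refl)
      where
      cases : ∀ b → C v ≡ b → (if b then eval γ μ (bitᵗ inCoverᵗ) (code f ∷ toℕ v ∷ []) else 0) ≡ bit (f v)
      cases true Cv = trans (B.bit-value (ext f) (toℕ v) (toℕ<n v) (trans (ext-toℕ C v) Cv)) (cong bit (ext-toℕ f v))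
      cases false Cv = cong bit (sym (¬-not λ fv → contradiction (trans (sym (f⊆C v fv)) Cv) λ ()))

  module _ {s p : VertexSet n} (s⊆C : s ⊆ᵇ C) (p⊆C : p ⊆ᵇ C) where

    opaque
      unfolding neighboursᵗ

      neighbours-value : ∀ v → eval γ μ neighboursᵗ (code s ∷ code p ∷ toℕ v ∷ []) ≡ bit (neighbours s p v)
      neighbours-value v = iter-every _ λ u _ →
        implies-value {a = C u ∧ A v u} (and-value {a = C u} (in-cover-value u) (AllVertices.adjacent-value v u))
          (or-value {a = p u} (member-value p⊆C u) (member-value s⊆C u))

    opaque
      unfolding validᵗ

      valid-value : eval γ μ validᵗ (code s ∷ code p ∷ []) ≡ bit (valid s p)
      valid-value = iter-every _ λ u _ → implies-value {a = p u} (member-value p⊆C u)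
        (and-value {a = not (s u)} (not-value {a = s u} (member-value s⊆C u)) (neighbours-value u))

    opaque
      unfolding regionᵗ

      region-value : ∀ v → eval γ μ regionᵗ (code s ∷ code p ∷ toℕ v ∷ []) ≡ bit (region s p v)
      region-value v = or-value {a = p v} (member-value p⊆C v)
        (and-value {a = not (C v)} (not-value {a = C v} (in-cover-value v))
          (and-value {a = neighbours s p v} (neighbours-value v)
            (some-value {φ = λ i x → eval γ μ (andᵗ (call adjacentᵗ (v4 ∷ v0 ∷ [])) (call memberᵗ (v3 ∷ v0 ∷ [])))
                (i ∷ x ∷ code s ∷ code p ∷ toℕ v ∷ [])} (λ u → A v u ∧ p u) λ u _ → and-value {a = A v u} (AllVertices.adjacent-value v u) (member-value p⊆C u))))

    opaque
      unfolding regionWeightᵗ weightᵗ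

      region-weight-value : eval γ μ regionWeightᵗ (code s ∷ code p ∷ []) ≡ total w (region s p)
      region-weight-value = iter-sum (part w (region s p)) λ v _ →
        trans (branch-bit (region s p v) _ _ (region-value v)) (cong (if region s p v then_else 0) (read-weight v))

    opaque
      unfolding subsetᵗ

      subset-value : eval γ μ subsetᵗ (code s ∷ code p ∷ []) ≡ bit (subset s p)
      subset-value = iter-every _ λ u _ → implies-value {a = s u} (member-value s⊆C u) (member-value p⊆C u)

  opaque
    unfolding totalWeightᵗ weightᵗ

    total-weight-value : eval γ μ totalWeightᵗ [] ≡ total w (λ _ → true)
    total-weight-value = iter-sum w λ v _ → read-weight v

  module _ {s : VertexSet n} (s⊆C : s ⊆ᵇ C) where

    opaque
      unfolding isolatedPartᵗ isolatedᵗ weightᵗ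

      isolated-part-value : ∀ v → eval γ μ isolatedPartᵗ (toℕ v ∷ code s ∷ []) ≡ part w (isolated s) v
      isolated-part-value v = trans
        (branch-bit (isolated s v) _ _ (and-value {a = not (C v)} (not-value {a = C v} (in-cover-value v))
          (trans (cong (λ x → eval γ μ neighboursᵗ (code s ∷ x ∷ toℕ v ∷ [])) (sym (code-empty {∅ᵇ} λ _ ())))
            (neighbours-value s⊆C (λ _ ()) v))))
        (cong (if isolated s v then_else 0) (read-weight v))

    opaque
      unfolding isolatedWeightᵗ

      isolated-weight-value : eval γ μ isolatedWeightᵗ (code s ∷ []) ≡ total w (isolated s)
      isolated-weight-value = iter-sum (part w (isolated s)) λ v _ → isolated-part-value v

    limit : VertexSet n → ℕ
    limit q = eval γ μ limitᵗ (code s ∷ code q ∷ [])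

    opaque
      unfolding limitᵗ isolatedMaxᵗ

      isolated≤limit : ∀ q v → isolated s v ≡ true → w v ≤ limit q
      isolated≤limit q v isolated-v = ≤-trans
        (≤-iter-max (toℕ<n v) λ x → ≤-reflexive (sym (trans (isolated-part-value v)
          (cong (if_then w v else 0) isolated-v))))
        (m≤n+m∸n _ (eval γ μ regionWeightᵗ (code s ∷ code q ∷ [])))

    opaque
      unfolding limitᵗ

      region≤limit : ∀ {q} → q ⊆ᵇ C → total w (region s q) ≤ limit q
      region≤limit {q} q⊆C = ≤-trans (≤-reflexive (sym (region-weight-value s⊆C q⊆C))) (m≤m+n _ _)

    opaque
      unfolding limitᵗ isolatedMaxᵗ

      limit≤ : ∀ {q m} → q ⊆ᵇ C → total w (region s q) ≤ m → (∀ v → isolated s v ≡ true → w v ≤ m) → limit q ≤ m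
      limit≤ {q} {m} q⊆C region≤m isolated≤m = m+[n∸m]≤
        (≤-trans (≤-reflexive (region-weight-value s⊆C q⊆C)) region≤m)
        (iter-max-≤ each)
        where
        part≤m : ∀ v → part w (isolated s) v ≤ m
        part≤m v with isolated s v | isolated≤m v
        ... | true  | le = le refl
        ... | false | _  = z≤n
        each : ∀ i → i < n → ∀ (x : ℕ) → eval γ μ isolatedPartᵗ (i ∷ code s ∷ []) ≤ m
        each i i<n x with fromℕ< i<n | toℕ-fromℕ< i<n
        ... | v | refl = ≤-trans (≤-reflexive (isolated-part-value v)) (part≤m v)

    candidate-condition : ℕ → VertexSet n → VertexSet n → Bool
    candidate-condition ℓ f p = (1 ≤ᵇ code p) ∧ (subset p f ∧ (valid s p ∧
      ((total w (region s p) ≤ᵇ ℓ) ∧ (1 ≤ᵇ μ (L + (code f ∸ code p))))))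

    opaque
      unfolding candidateᵗ tableᵗ

      candidate-value : ∀ {f p} ℓ → f ⊆ᵇ C → p ⊆ᵇ C →
        eval γ μ candidateᵗ (code s ∷ ℓ ∷ code f ∷ code p ∷ []) ≡
        (if candidate-condition ℓ f p then μ (L + (code f ∸ code p)) + total w (region s p) else 0)
      candidate-value {f} {p} ℓ f⊆C p⊆C = trans
        (branch-bit (candidate-condition ℓ f p) _ _
          (and-value {a = 1 ≤ᵇ code p} (leq-value 1 (code p))
          (and-value {a = subset p f} (subset-value p⊆C f⊆C)
          (and-value {a = valid s p} (valid-value s⊆C p⊆C)
          (and-value {a = total w (region s p) ≤ᵇ ℓ}
            (trans (cong (λ x → 1 ∸ (x ∸ ℓ)) (region-weight-value s⊆C p⊆C)) (leq-value (total w (region s p)) ℓ))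
            (leq-value 1 (μ (L + (code f ∸ code p)))))))))
        (cong (if candidate-condition ℓ f p then_else 0) (cong (μ (L + (code f ∸ code p)) +_) (region-weight-value s⊆C p⊆C)))

    entry : ℕ → ℕ → ℕ
    entry ℓ y = eval γ μ entryᵗ (code s ∷ ℓ ∷ y ∷ [])

    private
      branch-positive : ∀ {c x y} → 1 ≤ c → branch c x y ≡ x
      branch-positive (s≤s z≤n) = refl

      candidate : ℕ → VertexSet n → ℕ → ℕ
      candidate ℓ f i = eval γ μ candidateᵗ (code s ∷ ℓ ∷ code f ∷ i ∷ [])

      opaque
        unfolding entryᵗ

        entry-unfold : ∀ {f} ℓ → 1 ≤ code f →
                       entry ℓ (code f) ≡ iter size (λ i x → x + (candidate ℓ f i ∸ x)) 0
        entry-unfold ℓ = branch-positive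

      code-∖′ : ∀ {f p} → p ⊆ᵇ f → code f ∸ code p ≡ code (f ∖ᵇ p)
      code-∖′ {f} {p} p⊆f = trans (cong (_∸ code p) (code-∖ p⊆f)) (m+n∸n≡m (code (f ∖ᵇ p)) (code p))

      max-choice : ∀ m n → m + (n ∸ m) ≡ m ⊎ m + (n ∸ m) ≡ n
      max-choice m n with ≤-total m n
      ... | inj₁ m≤n = inj₂ (m+[n∸m]≡n m≤n)
      ... | inj₂ n≤m = inj₁ (trans (cong (m +_) (m≤n⇒m∸n≡0 n≤m)) (+-identityʳ m))

    opaque
      unfolding entryᵗ

      entry-0 : ∀ ℓ → entry ℓ 0 ≡ 1
      entry-0 ℓ = refl

    -- An entry is a maximum over all `p`, so each admissible `p` bounds it from below. Completeness
    -- of the search rests on this bound.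
    entry-lower : ∀ {f p} ℓ → f ⊆ᵇ C → p ⊆ᵇ f → 1 ≤ code p → valid s p ≡ true → total w (region s p) ≤ ℓ →
                  1 ≤ μ (L + code (f ∖ᵇ p)) →
                  μ (L + code (f ∖ᵇ p)) + total w (region s p) ≤ entry ℓ (code f)
    entry-lower {f} {p} ℓ f⊆C p⊆f p≥1 p-valid light filled =
      ≤-trans (≤-iter-max (code<size p) λ _ → ≤-reflexive (sym value))
        (≤-reflexive (sym (entry-unfold {f} ℓ f≥1)))
      where
      f≥1 : 1 ≤ code f
      f≥1 = ≤-trans p≥1 (≤-trans (m≤n+m _ _) (≤-reflexive (sym (code-∖ p⊆f))))

      condition : candidate-condition ℓ f p ≡ true
      condition = ∧-join (≤ᵇ-intro p≥1) (∧-join (every-intro λ u → ⇒-intro {p u} (p⊆f u))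
        (∧-join p-valid (∧-join (≤ᵇ-intro light)
          (≤ᵇ-intro (subst (λ i → 1 ≤ μ (L + i)) (sym (code-∖′ p⊆f)) filled)))))

      value : candidate ℓ f (code p) ≡ μ (L + code (f ∖ᵇ p)) + total w (region s p)
      value = trans (candidate-value ℓ f⊆C (λ v pv → f⊆C v (p⊆f v pv)))
        (trans (cong (if_then _ else 0) condition)
          (cong (λ i → μ (L + i) + total w (region s p)) (code-∖′ p⊆f)))

    Extends : ℕ → VertexSet n → VertexSet n → ℕ → Set
    Extends ℓ f p x = p ⊆ᵇ f × 1 ≤ code p × valid s p ≡ true × total w (region s p) ≤ ℓ ×
      1 ≤ μ (L + code (f ∖ᵇ p)) × x ≡ μ (L + code (f ∖ᵇ p)) + total w (region s p)

    -- A maximum started at 0 is 0 or attained, and a rejected candidate contributes 0 too. A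
    -- positive entry thus comes with the set that produced it, as soundness requires.
    entry-choice : ∀ {f} ℓ → f ⊆ᵇ C → 1 ≤ code f →
                   entry ℓ (code f) ≡ 0 ⊎ ∃ λ p → Extends ℓ f p (entry ℓ (code f))
    entry-choice {f} ℓ f⊆C f≥1 = subst (λ x → x ≡ 0 ⊎ ∃ λ p → Extends ℓ f p x) (sym (entry-unfold {f} ℓ f≥1))
      (iter-rule (λ _ x → x ≡ 0 ⊎ ∃ λ p → Extends ℓ f p x) size (inj₁ refl) step)
      where
      chosen : ∀ p → p ⊆ᵇ C → candidate ℓ f (code p) ≡ 0 ⊎ Extends ℓ f p (candidate ℓ f (code p))
      chosen p p⊆C with candidate-condition ℓ f p in eq | candidate-value {f} {p} ℓ f⊆C p⊆C
      ... | false | value = inj₁ value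
      ... | true  | value =
        let (p≥1 , eq₁)   = ∧-split {1 ≤ᵇ code p} eq
            (sub , eq₂)   = ∧-split {subset p f} eq₁
            (val , eq₃)   = ∧-split {valid s p} eq₂
            (light , fil) = ∧-split {total w (region s p) ≤ᵇ ℓ} eq₃
            p⊆f : p ⊆ᵇ f
            p⊆f v pv = ⇒-elim {p v} (every-elim (λ u → p u ⇒ f u) sub v) pv
        in inj₂ (p⊆f , ≤ᵇ-elim p≥1 , val , ≤ᵇ-elim light ,
             subst (λ i → 1 ≤ μ (L + i)) (code-∖′ p⊆f) (≤ᵇ-elim fil) ,
             trans value (cong (λ i → μ (L + i) + total w (region s p)) (code-∖′ p⊆f)))

      step : ∀ i {x} → i < size → x ≡ 0 ⊎ (∃ λ p → Extends ℓ f p x) →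
             x + (candidate ℓ f i ∸ x) ≡ 0 ⊎ ∃ λ p → Extends ℓ f p (x + (candidate ℓ f i ∸ x))
      step i {x} i<size q with code-surjective i<size
      ... | p , p⊆C , refl with max-choice x (candidate ℓ f (code p))
      ...   | inj₁ eq = subst (λ x → x ≡ 0 ⊎ ∃ λ p → Extends ℓ f p x) (sym eq) q
      ...   | inj₂ eq = subst (λ x → x ≡ 0 ⊎ ∃ λ p → Extends ℓ f p x) (sym eq)
                ([ inj₁ , (λ e → inj₂ (p , e)) ]′ (chosen p p⊆C))

    last-entry : ℕ
    last-entry = μ (L + code (C ∖ᵇ s))

    opaque
      unfolding acceptᵗ tableᵗ

      -- The set to be deleted weighs the total minus the kept regions and the isolated vertices.
      -- That this plus `ℓ` is at most `k` is tested with all terms moved to the side on which they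
      -- are added; the 1 offsets the shift of the table entries.
      accept-value : ∀ {negative k} → μ 1 ≡ bit negative → μ 2 ≡ k → ∀ ℓ →
        eval γ μ acceptᵗ (code s ∷ ℓ ∷ []) ≡
        bit (not negative ∧ ((1 ≤ᵇ last-entry) ∧ (total w (λ _ → true) + ℓ + 1 ≤ᵇ k + last-entry + total w (isolated s))))
      accept-value {negative} {k} sign absolute ℓ = and-value {a = not negative} (not-value {a = negative} sign)
        (and-value {a = 1 ≤ᵇ last-entry} (trans (cong (λ i → 1 ∸ (1 ∸ μ (L + i))) full) (leq-value 1 last-entry))
          (trans (cong₂ (λ x y → 1 ∸ (x ∸ y)) (cong (λ W → W + ℓ + 1) total-weight-value)
              (cong₂ _+_ (cong₂ (λ a i → a + μ (L + i)) absolute full) isolated-weight-value))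
            (leq-value _ (k + last-entry + total w (isolated s)))))
        where
        full : size ∸ 1 ∸ code s ≡ code (C ∖ᵇ s)
        full = trans (cong (λ m → m ∸ 1 ∸ code s) (sym code-full)) (code-∖′ s⊆C)

-- Regions and components

maximal : ∀ {n} (f : VertexSet n) (g : Fin n → ℕ) →
          (∀ v → ¬ (f v ≡ true)) ⊎ ∃ λ u → f u ≡ true × ∀ v → f v ≡ true → g v ≤ g u
maximal {zero}  f g = inj₁ λ ()
maximal {suc n} f g with f zero in f0 | maximal (f ∘ suc) (g ∘ suc)
... | false | inj₁ none = inj₁ λ { zero q → contradiction (trans (sym f0) q) λ () ; (suc v) → none v }
... | true  | inj₁ none = inj₂ (zero , f0 , λ { zero _ → ≤-refl ; (suc v) q → contradiction q (none v) })
... | false | inj₂ (u , fu , largest) =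
  inj₂ (suc u , fu , λ { zero q → contradiction (trans (sym f0) q) λ () ; (suc v) → largest v })
... | true  | inj₂ (u , fu , largest) with ≤-total (g zero) (g (suc u))
...   | inj₁ le = inj₂ (suc u , fu , λ { zero _ → le ; (suc v) → largest v })
...   | inj₂ ge = inj₂ (zero , f0 , λ { zero _ → ≤-refl ; (suc v) q → ≤-trans (largest v q) ge })

-- Everything that the exchange argument uses about the components of the graph without `S`, freed
-- from paths.
record Components {n : ℕ} (A : Fin n → Fin n → Bool) (w : Fin n → ℕ)
                  (S : VertexSet n) (component : Fin n → VertexSet n) (m : ℕ) : Set where
  field
    component-self   : ∀ u → ¬ (S u ≡ true) → component u u ≡ true
    component-avoids : ∀ u v → ¬ (S u ≡ true) → component u v ≡ true → ¬ (S v ≡ true)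
    component-step   : ∀ u v x → ¬ (S u ≡ true) → component u v ≡ true → A v x ≡ true → ¬ (S x ≡ true) →
                       component u x ≡ true
    component-sym    : ∀ u v → component u v ≡ true → component v u ≡ true
    component-trans  : ∀ u v x → component u v ≡ true → component v x ≡ true → component u x ≡ true
    component-weight : ∀ u → ¬ (S u ≡ true) → total w (component u) ≤ m

module Combinatorics {n : ℕ} (A : Fin n → Fin n → Bool) (A-sym : ∀ {u v} → A u v ≡ true → A v u ≡ true)
  (C : VertexSet n) (cover : IsCover A C) (w : Fin n → ℕ) where

  open Regions A C

  neighbours-elim : ∀ s p v {u} → neighbours s p v ≡ true → C u ≡ true → A v u ≡ true → p u ≡ true ⊎ s u ≡ true
  neighbours-elim s p v nb Cu Avu =
    ∨-split (⇒-elim (every-elim (λ u → C u ∧ A v u ⇒ p u ∨ s u) nb _) (∧-join Cu Avu))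

  neighbours-intro : ∀ {s p v} → (∀ u → C u ≡ true → A v u ≡ true → p u ≡ true ⊎ s u ≡ true) → neighbours s p v ≡ true
  neighbours-intro {s} {p} {v} nb = every-intro λ u → ⇒-intro {C u ∧ A v u} λ q →
    [ ∨-left , ∨-right {p u} ]′ (nb u (proj₁ (∧-split q)) (proj₂ (∧-split {C u} q)))

  neighbour-in-cover : ∀ {u v} → ¬ (C v ≡ true) → A v u ≡ true → C u ≡ true
  neighbour-in-cover {u} {v} ¬Cv Avu = [ (λ Cv → contradiction Cv ¬Cv) , id ]′ (cover v u Avu)

  region-cover : ∀ {s p v} → C v ≡ true → region s p v ≡ true → p v ≡ true
  region-cover {s} {p} {v} Cv r = [ id , (λ q → contradiction Cv (not-elim (proj₁ (∧-split q)))) ]′ (∨-split {p v} r)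

  region-outside : ∀ {s p v} → p ⊆ᵇ C → ¬ (C v ≡ true) → region s p v ≡ true →
                   neighbours s p v ≡ true × ∃ λ u → A v u ≡ true × p u ≡ true
  region-outside {s} {p} {v} p⊆C ¬Cv r =
    [ (λ pv → contradiction (p⊆C v pv) ¬Cv)
    , (λ q → let q′ = proj₂ (∧-split {not (C v)} q)
                 (u , a) = some-elim (proj₂ (∧-split {neighbours s p v} q′))
             in proj₁ (∧-split q′) , u , proj₁ (∧-split a) , proj₂ (∧-split {A v u} a)) ]′ (∨-split {p v} r)

  ∈⇒region : ∀ {s p v} → p v ≡ true → region s p v ≡ true
  ∈⇒region = ∨-left

  region-intro : ∀ {s p v u} → ¬ (C v ≡ true) → neighbours s p v ≡ true → A v u ≡ true → p u ≡ true →
                 region s p v ≡ true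
  region-intro {s} {p} {v} {u} ¬Cv nb Avu pu =
    ∨-right {p v} (∧-join (not-intro ¬Cv) (∧-join nb (some-intro u (∧-join Avu pu))))

  region-mono : ∀ {s p q v} → p ⊆ᵇ q → region s p v ≡ true → region s q v ≡ true
  region-mono {s} {p} {q} {v} p⊆q r =
    [ (λ pv → ∈⇒region {s} {q} (p⊆q v pv))
    , (λ r′ → let (¬Cv , r″) = ∧-split {not (C v)} r′
                  (nb , touches) = ∧-split {neighbours s p v} r″
                  (u , a) = some-elim {f = λ u → A v u ∧ p u} touches
                  (Avu , pu) = ∧-split {A v u} a
              in region-intro {s} {q} {v} {u} (not-elim ¬Cv)
                   (neighbours-intro {s} {q} {v} λ x Cx Avx →
                     [ (λ px → inj₁ (p⊆q x px)) , inj₂ ]′ (neighbours-elim s p v nb Cx Avx))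
                   Avu (p⊆q u pu)) ]′ (∨-split {p v} r)

  isolated-elim : ∀ {s v} → isolated s v ≡ true → ¬ (C v ≡ true) × (∀ u → A v u ≡ true → s u ≡ true)
  isolated-elim {s} {v} i = ¬Cv , λ u Avu →
      [ (λ ()) , id ]′ (neighbours-elim s ∅ᵇ v (proj₂ (∧-split {not (C v)} i)) (neighbour-in-cover ¬Cv Avu) Avu)
    where ¬Cv = not-elim (proj₁ (∧-split i))

  valid-elim : ∀ s p {u} → valid s p ≡ true → p u ≡ true → ¬ (s u ≡ true) × neighbours s p u ≡ true
  valid-elim s p {u} v pu =
    let q = ⇒-elim {p u} (every-elim (λ u → p u ⇒ not (s u) ∧ neighbours s p u) v u) pu
    in not-elim (proj₁ (∧-split q)) , proj₂ (∧-split {not (s u)} q)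

  -- A set h of vertices that may be kept when s is deleted, f being its part
  -- in the cover: it splits into blocks of weight at most ℓ without edges
  -- between them.
  record Kept (s : VertexSet n) (ℓ : ℕ) (f h : VertexSet n) : Set where
    field
      cover-part  : ∀ v → h v ≡ true → C v ≡ true → f v ≡ true
      contains    : f ⊆ᵇ h
      avoids      : ∀ v → f v ≡ true → ¬ (s v ≡ true)
      attached    : ∀ v → h v ≡ true → ¬ (C v ≡ true) → ∃ λ u → A v u ≡ true × f u ≡ true
      surrounded  : ∀ v → h v ≡ true → ¬ (C v ≡ true) → ∀ u → A v u ≡ true → f u ≡ true ⊎ s u ≡ true
      blocks      : ∀ u → h u ≡ true → Σ[ B ∈ VertexSet n ] B u ≡ true × total w B ≤ ℓ ×
                    (∀ x y → B x ≡ true → h y ≡ true → A x y ≡ true → B y ≡ true)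

  open Kept

  kept-empty : ∀ {s ℓ f} → (∀ v → ¬ (f v ≡ true)) → Kept s ℓ f ∅ᵇ
  kept-empty empty = record
    { cover-part = λ _ ()
    ; contains   = λ v fv → contradiction fv (empty v)
    ; avoids     = λ v fv → contradiction fv (empty v)
    ; attached   = λ _ ()
    ; surrounded = λ _ ()
    ; blocks     = λ _ ()
    }

  module _ {s ℓ f p h} (f⊆C : f ⊆ᵇ C) (p⊆f : p ⊆ᵇ f) (p-valid : valid s p ≡ true)
           (kept : Kept s ℓ (f ∖ᵇ p) h) where

    private
      p⊆C : p ⊆ᵇ C
      p⊆C v pv = f⊆C v (p⊆f v pv)

      ∖⊆ : f ∖ᵇ p ⊆ᵇ f
      ∖⊆ v q = proj₁ (∧-split q)

      ∖-disjoint : Disjoint (f ∖ᵇ p) p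
      ∖-disjoint v q = not-elim (proj₂ (∧-split {f v} q))

      apart : ∀ {y x} → h y ≡ true → ¬ (C y ≡ true) → A y x ≡ true → p x ≡ true → ⊥
      apart {y} {x} hy ¬Cy Ayx px =
        [ (λ q → ∖-disjoint x q px) , proj₁ (valid-elim s p p-valid px) ]′ (surrounded kept y hy ¬Cy x Ayx)

    region-disjoint : Disjoint h (region s p)
    region-disjoint v hv r with C v ≟ᵇ true
    ... | yes Cv = ∖-disjoint v (cover-part kept v hv Cv) (region-cover {s} {p} Cv r)
    ... | no ¬Cv = let (_ , u , Avu , pu) = region-outside p⊆C ¬Cv r in apart hv ¬Cv Avu pu

    -- If `y` is outside the cover, then `x` is in `p`, but the neighbours of `y` are in the
    -- remainder of `f` or in `s`. If `y` is in the cover, then the condition on the region puts `y`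
    -- into `p` or `s`, and `h` meets neither.
    no-edge : ∀ x y → region s p x ≡ true → h y ≡ true → A x y ≡ true → ⊥
    no-edge x y r hy Axy with C y ≟ᵇ true
    ... | no ¬Cy = apart hy ¬Cy (A-sym Axy) (region-cover {s} {p} Cx r)
      where Cx = neighbour-in-cover ¬Cy (A-sym Axy)
    ... | yes Cy = [ ∖-disjoint y fy , avoids kept y fy ]′ (neighbours-elim s p x nb Cy Axy)
      where
      fy = cover-part kept y hy Cy
      nb : neighbours s p x ≡ true
      nb with C x ≟ᵇ true
      ... | yes Cx = proj₂ (valid-elim s p p-valid (region-cover {s} {p} Cx r))
      ... | no ¬Cx = proj₁ (region-outside p⊆C ¬Cx r)

    kept-step : total w (region s p) ≤ ℓ → Kept s ℓ f (h ∪ᵇ region s p)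
    kept-step light = record
      { cover-part = λ v q Cv → [ (λ hv → ∖⊆ v (cover-part kept v hv Cv))
                                , (λ r → p⊆f v (region-cover {s} {p} Cv r)) ]′ (∨-split {h v} q)
      ; contains   = contains′
      ; avoids     = avoids′
      ; attached   = λ v q ¬Cv → [ (λ hv → let (u , a , b) = attached kept v hv ¬Cv in u , a , ∖⊆ u b)
                                 , (λ r → let (_ , u , a , b) = region-outside p⊆C ¬Cv r in u , a , p⊆f u b) ]′ (∨-split {h v} q)
      ; surrounded = λ v q ¬Cv u Avu →
          [ (λ hv → [ (λ b → inj₁ (∖⊆ u b)) , inj₂ ]′ (surrounded kept v hv ¬Cv u Avu))
          , (λ r → [ (λ b → inj₁ (p⊆f u b)) , inj₂ ]′
              (neighbours-elim s p v (proj₁ (region-outside p⊆C ¬Cv r)) (neighbour-in-cover ¬Cv Avu) Avu)) ]′ (∨-split {h v} q)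
      ; blocks     = λ u q → [ old u , (λ r → region s p , r , light , new) ]′ (∨-split {h u} q)
      }
      where
      contains′ : f ⊆ᵇ h ∪ᵇ region s p
      contains′ v fv with p v ≟ᵇ true
      ... | yes pv = ∨-right {h v} (∈⇒region {s} pv)
      ... | no ¬pv = ∨-left (contains kept v (∧-join fv (not-intro ¬pv)))

      avoids′ : ∀ v → f v ≡ true → ¬ (s v ≡ true)
      avoids′ v fv with p v ≟ᵇ true
      ... | yes pv = proj₁ (valid-elim s p p-valid pv)
      ... | no ¬pv = avoids kept v (∧-join fv (not-intro ¬pv))

      new : ∀ x y → region s p x ≡ true → (h ∪ᵇ region s p) y ≡ true → A x y ≡ true → region s p y ≡ true
      new x y r q Axy = [ (λ hy → ⊥-elim (no-edge x y r hy Axy)) , id ]′ (∨-split {h y} q)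

      old : ∀ u → h u ≡ true → Σ[ B ∈ VertexSet n ] B u ≡ true × total w B ≤ ℓ ×
            (∀ x y → B x ≡ true → (h ∪ᵇ region s p) y ≡ true → A x y ≡ true → B y ≡ true)
      old u hu =
        let (B , Bu , B≤ℓ , closed) = blocks kept u hu
        -- A block need only be closed within `h` and may contain other vertices. Cutting it down to
        -- `h` ensures that no edge leads from it into the new region.
        in (λ v → B v ∧ h v) , ∧-join Bu hu ,
           ≤-trans (total-mono w (λ v → B v ∧ h v) B λ v q → proj₁ (∧-split q)) B≤ℓ ,
           λ x y q r Axy →
             [ (λ hy → ∧-join (closed x y (proj₁ (∧-split q)) hy Axy) hy)
             , (λ r′ → ⊥-elim (no-edge y x r′ (proj₂ (∧-split {B x} q)) (A-sym Axy))) ]′ (∨-split {h y} r)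

  rest : VertexSet n → VertexSet n
  rest s = C ∖ᵇ s

  deleted : VertexSet n → VertexSet n → VertexSet n
  deleted s h v = not (h v ∨ isolated s v)

  not-deleted : ∀ s h {v} → ¬ (deleted s h v ≡ true) → h v ≡ true ⊎ isolated s v ≡ true
  not-deleted s h {v} ¬d with (h v ∨ isolated s v) ≟ᵇ true
  ... | yes q = ∨-split q
  ... | no ¬q = contradiction (not-intro ¬q) ¬d

  module _ {s ℓ h} (kept : Kept s ℓ (rest s) h) where

    private
      not-both : ∀ v → h v ≡ true → C v ≡ true → s v ≡ true → ⊥
      not-both v hv Cv = avoids kept v (cover-part kept v hv Cv)

    isolated-disjoint : Disjoint h (isolated s)
    isolated-disjoint v hv i =
      let (¬Cv , nb) = isolated-elim i
          (u , Avu , fu) = attached kept v hv ¬Cv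
      in avoids kept u fu (nb u Avu)

    deleted-weight : total w (deleted s h) + (total w h + total w (isolated s)) ≤ total w (λ _ → true)
    deleted-weight = ≤-trans
      (+-monoʳ-≤ (total w (deleted s h)) (total-pack w h (isolated s) (λ v → h v ∨ isolated s v) isolated-disjoint
        λ v → [ ∨-left , ∨-right {h v} ]′))
      (total-pack w (deleted s h) (λ v → h v ∨ isolated s v) (λ _ → true) (λ v d q → not-elim d q) (λ _ _ → refl))

    light-blocks : (∀ v → isolated s v ≡ true → w v ≤ ℓ) → ∀ u → ¬ (deleted s h u ≡ true) →
      Σ[ B ∈ VertexSet n ] B u ≡ true × total w B ≤ ℓ ×
        (∀ x y → B x ≡ true → ¬ (deleted s h y ≡ true) → A x y ≡ true → B y ≡ true)
    light-blocks isolated≤ℓ u ¬d = [ attached-block , isolated-block ]′ (not-deleted s h ¬d)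
      where
      attached-block : h u ≡ true → Σ[ B ∈ VertexSet n ] B u ≡ true × total w B ≤ ℓ ×
        (∀ x y → B x ≡ true → ¬ (deleted s h y ≡ true) → A x y ≡ true → B y ≡ true)
      attached-block hu =
        let (B , Bu , B≤ℓ , closed) = blocks kept u hu
        in (λ v → B v ∧ h v) , ∧-join Bu hu ,
           ≤-trans (total-mono w (λ v → B v ∧ h v) B λ v q → proj₁ (∧-split q)) B≤ℓ ,
           λ x y q ¬d′ Axy →
             [ (λ hy → ∧-join (closed x y (proj₁ (∧-split q)) hy Axy) hy)
             , (λ i → let (¬Cy , nb) = isolated-elim i
                          Cx = neighbour-in-cover ¬Cy (A-sym Axy)
                      in ⊥-elim (not-both x (proj₂ (∧-split {B x} q)) Cx (nb x (A-sym Axy)))) ]′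
             (not-deleted s h ¬d′)

      isolated-block : isolated s u ≡ true → Σ[ B ∈ VertexSet n ] B u ≡ true × total w B ≤ ℓ ×
        (∀ x y → B x ≡ true → ¬ (deleted s h y ≡ true) → A x y ≡ true → B y ≡ true)
      isolated-block i = ⁅ u ⁆ᵇ , ∈⁅⁆ u ,
        ≤-trans (≤-reflexive (total-single w u (∈⁅⁆ u) λ v → ∈⁅⁆⇒≡ {v = v})) (isolated≤ℓ u i) ,
        λ x y q ¬d′ Axy → ⊥-elim (alone y (subst (λ x → A x y ≡ true) (∈⁅⁆⇒≡ {v = x} q) Axy) (not-deleted s h ¬d′))
        where
        alone : ∀ y → A u y ≡ true → h y ≡ true ⊎ isolated s y ≡ true → ⊥
        alone y Auy q =
          let (¬Cu , nb) = isolated-elim i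
              Cy = neighbour-in-cover ¬Cu Auy
          in [ (λ hy → not-both y hy Cy (nb y Auy)) , (λ i′ → proj₁ (isolated-elim i′) Cy) ]′ q

  -- The exchange argument for a given deleted set

  module Optimal {S : VertexSet n} {component : Fin n → VertexSet n} {m : ℕ} (components : Components A w S component m) where

    open Components components

    s : VertexSet n
    s v = C v ∧ S v

    part-of : Fin n → VertexSet n
    part-of u v = C v ∧ component u v

    part-of⊆C : ∀ u → part-of u ⊆ᵇ C
    part-of⊆C u v q = proj₁ (∧-split q)

    rest-∉S : ∀ u → rest s u ≡ true → ¬ (S u ≡ true)
    rest-∉S u q Su = let (Cu , ¬su) = ∧-split {C u} q in not-elim ¬su (∧-join Cu Su)

    rest-intro : ∀ u → C u ≡ true → ¬ (S u ≡ true) → rest s u ≡ true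
    rest-intro u Cu ¬Su = ∧-join Cu (not-intro λ q → ¬Su (proj₂ (∧-split {C u} q)))

    Closed : VertexSet n → Set
    Closed f = ∀ u v → f u ≡ true → part-of u v ≡ true → f v ≡ true

    rest-closed : Closed (rest s)
    rest-closed u v ru q = let (Cv , cuv) = ∧-split {C v} q in
      rest-intro v Cv (component-avoids u v (rest-∉S u ru) cuv)

    part-of-self : ∀ u → rest s u ≡ true → part-of u u ≡ true
    part-of-self u ru = ∧-join (proj₁ (∧-split ru)) (component-self u (rest-∉S u ru))

    component-neighbours : ∀ u v → ¬ (S u ≡ true) → component u v ≡ true → neighbours s (part-of u) v ≡ true
    component-neighbours u v ¬Su cuv = neighbours-intro {s} {part-of u} {v} inside-or-deleted
      where
      inside-or-deleted : ∀ x → C x ≡ true → A v x ≡ true → part-of u x ≡ true ⊎ s x ≡ true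
      inside-or-deleted x Cx Avx with S x ≟ᵇ true
      ... | yes Sx = inj₂ (∧-join Cx Sx)
      ... | no ¬Sx = inj₁ (∧-join Cx (component-step u v x ¬Su cuv Avx ¬Sx))

    part-of-valid : ∀ u → rest s u ≡ true → valid s (part-of u) ≡ true
    part-of-valid u ru = every-intro λ v → ⇒-intro {part-of u v} λ q →
      let (Cv , cuv) = ∧-split {C v} q in
      ∧-join (not-intro λ sv → component-avoids u v (rest-∉S u ru) cuv (proj₂ (∧-split {C v} sv)))
             (component-neighbours u v (rest-∉S u ru) cuv)

    -- The union of the regions of the traces of all components that meet `f`. For closed `f` this
    -- is what the table can collect by splitting off one trace after another.
    attachedTo : VertexSet n → VertexSet n
    attachedTo f v = some λ u → f u ∧ region s (part-of u) v

    attachedTo-intro : ∀ f u v → f u ≡ true → region s (part-of u) v ≡ true → attachedTo f v ≡ true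
    attachedTo-intro f u v fu r = some-intro {f = λ u → f u ∧ region s (part-of u) v} u (∧-join fu r)

    attachedTo-elim : ∀ f v → attachedTo f v ≡ true → ∃ λ u → f u ≡ true × region s (part-of u) v ≡ true
    attachedTo-elim f v q = let (u , r) = some-elim {f = λ u → f u ∧ region s (part-of u) v} q
      in u , ∧-split {f u} r

    ∖-closed : ∀ f u → f ⊆ᵇ rest s → Closed f → Closed (f ∖ᵇ part-of u)
    ∖-closed f u f⊆rest closed x y q r =
      let (fx , ¬px) = ∧-split {f x} q
          (Cy , cxy) = ∧-split {C y} r
      in ∧-join (closed x y fx r) (not-intro λ py → not-elim ¬px
           (∧-join (proj₁ (∧-split (f⊆rest x fx)))
             (component-trans u y x (proj₂ (∧-split {C y} py)) (component-sym x y cxy))))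

    -- A vertex `x` in the trace at `u` has its own trace inside that one, by transitivity, and
    -- regions are monotone. So whatever is lost with the trace lies in its region.
    attachedTo-∖ : ∀ f u → total w (attachedTo f) ≤
                   total w (attachedTo (f ∖ᵇ part-of u)) + total w (region s (part-of u))
    attachedTo-∖ f u = total-cover w _ _ _ split
      where
      split : ∀ v → attachedTo f v ≡ true → attachedTo (f ∖ᵇ part-of u) v ≡ true ⊎ region s (part-of u) v ≡ true
      split v q with attachedTo-elim f v q
      ... | x , fx , r with part-of u x ≟ᵇ true
      ...   | no ¬p = inj₁ (attachedTo-intro (f ∖ᵇ part-of u) x v (∧-join fx (not-intro ¬p)) r)
      ...   | yes p = inj₂ (region-mono {s} {part-of x} {part-of u} {v}
              (λ y py → let (Cy , cxy) = ∧-split {C y} py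
                        in ∧-join Cy (component-trans u x y (proj₂ (∧-split {C x} p)) cxy)) r)

    attachedTo-empty : ∀ f → (∀ v → ¬ (f v ≡ true)) → total w (attachedTo f) ≡ 0
    attachedTo-empty f empty = sum-0 λ v → cong (if_then w v else 0)
      (¬-not λ q → let (u , fu , _) = attachedTo-elim f v q in empty u fu)

    remaining : VertexSet n
    remaining = deleted s (attachedTo (rest s))

    total-≤ : total w (λ _ → true) ≤ total w remaining + (total w (attachedTo (rest s)) + total w (isolated s))
    total-≤ = ≤-trans (total-cover w (λ _ → true) remaining (λ v → attachedTo (rest s) v ∨ isolated s v) λ v _ → either v)
      (+-monoʳ-≤ (total w remaining) (total-cover w _ (attachedTo (rest s)) (isolated s) λ v → ∨-split))
      where
      either : ∀ v → remaining v ≡ true ⊎ attachedTo (rest s) v ∨ isolated s v ≡ true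
      either v with attachedTo (rest s) v ∨ isolated s v
      ... | true  = inj₂ refl
      ... | false = inj₁ refl

    -- A vertex `v` outside `S` is kept. In the cover it belongs to its own trace. Otherwise all its
    -- neighbours are in `s` and it is isolated, or some neighbour `u` is not in `S`, and then `v`
    -- lies in the region of the trace of `u`.
    remaining⊆S : remaining ⊆ᵇ S
    remaining⊆S v q with S v ≟ᵇ true
    ... | yes Sv = Sv
    ... | no ¬Sv = contradiction (kept-or-isolated (C v ≟ᵇ true)) (not-elim q)
      where
      by-neighbour : ¬ (C v ≡ true) → (∃ λ u → ¬ ((C u ∧ A v u ⇒ s u) ≡ true)) → attachedTo (rest s) v ≡ true
      by-neighbour ¬Cv (u , ¬q) with C u ≟ᵇ true | A v u ≟ᵇ true | S u ≟ᵇ true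
      ... | no ¬Cu | _ | _ = contradiction (⇒-intro {C u ∧ A v u} λ r → contradiction (proj₁ (∧-split r)) ¬Cu) ¬q
      ... | yes _ | no ¬Avu | _ = contradiction (⇒-intro {C u ∧ A v u} λ r → contradiction (proj₂ (∧-split {C u} r)) ¬Avu) ¬q
      ... | yes Cu | yes _ | yes Su = contradiction (⇒-intro {C u ∧ A v u} λ r → ∧-join Cu Su) ¬q
      ... | yes Cu | yes Avu | no ¬Su = attachedTo-intro (rest s) u v ru
            (region-intro {s} {part-of u} {v} {u} ¬Cv
              (component-neighbours u v ¬Su (component-step u u v ¬Su (component-self u ¬Su) (A-sym Avu) ¬Sv))
              Avu (part-of-self u ru))
        where ru = rest-intro u Cu ¬Su

      kept-or-isolated : Dec (C v ≡ true) → attachedTo (rest s) v ∨ isolated s v ≡ true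
      kept-or-isolated (yes Cv) = ∨-left (attachedTo-intro (rest s) v v rv (∈⇒region {s} {part-of v} (part-of-self v rv)))
        where rv = rest-intro v Cv ¬Sv
      kept-or-isolated (no ¬Cv) with all? (λ u → (C u ∧ A v u ⇒ s u) ≟ᵇ true)
      ... | yes all = ∨-right {attachedTo (rest s) v} (∧-join (not-intro ¬Cv) (every-intro all))
      ... | no ¬all = ∨-left (by-neighbour ¬Cv (¬∀⟶∃¬ n _ (λ u → (C u ∧ A v u ⇒ s u) ≟ᵇ true) ¬all))

    region⊆ : ∀ u → rest s u ≡ true → ∀ v → region s (part-of u) v ≡ true → S v ≡ true ⊎ component u v ≡ true
    region⊆ u ru v r with S v ≟ᵇ true | C v ≟ᵇ true
    ... | yes Sv | _ = inj₁ Sv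
    ... | no ¬Sv | yes Cv = inj₂ (proj₂ (∧-split {C v} (region-cover {s} {part-of u} Cv r)))
    ... | no ¬Sv | no ¬Cv =
      let (_ , x , Avx , px) = region-outside (part-of⊆C u) ¬Cv r
      in inj₂ (component-step u x v (rest-∉S u ru) (proj₂ (∧-split {C x} px)) (A-sym Avx) ¬Sv)

    -- The two sets on the left are disjoint, and both lie in the union of `S` and the component of
    -- `u`. Vertices of `S` that `B` takes back are paid for by what is saved in deletions.
    exchange : ∀ B {u} → ¬ (S u ≡ true) → Disjoint remaining B →
               (∀ v → B v ≡ true → S v ≡ true ⊎ component u v ≡ true) →
               total w remaining + total w B ≤ total w S + m
    exchange B {u} ¬Su disjoint B⊆ = ≤-trans
      (total-pack w remaining B (λ v → remaining v ∨ B v) disjoint (λ v → [ ∨-left , ∨-right {remaining v} ]′))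
      (≤-trans (total-cover w _ S (component u) λ v q → [ (λ d → inj₁ (remaining⊆S v d)) , B⊆ v ]′ (∨-split {remaining v} q))
        (+-monoʳ-≤ (total w S) (component-weight u ¬Su)))

    region-bound : ∀ u → rest s u ≡ true → total w remaining + total w (region s (part-of u)) ≤ total w S + m
    region-bound u ru = exchange (region s (part-of u)) (rest-∉S u ru)
      (λ v d r → not-elim d (∨-left (attachedTo-intro (rest s) u v ru r))) (region⊆ u ru)

    isolated-bound : ∀ v → isolated s v ≡ true → total w remaining + w v ≤ total w S + m
    isolated-bound v i = ≤-trans (+-monoʳ-≤ (total w remaining) (∈⇒≤total w {⁅ v ⁆ᵇ} {v} (∈⁅⁆ v))) (cases (S v ≟ᵇ true))
      where
      disjoint : Disjoint remaining ⁅ v ⁆ᵇ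
      disjoint x d q = not-elim d (∨-right {attachedTo (rest s) x} (trans (cong (isolated s) (∈⁅⁆⇒≡ {v = x} q)) i))

      cases : Dec (S v ≡ true) → total w remaining + total w ⁅ v ⁆ᵇ ≤ total w S + m
      cases (no ¬Sv) = exchange ⁅ v ⁆ᵇ ¬Sv disjoint
        λ x q → inj₂ (trans (cong (component v) (∈⁅⁆⇒≡ {v = x} q)) (component-self v ¬Sv))
      -- Here `S` deletes `v`, so its weight is already part of the weight of `S`.
      cases (yes Sv) = ≤-trans
        (total-pack w remaining ⁅ v ⁆ᵇ S disjoint
          λ x → [ remaining⊆S x , (λ q → trans (cong S (∈⁅⁆⇒≡ {v = x} q)) Sv) ]′)
        (m≤m+n _ m)

    remaining-bound : total w remaining ≤ total w S + m
    remaining-bound = ≤-trans (total-mono w remaining S remaining⊆S) (m≤m+n _ m)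

    region-empty : total w (region s ∅ᵇ) ≡ 0
    region-empty = sum-0 λ v → cong (if_then w v else 0) (¬-not λ r →
      [ (λ ()) , (λ q → let (_ , q′) = ∧-split {neighbours s ∅ᵇ v} (proj₂ (∧-split {not (C v)} q))
                            (u , a) = some-elim {f = λ u → A v u ∧ false} q′
                        in contradiction (proj₂ (∧-split {A v u} a)) λ ()) ]′ (∨-split {false} r))

    -- The `q` for which the search succeeds: the trace with the heaviest region, so that its limit
    -- admits all the others. If the cover lies within `s`, there is no trace, and the empty set
    -- with its region of weight 0 takes its place.
    heaviest : Σ[ q ∈ VertexSet n ] q ⊆ᵇ C ×
      (∀ u → rest s u ≡ true → total w (region s (part-of u)) ≤ total w (region s q)) ×
      total w remaining + total w (region s q) ≤ total w S + m
    heaviest with maximal (rest s) (λ u → total w (region s (part-of u)))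
    ... | inj₁ none = ∅ᵇ , (λ _ ()) , (λ u ru → contradiction ru (none u)) ,
      ≤-trans (≤-reflexive (trans (cong (total w remaining +_) region-empty) (+-identityʳ _))) remaining-bound
    ... | inj₂ (u , ru , largest) = part-of u , part-of⊆C u , largest , region-bound u ru

-- Correctness of the search

module Search {n : ℕ} (A : Fin n → Fin n → Bool) (irreflexive : ∀ v → ¬ (A v v ≡ true))
  (A-sym : ∀ {u v} → A u v ≡ true → A v u ≡ true)
  (C : VertexSet n) (cover : IsCover A C) (w : Fin n → ℕ) (L : ℕ) (input : Memory)
  (negative : Bool) (k : ℕ) (input-length : 3 + n + n * n ≤ L)
  (input-sign : input 1 ≡ bit negative) (input-absolute : input 2 ≡ k)
  (input-adjacency : ∀ u v → input (3 + n + n * toℕ u + toℕ v) ≡ bit (A u v))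
  (input-weight : ∀ v → input (3 + toℕ v) ≡ w v) where

  open Coding C
  open Regions A C
  open Combinatorics A A-sym C cover w

  Intact : Memory → Set
  Intact μ = ∀ a → a < L → μ a ≡ input a

  adjacency-address : ∀ (u v : Fin n) → 3 + n + n * toℕ u + toℕ v < L
  adjacency-address u v = ≤-trans (≤-reflexive (sym (+-suc (3 + n + n * toℕ u) (toℕ v))))
    (≤-trans (+-monoʳ-≤ (3 + n + n * toℕ u) (toℕ<n v))
      (≤-trans (≤-reflexive (trans (+-assoc (3 + n) (n * toℕ u) n)
          (cong (3 + n +_) (trans (+-comm (n * toℕ u) n) (sym (*-suc n (toℕ u)))))))
        (≤-trans (+-monoʳ-≤ (3 + n) (*-monoʳ-≤ n (toℕ<n u))) input-length)))

  header-address : ∀ {a} → a < 3 → a < L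
  header-address a<3 = ≤-trans a<3 (≤-trans (m≤m+n 3 n) (≤-trans (m≤m+n (3 + n) (n * n)) input-length))

  weight-address : ∀ (v : Fin n) → 3 + toℕ v < L
  weight-address v = ≤-trans (+-monoʳ-< 3 (toℕ<n v)) (≤-trans (m≤m+n (3 + n) (n * n)) input-length)

  module On (μ : Memory) (intact : Intact μ) =
    Values A irreflexive C w L μ
      (λ u v → trans (intact _ (adjacency-address u v)) (input-adjacency u v))
      (λ v → trans (intact _ (weight-address v)) (input-weight v))

  γ : Vec ℕ 4
  γ = n ∷ size ∷ Coding.code (λ _ → true) C ∷ L ∷ []

  -- Strong induction along the table. The hypothesis speaks of any memory with the input intact and
  -- the earlier entries in order, so that stale values in later cells do not matter.
  fill-rule : ∀ {s ℓ q x z μ} (Q : ℕ → ℕ → Set) → Intact μ →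
    (∀ μ → Intact μ → ∀ y → y < size → (∀ i → i < y → Q i (μ (L + i))) →
      Q y (eval γ μ entryᵗ (s ∷ ℓ ∷ y ∷ []))) →
    let μ′ = proj₂ (exec γ fillᶜ (ℓ ∷ q ∷ x ∷ s ∷ z ∷ []) μ) in
    Intact μ′ × ∀ i → i < size → Q i (μ′ (L + i))
  fill-rule {s} {ℓ} {μ = μ} Q intact local = iter-rule
    (λ y p → Intact (proj₂ p) × ∀ i → i < y → Q i (proj₂ p (L + i))) size (intact , λ _ ()) step
    where
    step : ∀ y {p : ℕ × Memory} → y < size → (Intact (proj₂ p) × ∀ i → i < y → Q i (proj₂ p (L + i))) →
      let μ′ = proj₂ p [ L + y ↦ eval γ (proj₂ p) entryᵗ (s ∷ ℓ ∷ y ∷ []) ] in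
      Intact μ′ × ∀ i → i < suc y → Q i (μ′ (L + i))
    step y {_ , ν} y<size (ν-intact , filled) =
      (λ a a<L → trans (update-other ν (L + y) e (<⇒≢ (≤-trans a<L (m≤m+n L y)))) (ν-intact a a<L)) ,
      λ i i<1+y → [ (λ i<y → subst (Q i) (sym (update-other ν (L + y) e (<⇒≢ (+-monoʳ-< L i<y)))) (filled i i<y))
                  , (λ { refl → subst (Q y) (sym (update-same ν (L + y) e)) (local ν ν-intact y y<size filled) }) ]′
                  (m≤n⇒m<n∨m≡n (≤-pred i<1+y))
      where e = eval γ ν entryᵗ (s ∷ ℓ ∷ y ∷ [])

  module _ {s : VertexSet n} (s⊆C : s ⊆ᵇ C) (ℓ : ℕ) where

    Sound : ℕ → ℕ → Set
    Sound i x = ∀ f → f ⊆ᵇ C → code f ≡ i → x ≡ 0 ⊎ ∃ λ h → Kept s ℓ f h × x ≡ suc (total w h)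

    code-smaller : ∀ {f p} → p ⊆ᵇ f → 1 ≤ code p → code (f ∖ᵇ p) < code f
    code-smaller {f} {p} p⊆f p≥1 = ≤-trans (≤-reflexive (+-comm 1 _))
      (≤-trans (+-monoʳ-≤ (code (f ∖ᵇ p)) p≥1) (≤-reflexive (sym (code-∖ p⊆f))))

    sound-local : ∀ μ → Intact μ → ∀ y → y < size → (∀ i → i < y → Sound i (μ (L + i))) →
                  Sound y (eval γ μ entryᵗ (code s ∷ ℓ ∷ y ∷ []))
    sound-local μ intact y y<size ih f f⊆C refl with 1 ≤ⁿ? code f
    ... | no ¬f≥1 = inj₂ (∅ᵇ , kept-empty (λ v fv → ¬f≥1 (code-positive (f⊆C v fv) fv)) ,
            trans (cong (On.entry μ intact s⊆C ℓ) (n<1⇒n≡0 (≰⇒> ¬f≥1)))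
              (trans (On.entry-0 μ intact s⊆C ℓ) (cong suc (sym (sum-0 {n} {part w ∅ᵇ} λ v → refl)))))
    ... | yes f≥1 with On.entry-choice μ intact s⊆C {f} ℓ f⊆C f≥1
    ...   | inj₁ eq = inj₁ eq
    ...   | inj₂ (p , p⊆f , p≥1 , p-valid , light , filled , eq)
            with ih (code (f ∖ᵇ p)) (code-smaller p⊆f p≥1) (f ∖ᵇ p) (λ v q → f⊆C v (proj₁ (∧-split q))) refl
    ...     | inj₁ zero-entry = contradiction (subst (1 ≤_) zero-entry filled) λ ()
    ...     | inj₂ (h , kept , eq′) = inj₂ (h ∪ᵇ region s p , kept-step f⊆C p⊆f p-valid kept light ,
              trans eq (trans (cong (_+ total w (region s p)) eq′) (cong suc additive)))
      where
      additive : total w h + total w (region s p) ≡ total w (h ∪ᵇ region s p)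
      additive = ≤-antisym
        (total-pack w h (region s p) (h ∪ᵇ region s p) (region-disjoint f⊆C p⊆f p-valid kept) λ v → [ ∨-left , ∨-right {h v} ]′)
        (total-cover w (h ∪ᵇ region s p) h (region s p) λ v → ∨-split)

  -- The blocks B contain the components of the graph without D.
  Feasible : Set
  Feasible = negative ≡ false × Σ[ D ∈ VertexSet n ] Σ[ ℓ ∈ ℕ ] total w D + ℓ ≤ k ×
    (∀ u → ¬ (D u ≡ true) → Σ[ B ∈ VertexSet n ] B u ≡ true × total w B ≤ ℓ ×
      (∀ x y → B x ≡ true → ¬ (D y ≡ true) → A x y ≡ true → B y ≡ true))

  module Attempt {s q : VertexSet n} (s⊆C : s ⊆ᵇ C) (q⊆C : q ⊆ᵇ C) (x z : ℕ) (μ : Memory) (intact : Intact μ) where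

    ℓ : ℕ
    ℓ = On.limit μ intact s⊆C q

    filled : Memory
    filled = proj₂ (exec γ fillᶜ (ℓ ∷ code q ∷ x ∷ code s ∷ z ∷ []) μ)

    filled-intact : Intact filled
    -- The trivial property is enough to learn that filling the table leaves the input alone.
    filled-intact = proj₁ (fill-rule {code s} {ℓ} {code q} {x} {z} {μ} (λ _ _ → ⊤) intact (λ _ _ _ _ _ → tt))

    private
      F : ℕ
      F = filled (L + code (rest s))

      W : ℕ
      W = total w (λ _ → true)

      accepted : Bool
      accepted = not negative ∧ ((1 ≤ᵇ F) ∧ (W + ℓ + 1 ≤ᵇ k + F + total w (isolated s)))

    value : exec γ attemptᶜ (code q ∷ x ∷ code s ∷ z ∷ []) μ ≡ ((if accepted then 1 else x) , filled)
    value = cong (_, filled) (branch-bit accepted 1 x (On.accept-value filled filled-intact s⊆C {negative} {k}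
      (trans (filled-intact 1 (header-address (s≤s (s≤s z≤n)))) input-sign)
      (trans (filled-intact 2 (header-address ≤-refl)) input-absolute) ℓ))

    rest⊆C : rest s ⊆ᵇ C
    rest⊆C v q = proj₁ (∧-split q)

    sound : accepted ≡ true → Feasible
    sound acc with ∧-split {not negative} acc
    ... | nonnegative , acc′ with ∧-split {1 ≤ᵇ F} acc′
    ... | F≥1 , enough with proj₂ (fill-rule {code s} {ℓ} {code q} {x} {z} {μ} (Sound s⊆C ℓ) intact (sound-local s⊆C ℓ))
            (code (rest s)) (code<size (rest s)) (rest s) rest⊆C refl
    ... | inj₁ F≡0 = contradiction (subst (1 ≤_) F≡0 (≤ᵇ-elim F≥1)) λ ()
    ... | inj₂ (h , kept , F≡) = ¬-not (not-elim nonnegative) , deleted s h , ℓ , cheap ,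
            light-blocks kept (On.isolated≤limit μ intact s⊆C q)
      where
      D = total w (deleted s h)
      H = total w h
      I = total w (isolated s)
      open ≤-Reasoning
      cheap : D + ℓ ≤ k
      -- The amount cancelled is the kept weight, the isolated weight and the 1 by which table
      -- entries are shifted.
      cheap = +-cancelʳ-≤ (H + I + 1) (D + ℓ) k (begin
        D + ℓ + (H + I + 1)   ≡⟨ solve 4 (λ d l h i → d :+ l :+ (h :+ i :+ con 1) := d :+ (h :+ i) :+ l :+ con 1) refl D ℓ H I ⟩
        D + (H + I) + ℓ + 1   ≤⟨ +-monoˡ-≤ 1 (+-monoˡ-≤ ℓ (deleted-weight kept)) ⟩
        W + ℓ + 1             ≤⟨ ≤ᵇ-elim enough ⟩
        k + F + I             ≡⟨ cong (λ F → k + F + I) F≡ ⟩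
        k + suc H + I         ≡⟨ solve 3 (λ k h i → k :+ (con 1 :+ h) :+ i := k :+ (h :+ i :+ con 1)) refl k H I ⟩
        k + (H + I + 1)       ∎)

    result-sound : x ≡ 0 ⊎ x ≡ 1 × Feasible →
                   (if accepted then 1 else x) ≡ 0 ⊎ (if accepted then 1 else x) ≡ 1 × Feasible
    result-sound before with accepted in eq
    ... | true  = inj₂ (refl , sound eq)
    ... | false = before

    result-keeps : x ≡ 1 → (if accepted then 1 else x) ≡ 1
    result-keeps refl with accepted
    ... | true  = refl
    ... | false = refl

    module _ (nonnegative : negative ≡ false)
             (enough : W + ℓ + 1 ≤ k + F + total w (isolated s)) (F≥1 : 1 ≤ F) where

      result-accepts : (if accepted then 1 else x) ≡ 1
      result-accepts = cong (if_then 1 else x)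
        (∧-join (cong not nonnegative) (∧-join (≤ᵇ-intro F≥1) (≤ᵇ-intro enough)))

    F-filled : (Q : ℕ → ℕ → Set) →
      (∀ μ → Intact μ → ∀ y → y < size → (∀ i → i < y → Q i (μ (L + i))) → Q y (eval γ μ entryᵗ (code s ∷ ℓ ∷ y ∷ []))) →
      Q (code (rest s)) F
    F-filled Q local = proj₂ (fill-rule {code s} {ℓ} {code q} {x} {z} {μ} Q intact local) (code (rest s)) (code<size (rest s))

  search-sound : let x = proj₁ (exec γ searchᶜ [] input) in x ≡ 0 ⊎ x ≡ 1 × Feasible
  search-sound = proj₂ (iter-rule (λ _ → Invariant) {0 , input} size ((λ _ _ → refl) , inj₁ refl)
    λ i {p} i<size inv → iter-rule (λ _ → Invariant) size inv λ j j<size → step i j i<size j<size (proj₁ p))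
    where
    Invariant : ℕ × Memory → Set
    Invariant (x , μ) = Intact μ × (x ≡ 0 ⊎ x ≡ 1 × Feasible)

    step : ∀ i j → i < size → j < size → ∀ z {p} → Invariant p →
           Invariant (exec γ attemptᶜ (j ∷ proj₁ p ∷ i ∷ z ∷ []) (proj₂ p))
    step i j i<size j<size z {x , μ} (intact , before) with code-surjective i<size | code-surjective j<size
    ... | s , s⊆C , refl | q , q⊆C , refl = subst Invariant (sym (Attempt.value s⊆C q⊆C x z μ intact))
      (Attempt.filled-intact s⊆C q⊆C x z μ intact , Attempt.result-sound s⊆C q⊆C x z μ intact before)

  module _ {S component m} (components : Components A w S component m)
           (nonnegative : negative ≡ false) (affordable : total w S + m ≤ k) where

    private
      module O = Optimal components

      s q : VertexSet n
      s = O.s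
      q = proj₁ O.heaviest

      s⊆C : s ⊆ᵇ C
      s⊆C v r = proj₁ (∧-split r)

      q⊆C : q ⊆ᵇ C
      q⊆C = proj₁ (proj₂ O.heaviest)

    -- A lower bound is claimed only for unions of whole traces of components. Removing one trace
    -- leaves such a union, so the induction stays among them.
    Complete : ℕ → ℕ → Set
    Complete i x = ∀ f → f ⊆ᵇ rest s → O.Closed f → code f ≡ i → suc (total w (O.attachedTo f)) ≤ x

    complete-local : ∀ {ℓ} → (∀ u → rest s u ≡ true → total w (region s (O.part-of u)) ≤ ℓ) →
      ∀ μ → Intact μ → ∀ y → y < size → (∀ i → i < y → Complete i (μ (L + i))) →
      Complete y (eval γ μ entryᵗ (code s ∷ ℓ ∷ y ∷ []))
    complete-local {ℓ} light μ intact y y<size ih f f⊆rest closed refl with some f ≟ᵇ true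
    ... | no none = ≤-reflexive (trans (cong suc (O.attachedTo-empty f empty))
            (sym (trans (cong (On.entry μ intact s⊆C ℓ) (code-empty empty)) (On.entry-0 μ intact s⊆C ℓ))))
      where
      empty : ∀ v → ¬ (f v ≡ true)
      empty v fv = none (some-intro v fv)
    ... | yes nonempty = ≤-trans (s≤s (O.attachedTo-∖ f u))
            (≤-trans (+-monoˡ-≤ (total w (region s p)) earlier)
              (On.entry-lower μ intact s⊆C {f} {p} ℓ (λ v fv → proj₁ (∧-split (f⊆rest v fv))) p⊆f p≥1
                (O.part-of-valid u ru) (light u ru) (≤-trans (s≤s z≤n) earlier)))
      where
      u = proj₁ (some-elim {f = f} nonempty)
      fu = proj₂ (some-elim {f = f} nonempty)
      ru = f⊆rest u fu
      p = O.part-of u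
      p⊆f : p ⊆ᵇ f
      p⊆f v = closed u v fu
      p≥1 : 1 ≤ code p
      p≥1 = code-positive (proj₁ (∧-split ru)) (O.part-of-self u ru)
      earlier : suc (total w (O.attachedTo (f ∖ᵇ p))) ≤ μ (L + code (f ∖ᵇ p))
      earlier = ih (code (f ∖ᵇ p)) (code-smaller s⊆C ℓ p⊆f p≥1) (f ∖ᵇ p)
        (λ v r → f⊆rest v (proj₁ (∧-split r))) (O.∖-closed f u f⊆rest closed) refl

    module _ (x z : ℕ) (μ : Memory) (intact : Intact μ) where

      private
        module T = Attempt s⊆C q⊆C x z μ intact

        F : ℕ
        F = T.filled (L + code (rest s))

        complete : suc (total w (O.attachedTo (rest s))) ≤ F
        complete = T.F-filled Complete (complete-local λ u ru →
          ≤-trans (proj₁ (proj₂ (proj₂ O.heaviest)) u ru) (On.region≤limit μ intact s⊆C q⊆C))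
          (rest s) (λ _ r → r) O.rest-closed refl

        R = total w O.remaining

        -- The limit is a maximum of weights each of which, together with `R`, is at most
        -- `total w S + m` by the exchange bounds; `R` itself is too, so the truncated difference
        -- can be undone.
        remaining+limit : R + T.ℓ ≤ k
        remaining+limit = begin
          R + T.ℓ                    ≤⟨ +-monoʳ-≤ R (On.limit≤ μ intact s⊆C {q} {k ∸ R} q⊆C
                                          (bound (proj₂ (proj₂ (proj₂ O.heaviest))))
                                          (λ v i → bound (O.isolated-bound v i))) ⟩
          R + (k ∸ R)                ≡⟨ m+[n∸m]≡n (≤-trans O.remaining-bound affordable) ⟩
          k                          ∎
          where
          open ≤-Reasoning
          bound : ∀ {a} → R + a ≤ total w S + m → a ≤ k ∸ R
          bound {a} le = subst (_≤ k ∸ R) (m+n∸m≡n R a) (∸-monoˡ-≤ R (≤-trans le affordable))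

        enough : total w (λ _ → true) + T.ℓ + 1 ≤ k + F + total w (isolated s)
        enough = begin
          total w (λ _ → true) + T.ℓ + 1 ≤⟨ +-monoˡ-≤ 1 (+-monoˡ-≤ T.ℓ O.total-≤) ⟩
          R + (H + I) + T.ℓ + 1          ≡⟨ solve 4 (λ d l h i → d :+ (h :+ i) :+ l :+ con 1 := d :+ l :+ (con 1 :+ h) :+ i) refl R T.ℓ H I ⟩
          R + T.ℓ + suc H + I            ≤⟨ +-monoˡ-≤ I (+-mono-≤ remaining+limit complete) ⟩
          k + F + I                      ∎
          where
          open ≤-Reasoning
          H = total w (O.attachedTo (rest s))
          I = total w (isolated s)

      hit : proj₁ (exec γ attemptᶜ (code q ∷ x ∷ code s ∷ z ∷ []) μ) ≡ 1
      hit = trans (cong proj₁ T.value) (T.result-accepts nonnegative enough (≤-trans (s≤s z≤n) complete))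

    -- The invariant promises nothing until the pair of the codes of `s` and `q` has been passed;
    -- from then on the result is 1, as no later attempt resets it.
    search-complete : proj₁ (exec γ searchᶜ [] input) ≡ 1
    search-complete = proj₂ (iter-rule Outer {0 , input} size ((λ _ _ → refl) , λ ()) outer) (code<size s)
      where
      Outer : ℕ → ℕ × Memory → Set
      Outer i (x , μ) = Intact μ × (code s < i → x ≡ 1)

      Inner : ℕ → ℕ → ℕ × Memory → Set
      Inner i j (x , μ) = Intact μ × (code s < i ⊎ code s ≡ i × code q < j → x ≡ 1)

      inner : ∀ i j z {p} → i < size → j < size → Inner i j p →
              Inner i (suc j) (exec γ attemptᶜ (j ∷ proj₁ p ∷ i ∷ z ∷ []) (proj₂ p))
      inner i j z {x , μ} i<size j<size (intact , before) with code-surjective i<size | code-surjective j<size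
      ... | s′ , s′⊆C , refl | q′ , q′⊆C , refl =
        subst Intact (sym (cong proj₂ T.value)) T.filled-intact ,
        λ { (inj₁ s<s′) → keep (before (inj₁ s<s′))
          ; (inj₂ (s≡s′ , q≤q′)) → [ (λ q<q′ → keep (before (inj₂ (s≡s′ , q<q′))))
                                   , (λ q≡q′ → subst₂ (λ a b → proj₁ (exec γ attemptᶜ (b ∷ x ∷ a ∷ z ∷ []) μ) ≡ 1)
                                       s≡s′ q≡q′ (hit x z μ intact)) ]′ (m≤n⇒m<n∨m≡n (≤-pred q≤q′)) }
        where
        module T = Attempt s′⊆C q′⊆C x z μ intact
        keep : x ≡ 1 → proj₁ (exec γ attemptᶜ (code q′ ∷ x ∷ code s′ ∷ z ∷ []) μ) ≡ 1
        keep x≡1 = trans (cong proj₁ T.value) (T.result-keeps x≡1)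

      outer : ∀ i {p} → i < size → Outer i p →
              Outer (suc i) (iter size (λ j r → exec γ attemptᶜ (j ∷ proj₁ r ∷ i ∷ proj₁ p ∷ []) (proj₂ r)) p)
      outer i {x , μ} i<size (intact , before) =
        let (intact′ , after) = iter-rule (Inner i) {x , μ} size
              (intact , [ before , (λ ()) ]′) λ j j<size → inner i j x i<size j<size
        in intact′ , λ s≤i → after ([ inj₁ , (λ s≡i → inj₂ (s≡i , code<size q)) ]′ (m≤n⇒m<n∨m≡n (≤-pred s≤i)))

-- The input and the quantities wvi and vc

load-++ : ∀ xs ys a → load (xs ++ ys) (length xs + a) ≡ load ys a
load-++ []       ys a = refl
load-++ (x ∷ xs) ys a = load-++ xs ys a

load-tabulate : ∀ {m} (f : Fin m → ℕ) ys v → load (tabulate f ++ ys) (toℕ v) ≡ f v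
load-tabulate f ys zero    = refl
load-tabulate f ys (suc v) = load-tabulate (f ∘ suc) ys v

length-map-allFin : ∀ {m} (f : Fin m → ℕ) → length (map f (allFin m)) ≡ m
length-map-allFin {m} f = trans (cong length (map-tabulate id f)) (length-tabulate f)

load-map : ∀ {m} (f : Fin m → ℕ) ys v → load (map f (allFin m) ++ ys) (toℕ v) ≡ f v
load-map f ys v = trans (cong (λ xs → load (xs ++ ys) (toℕ v)) (map-tabulate id f)) (load-tabulate f ys v)

load-after-map : ∀ {m} (f : Fin m → ℕ) ys a → load (map f (allFin m) ++ ys) (m + a) ≡ load ys a
load-after-map {m} f ys a = trans
  (cong (λ l → load (map f (allFin m) ++ ys) (l + a)) (sym (length-map-allFin f)))
  (load-++ (map f (allFin m)) ys a)

load-rows : ∀ {m n} {A : Set} (h : A → Fin n → ℕ) (g : Fin m → A) u v →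
  load (concatMap (λ a → map (h a) (allFin n)) (tabulate g)) (n * toℕ u + toℕ v) ≡ h (g u) v
load-rows {n = n} h g zero v rewrite *-zeroʳ n = load-map (h (g zero)) _ v
load-rows {n = n} h g (suc u) v
  rewrite *-suc n (toℕ u) | +-assoc n (n * toℕ u) (toℕ v) =
  trans (load-after-map (h (g zero)) _ (n * toℕ u + toℕ v)) (load-rows h (g ∘ suc) u v)

negativeᵇ : ℤ → Bool
negativeᵇ (ℤ.+ _)    = false
negativeᵇ -[1+ _ ] = true

adjacent : ∀ {n} → Graph n → Fin n → Fin n → Bool
adjacent G u v = does (Adj? G u v)

module _ {n : ℕ} (G : Graph n) (w : Fin n → ℕ) where

  private
    body : List ℕ
    body = map w (allFin n) ++ concatMap (λ u → map (λ v → bit (adjacent G u v)) (allFin n)) (allFin n)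

    skip-header : ∀ k a → load (encode G w k) (3 + a) ≡ load body a
    skip-header (ℤ.+ _)  a = refl
    skip-header -[1+ _ ] a = refl

  encode-sign : ∀ k → load (encode G w k) 1 ≡ bit (negativeᵇ k)
  encode-sign (ℤ.+ _)  = refl
  encode-sign -[1+ _ ] = refl

  encode-absolute : ∀ k → load (encode G w k) 2 ≡ ℤ.∣ k ∣
  encode-absolute (ℤ.+ _)  = refl
  encode-absolute -[1+ _ ] = refl

  encode-weight : ∀ k v → load (encode G w k) (3 + toℕ v) ≡ w v
  encode-weight k v = trans (skip-header k (toℕ v)) (load-map w _ v)

  encode-adjacency : ∀ k u v → load (encode G w k) (3 + n + n * toℕ u + toℕ v) ≡ bit (adjacent G u v)
  encode-adjacency k u v = begin
    load (encode G w k) (3 + (n + n * toℕ u + toℕ v))   ≡⟨ cong (λ a → load (encode G w k) (3 + a)) (+-assoc n (n * toℕ u) (toℕ v)) ⟩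
    load (encode G w k) (3 + (n + (n * toℕ u + toℕ v))) ≡⟨ skip-header k (n + (n * toℕ u + toℕ v)) ⟩
    load body (n + (n * toℕ u + toℕ v))                 ≡⟨ load-after-map w _ (n * toℕ u + toℕ v) ⟩
    load (concatMap (λ u → map (λ v → bit (adjacent G u v)) (allFin n)) (allFin n)) (n * toℕ u + toℕ v)
                                                        ≡⟨ load-rows (λ u v → bit (adjacent G u v)) id u v ⟩
    bit (adjacent G u v)                                ∎
    where open ≡-Reasoning

members : ∀ {n} → Subset n → VertexSet n
members X v = does (v ∈? X)

∈⇒members : ∀ {n} {X : Subset n} {v} → v ∈ X → members X v ≡ true
∈⇒members {X = X} {v} = dec-true (v ∈? X)

members⇒∈ : ∀ {n} {X : Subset n} {v} → members X v ≡ true → v ∈ X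
members⇒∈ {X = X} {v} = does-elim (v ∈? X)

members-tabulate : ∀ {n} (f : VertexSet n) v → members (Vec.tabulate f) v ≡ f v
members-tabulate f v with f v in eq
... | true  = ∈⇒members (lookup⇒[]= v _ (trans (lookup∘tabulate f v) eq))
... | false = dec-false (v ∈? Vec.tabulate f) λ v∈ →
  contradiction (trans (sym ([]=⇒lookup v∈)) (trans (lookup∘tabulate f v) eq)) λ ()

weight≡total : ∀ {n} (w : Fin n → ℕ) X → weight w X ≡ total w (members X)
weight≡total {n} w X = along id
  where
  along : ∀ {m} (g : Fin m → Fin n) →
          ListAction.sum (map w (filter (_∈? X) (tabulate g))) ≡ sum (λ v → if members X (g v) then w (g v) else 0)
  along {zero}  g = refl
  along {suc m} g with members X (g zero) | along (g ∘ suc)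
  ... | true  | eq = cong (w (g zero) +_) eq
  ... | false | eq = eq

count-members : ∀ {n} (X : Subset n) → count (members X) ≡ ∣ X ∣
count-members []            = refl
count-members (inside ∷ X)  = cong suc (count-members X)
count-members (outside ∷ X) = count-members X

∈-allSubsets : ∀ {n} (X : Subset n) → X ∈ˡ allSubsets n
∈-allSubsets []            = here refl
∈-allSubsets (outside ∷ X) = ∈-++⁺ˡ (∈-map⁺ (outside ∷_) (∈-allSubsets X))
∈-allSubsets {suc n} (inside ∷ X) =
  ∈-++⁺ʳ (map (outside ∷_) (allSubsets n)) (∈-map⁺ (inside ∷_) (∈-allSubsets X))

wvi≤integrity : ∀ {n} (G : Graph n) w X → wvi G w ≤ integrity G w X
wvi≤integrity G w X = Allˡ.lookup (min≤xs (integrity G w Subset.⊤) _) (∈-map⁺ (integrity G w) (∈-allSubsets X))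

wvi-attained : ∀ {n} (G : Graph n) w → ∃ λ X → wvi G w ≡ integrity G w X
wvi-attained {n} G w with argmin-sel id (integrity G w Subset.⊤) (map (integrity G w) (allSubsets n))
... | inj₁ eq = Subset.⊤ , eq
... | inj₂ wvi∈ = let (X , _ , eq) = ∈-map⁻ (integrity G w) wvi∈ in X , eq

matched≤2vc : ∀ {n} (G : Graph n) (C : VertexSet n) → Matched (adjacent G) C → count C ≤ 2 * vc G
matched≤2vc {n} G C matched = argmin-all id {P = λ m → count C ≤ 2 * m} trivial
  (Allˡ.map⁺ (Allˡ.map small-cover (Allˡ.all-filter (isVertexCover? G) (allSubsets n))))
  where
  ones≤ : ∀ m → sum {m} (λ _ → 1) ≤ m
  ones≤ zero    = z≤n
  ones≤ (suc m) = s≤s (ones≤ m)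

  -- Accounts for the default candidate `n` in the minimum that defines `vc`.
  trivial : count C ≤ 2 * n
  trivial = ≤-trans (total-mono (λ _ → 1) C (λ _ → true) λ _ _ → refl) (≤-trans (ones≤ n) (m≤m+n n _))

  small-cover : ∀ {X} → IsVertexCover G X → count C ≤ 2 * ∣ X ∣
  small-cover {X} cover = ≤-trans
    (matched (members X) λ u v Auv → [ inj₁ ∘ ∈⇒members , inj₂ ∘ ∈⇒members ]′ (cover u v (does-elim (Adj? G u v) Auv)))
    (*-monoʳ-≤ 2 (≤-trans (total-mono (λ _ → 1) (C ∩ᵇ members X) (members X) λ v q → proj₂ (∧-split {C v} q))
      (≤-reflexive (count-members X))))

-- Components of the graph without a set of vertices

module _ {n : ℕ} (G : Graph n) (w : Fin n → ℕ) (X : Subset n) where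

  reachableᵇ : Fin n → VertexSet n
  reachableᵇ u v = does (reachable? (adjOff? G X) u v)

  private
    reach : ∀ {u v} → reachableᵇ u v ≡ true → Star (AdjOff G X) u v
    reach {u} {v} = does-elim (reachable? (adjOff? G X) u v)

    unreach : ∀ {u v} → Star (AdjOff G X) u v → reachableᵇ u v ≡ true
    unreach {u} {v} = dec-true (reachable? (adjOff? G X) u v)

    ∉⇒ : ∀ {v} → v ∉ X → ¬ (members X v ≡ true)
    ∉⇒ v∉X = v∉X ∘ members⇒∈

    ⇒∉ : ∀ {v} → ¬ (members X v ≡ true) → v ∉ X
    ⇒∉ ¬m = ¬m ∘ ∈⇒members

    component-total : ∀ u → weight w (component G X u) ≡ total w (reachableᵇ u)
    component-total u = trans (weight≡total w (component G X u))
      (total-cong w (members (component G X u)) (reachableᵇ u) (members-tabulate (reachableᵇ u)))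

    end-∉ : ∀ {u v} → u ∉ X → Star (AdjOff G X) u v → v ∉ X
    end-∉ u∉X ε = u∉X
    end-∉ u∉X ((_ , v∉X , _) ◅ rs) = end-∉ v∉X rs

  components-of : Components (adjacent G) w (members X) reachableᵇ (maxComponentWeight G w X)
  components-of = record
    { component-self   = λ u _ → unreach ε
    ; component-avoids = λ u v ¬u r → ∉⇒ (end-∉ (⇒∉ ¬u) (reach r))
    ; component-step   = λ u v x ¬u r Avx ¬x → unreach (reach r ◅◅
        (end-∉ (⇒∉ ¬u) (reach r) , ⇒∉ ¬x , does-elim (Adj? G v x) Avx) ◅ ε)
    ; component-sym    = λ u v r → unreach (reverse (λ (a , b , c) → b , a , symmetric G c) (reach r))
    ; component-trans  = λ u v x r r′ → unreach (reach r ◅◅ reach r′)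
    ; component-weight = λ u ¬u → subst (_≤ maxComponentWeight G w X) (component-total u)
        (Allˡ.lookup (xs≤max 0 _) (∈-map⁺ (weight w) (∈-map⁺ (component G X)
          (∈-filter⁺ (λ v → ¬? (v ∈? X)) (∈-allFin u) (⇒∉ ¬u)))))
    }

  -- A path that avoids `X` cannot leave a block, so every component lies in the block of its
  -- starting vertex.
  integrity≤ : ∀ {ℓ} → (∀ u → ¬ (members X u ≡ true) → Σ[ B ∈ VertexSet n ] B u ≡ true × total w B ≤ ℓ ×
      (∀ x y → B x ≡ true → ¬ (members X y ≡ true) → adjacent G x y ≡ true → B y ≡ true)) →
    integrity G w X ≤ total w (members X) + ℓ
  integrity≤ {ℓ} blocks = +-mono-≤ (≤-reflexive (weight≡total w X))
    (max≤v⁺ z≤n (Allˡ.map⁺ (Allˡ.map⁺ (Allˡ.map light (Allˡ.all-filter (λ v → ¬? (v ∈? X)) (allFin n))))))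
    where
    light : ∀ {u} → u ∉ X → weight w (component G X u) ≤ ℓ
    light {u} u∉X =
      let (B , Bu , B≤ℓ , closed) = blocks u (∉⇒ u∉X)
          within : ∀ {x y} → B x ≡ true → Star (AdjOff G X) x y → B y ≡ true
          within = λ { Bx rs → stay closed Bx rs }
      in ≤-trans (≤-reflexive (component-total u))
           (≤-trans (total-mono w (reachableᵇ u) B λ v r → within Bu (reach r)) B≤ℓ)
      where
      stay : ∀ {B : VertexSet n} → (∀ x y → B x ≡ true → ¬ (members X y ≡ true) → adjacent G x y ≡ true → B y ≡ true) →
             ∀ {x y} → B x ≡ true → Star (AdjOff G X) x y → B y ≡ true
      stay closed Bx ε = Bx
      stay closed Bx ((_ , y∉X , Axy) ◅ rs) =
        stay closed (closed _ _ Bx (∉⇒ y∉X) (dec-true (Adj? G _ _) Axy)) rs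

-- The machine program

-- The number of cells of the input, and hence the first address free for the table.
lengthᵗ : Term 0
lengthᵗ = const 3 ⊹ vertices ⊹ loop small (const 0) (v1 ⊹ vertices)

assignGlobal : Fin 4 → Term 0 → Program
assignGlobal g t = compile t [] 4 ⨾ lookup globals g ≔ reg 4

sizeᵗ : Term 0
sizeᵗ = call (valᵗ inCoverᵗ) (vertices ∷ [])

solver : Program
solver =
  0 ≔ mem[ lit 0 ] ⨾
  assignGlobal (suc (suc (suc zero))) lengthᵗ ⨾
  assignGlobal (suc (suc zero)) coverᵗ ⨾
  assignGlobal (suc zero) sizeᵗ ⨾
  compileCommand searchᶜ [] 4 ⨾
  -- Register 0 has held the number of vertices up to here and only now receives the answer.
  0 ≔ reg 4

solverTime : ℕ → ℕ
solverTime K = 3 + (time K lengthᵗ + 2 + (time K coverᵗ + 2 + (time K sizeᵗ + 2 + (timeCommand K searchᶜ + 2))))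

solverTime-polynomial : Polynomial solverTime
solverTime-polynomial = polynomial-+ (polynomial-const 3)
  (polynomial-+ (phase lengthᵗ) (polynomial-+ (phase coverᵗ) (polynomial-+ (phase sizeᵗ)
    (polynomial-+ (polynomial-timeCommand searchᶜ) (polynomial-const 2)))))
  where
  phase : (t : Term 0) → Polynomial (λ K → time K t + 2)
  phase t = polynomial-+ (polynomial-time t) (polynomial-const 2)

record Reaches (s : State) (P : Program) (b : ℕ) (γ : Vec ℕ 4) (μ : Memory) : Set where
  constructor reaches
  field
    {duration} : ℕ
    {reached}  : State
    halts      : s ⊢ P ⇓[ duration ] reached
    in-time    : duration ≤ b
    ready      : Holds reached [] γ [] μ

open Reaches

put-global : ∀ {s γ μ} g x → Holds s [] γ [] μ → Holds (put s (lookup globals g) x) [] (γ Vec.[ g ]≔ x) [] μ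
put-global zero                   x (holds refl _ m) = holds refl refl m
put-global (suc zero)             x (holds refl _ m) = holds refl refl m
put-global (suc (suc zero))       x (holds refl _ m) = holds refl refl m
put-global (suc (suc (suc zero))) x (holds refl _ m) = holds refl refl m

assign-global : ∀ {γ K s μ} g t → (∀ r → lookup γ (counter r) ≤ K) → Holds s [] γ [] μ →
                Reaches s (assignGlobal g t) (time K t + 2) (γ Vec.[ g ]≔ eval γ μ t []) μ
assign-global {γ} {μ = μ} g t counter≤K h = reaches (⇓seq (runs p) ⇓reg) (+-monoˡ-≤ 2 (fast p))
  (subst (λ x → Holds (put (final p) (lookup globals g) (registers (final p) 4)) [] (γ Vec.[ g ]≔ x) [] μ)
    (yields p)
    (put-global g _ (holds-frame ≤-refl [] h (frame p) (remembers p))))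
  where p = compile-correct counter≤K t ≤-refl [] h

val≡2^ : ∀ D j → Code.val D j ≡ 2 ^ iter j (λ i x → x + bit (D i)) 0
val≡2^ D zero = refl
val≡2^ D (suc j) with D j
... | false = trans (val≡2^ D j) (cong (2 ^_) (sym (+-identityʳ (iter j (λ i x → x + bit (D i)) 0))))
... | true  = trans (cong₂ _+_ (val≡2^ D j) (trans (val≡2^ D j) (sym (+-identityʳ _))))
                (cong (2 ^_) (+-comm 1 (iter j (λ i x → x + bit (D i)) 0)))

size≡2^count : ∀ {n} (C : VertexSet n) → Coding.size C ≡ 2 ^ count C
size≡2^count {n} C = trans (val≡2^ (ext C) n)
  (cong (2 ^_) (iter-sum (λ v → bit (C v)) λ v _ → cong bit (ext-toℕ C v)))

module Correct {n : ℕ} (G : Graph n) (w : Fin n → ℕ) (k : ℤ) where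

  A : Fin n → Fin n → Bool
  A = adjacent G

  irreflexive : ∀ v → ¬ (A v v ≡ true)
  irreflexive v Avv = loopless G (does-elim (Adj? G v v) Avv)

  A-sym : ∀ {u v} → A u v ≡ true → A v u ≡ true
  A-sym {u} {v} Auv = dec-true (Adj? G v u) (symmetric G (does-elim (Adj? G u v) Auv))

  input : Memory
  input = load (encode G w k)

  γ₀ : Vec ℕ 4
  γ₀ = n ∷ 0 ∷ 0 ∷ 0 ∷ []

  L : ℕ
  L = eval γ₀ input lengthᵗ []

  module Phase₁ = CoverValue {n} {0} {0} {L} input A irreflexive (encode-adjacency G w k)

  input-length : 3 + n + n * n ≤ L
  input-length = ≤-reflexive (cong (3 + n +_) (sym (Phase₁.product-value n)))

  C : VertexSet n
  C = proj₁ Phase₁.cover-value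

  cover : IsCover A C
  cover = proj₂ (proj₂ (proj₂ Phase₁.cover-value))

  size≤ : Coding.size C ≤ 2 ^ (2 * vc G)
  size≤ = ≤-trans (≤-reflexive (size≡2^count C))
    (^-monoʳ-≤ 2 (matched≤2vc G C (proj₁ (proj₂ (proj₂ Phase₁.cover-value)))))

  open Search A irreflexive A-sym C cover w L input (negativeᵇ k) ℤ.∣ k ∣ input-length
    (encode-sign G w k) (encode-absolute G w k) (encode-adjacency G w k) (encode-weight G w k)

  answer : ℕ
  answer = proj₁ (exec γ searchᶜ [] input)

  feasible⇒ : Feasible → ℤ.+ wvi G w ℤ.≤ k
  feasible⇒ (nonnegative , D , ℓ , cheap , blocks) = conclude k nonnegative (≤-trans (wvi≤integrity G w X)
    (≤-trans (integrity≤ G w X blocks′) (subst (λ d → d + ℓ ≤ ℤ.∣ k ∣) (sym (total-cong w (members X) D (members-tabulate D))) cheap)))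
    where
    X : Subset n
    X = Vec.tabulate D

    conclude : ∀ k → negativeᵇ k ≡ false → wvi G w ≤ ℤ.∣ k ∣ → ℤ.+ wvi G w ℤ.≤ k
    conclude (ℤ.+ _) _ le = ℤ.+≤+ le

    same : ∀ {v} → ¬ (members X v ≡ true) → ¬ (D v ≡ true)
    same {v} ¬m Dv = ¬m (trans (members-tabulate D v) Dv)

    blocks′ : ∀ u → ¬ (members X u ≡ true) → Σ[ B ∈ VertexSet n ] B u ≡ true × total w B ≤ ℓ ×
      (∀ x y → B x ≡ true → ¬ (members X y ≡ true) → A x y ≡ true → B y ≡ true)
    blocks′ u ¬u = let (B , Bu , B≤ℓ , closed) = blocks u (same ¬u)
      in B , Bu , B≤ℓ , λ x y Bx ¬y → closed x y Bx (same ¬y)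

  ⇒accepted : ℤ.+ wvi G w ℤ.≤ k → answer ≡ 1
  ⇒accepted le = search-complete (components-of G w X) (nonnegative k le)
    (≤-trans (≤-reflexive (trans (cong (_+ maxComponentWeight G w X) (sym (weight≡total w X))) (sym eq))) (absolute k le))
    where
    X = proj₁ (wvi-attained G w)
    eq = proj₂ (wvi-attained G w)

    nonnegative : ∀ k → ℤ.+ wvi G w ℤ.≤ k → negativeᵇ k ≡ false
    nonnegative (ℤ.+ _) _ = refl

    absolute : ∀ k → ℤ.+ wvi G w ℤ.≤ k → wvi G w ≤ ℤ.∣ k ∣
    absolute (ℤ.+ _) (ℤ.+≤+ le) = le

  answer-correct : answer ≡ bit (does (ℤ.+ wvi G w ℤ.≤? k))
  answer-correct with ℤ.+ wvi G w ℤ.≤? k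
  ... | yes le = ⇒accepted le
  ... | no ¬le = [ id , (λ (_ , feasible) → contradiction (feasible⇒ feasible) ¬le) ]′ search-sound

  module _ {K : ℕ} (n≤K : n ≤ K) (size≤K : Coding.size C ≤ K) where

    private
      c : ℕ
      c = eval (n ∷ 0 ∷ 0 ∷ L ∷ []) input coverᵗ []

      γ₂ γ₃ : Vec ℕ 4
      γ₂ = n ∷ 0 ∷ c ∷ L ∷ []
      γ₃ = n ∷ eval γ₂ input sizeᵗ [] ∷ c ∷ L ∷ []

      c≡ : c ≡ Coding.code (λ _ → true) C
      c≡ = sym (proj₁ (proj₂ Phase₁.cover-value))

      γ₃≡γ : γ₃ ≡ γ
      γ₃≡γ = trans
        (cong (λ c → n ∷ eval (n ∷ 0 ∷ c ∷ L ∷ []) input sizeᵗ [] ∷ c ∷ L ∷ []) c≡)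
        (cong (λ M → n ∷ M ∷ Coding.code (λ _ → true) C ∷ L ∷ [])
          (InCover.size-value {n} {0} {L} A irreflexive C input (encode-adjacency G w k)))

      unset≤K : ∀ {c L} r → lookup (n ∷ 0 ∷ c ∷ L ∷ []) (counter r) ≤ K
      unset≤K small = n≤K
      -- The number of codes is still 0 in the phases before it is computed.
      unset≤K large = z≤n

      set≤K : ∀ r → lookup γ (counter r) ≤ K
      set≤K small = n≤K
      set≤K large = size≤K

    run : Σ[ t ∈ ℕ ] Σ[ s ∈ State ] (initial (encode G w k) ⊢ solver ⇓[ t ] s) ×
          output s ≡ bit (does (ℤ.+ wvi G w ℤ.≤? k)) × t ≤ solverTime K
    run = _ , _ ,
      ⇓seq ⇓reg (⇓seq (halts r₁) (⇓seq (halts r₂) (⇓seq (halts r₃) (⇓seq (runs p) ⇓reg)))) ,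
      trans (yields p) answer-correct ,
      +-monoʳ-≤ 3 (+-mono-≤ (in-time r₁) (+-mono-≤ (in-time r₂) (+-mono-≤ (in-time r₃) (+-monoˡ-≤ 2 (fast p)))))
      where
      r₁ : Reaches (put (initial (encode G w k)) 0 n) (assignGlobal (suc (suc (suc zero))) lengthᵗ)
             (time K lengthᵗ + 2) (n ∷ 0 ∷ 0 ∷ L ∷ []) input
      r₁ = assign-global (suc (suc (suc zero))) lengthᵗ unset≤K (holds refl refl refl)
      r₂ : Reaches (reached r₁) (assignGlobal (suc (suc zero)) coverᵗ) (time K coverᵗ + 2) γ₂ input
      r₂ = assign-global (suc (suc zero)) coverᵗ unset≤K (ready r₁)
      r₃ : Reaches (reached r₂) (assignGlobal (suc zero) sizeᵗ) (time K sizeᵗ + 2) γ₃ input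
      r₃ = assign-global (suc zero) sizeᵗ unset≤K (ready r₂)
      p : Outcome (reached r₃) (compileCommand searchᶜ [] 4) (timeCommand K searchᶜ) 4
            (proj₁ (exec γ searchᶜ [] input)) (proj₂ (exec γ searchᶜ [] input))
      p = compileCommand-correct set≤K searchᶜ ≤-refl []
        (subst (λ γ → Holds (reached r₃) [] γ [] input) γ₃≡γ (ready r₃))

*-^ : ∀ m n o → (m * n) ^ o ≡ m ^ o * n ^ o
*-^ m n zero    = refl
*-^ m n (suc o) = trans (cong (m * n *_) (*-^ m n o)) ([m*n]*[o*p]≡[m*o]*[n*p] m n (m ^ o) (n ^ o))

-- Explains the constant `2 * c` in the exponent: the factor 2 is that of the greedy cover, and `c`
-- is the degree of the polynomial in `K`.
rearranged : ∀ a c n v → a * (2 ^ (2 * v) * (n ⊔ 1)) ^ c ≡ a * 2 ^ (2 * c * v) * (n ⊔ 1) ^ c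
rearranged a c n v = begin
  a * (2 ^ (2 * v) * (n ⊔ 1)) ^ c          ≡⟨ cong (a *_) (*-^ (2 ^ (2 * v)) (n ⊔ 1) c) ⟩
  a * ((2 ^ (2 * v)) ^ c * (n ⊔ 1) ^ c)    ≡⟨ cong (λ x → a * (x * (n ⊔ 1) ^ c)) (^-*-assoc 2 (2 * v) c) ⟩
  a * (2 ^ (2 * v * c) * (n ⊔ 1) ^ c)      ≡⟨ cong (λ e → a * (2 ^ e * (n ⊔ 1) ^ c)) exponent ⟩
  a * (2 ^ (2 * c * v) * (n ⊔ 1) ^ c)      ≡⟨ *-assoc a (2 ^ (2 * c * v)) ((n ⊔ 1) ^ c) ⟨
  a * 2 ^ (2 * c * v) * (n ⊔ 1) ^ c        ∎
  where
  open ≡-Reasoning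
  exponent : 2 * v * c ≡ 2 * c * v
  exponent = trans (*-assoc 2 v c) (trans (cong (2 *_) (*-comm v c)) (sym (*-assoc 2 c v)))

open import Data.Integer.Base using (+_)
open import Data.Integer.Properties using (_≤?_)

theorem16 : Σ[ P ∈ Program ] Σ[ a ∈ ℕ ] Σ[ b ∈ ℕ ] Σ[ c ∈ ℕ ]
    (∀ (n : ℕ) (G : Graph n) (w : Fin n → ℕ) → (∀ v → w v > 0) → (k : ℤ) →
    Σ[ t ∈ ℕ ] Σ[ s ∈ State ]
    (initial (encode G w k) ⊢ P ⇓[ t ] s)
    × output s ≡ bit (does (+ wvi G w ≤? k))
    × t ≤ a * 2 ^ (b * vc G) * (n ⊔ 1) ^ c)
theorem16 = solver , a , 2 * c , c , λ n G w _ k →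
  -- A common bound on both loop counters. The maximum with 1 keeps it positive for the empty graph,
  -- as the polynomial bound demands.
  let K = 2 ^ (2 * vc G) * (n ⊔ 1)
      2^≥1 = m^n>0 2 (2 * vc G)
      N≥1 = m≤n⊔m n 1
      (t , s , run , out , t≤) = Correct.run G w k {K}
        (≤-trans (m≤m⊔n n 1) (m≤n*m (n ⊔ 1) (2 ^ (2 * vc G)) ⦃ >-nonZero 2^≥1 ⦄))
        (≤-trans (Correct.size≤ G w k) (m≤m*n (2 ^ (2 * vc G)) (n ⊔ 1) ⦃ >-nonZero N≥1 ⦄))
  in t , s , run , out , ≤-trans t≤ (≤-trans (bound K (*-mono-≤ 2^≥1 N≥1)) (≤-reflexive (rearranged a c n (vc G))))
  where
  a = proj₁ solverTime-polynomial
  c = proj₁ (proj₂ solverTime-polynomial)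
  bound = proj₂ (proj₂ solverTime-polynomial)
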